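{- For each real $x\ge 4$ let $\ell(x)$ be the least integer $\ell$ with $2\le\ell\le\lfloor \log x/\log 2\rfloor$ such that $\mathrm{S}^{\ell}(x)>2^{ -\ell}\mathrm{V}(x)$ (and $\ell(x)=\infty$ if no such $\ell$ exists). Assume the Hypothesis that $\ell_0:=\liminf_{x\to\infty}\ell(x)<\infty$. Then for every integer $n\ge0$, $$\limsup_{m\in\mathscr{V}^{\ell_0+n}}\mathrm{A}(m)=\infty.$$
   Context: $\phi$ is Euler's totient function, $\mathscr{V}$ its set of values, $\mathrm{A}(m)=|\phi^{ -1}(m)|$, $\mathrm{V}(x)=|\{m\in\mathscr{V}: m\le x\}|$, $\mathscr{V}^{\ell}=\{m\in\mathscr{V}: m\equiv 2^{\ell}\pmod{2^{\ell+1}}\}$, and $\mathrm{S}^{\ell}(x)=\sum_{m\in\mathscr{V}^{\ell},\,m\le x}\mathrm{A}(m)$. $\limsup_{m\in\mathscr{V}^{\ell}}\mathrm{A}(m)=\infty$ means the values $\mathrm{A}(m)$, $m\in\mathscr{V}^{\ell}$, are unbounded. -}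

module Defs where

open import Data.Nat using (ℕ; zero; suc; _+_; _*_; _∸_; _^_; _≤_; _<_; _%_; _≡ᵇ_; _<ᵇ_)
open import Data.Nat.GCD using (gcd)
open import Data.Nat.Logarithm using (⌊log₂_⌋)
open import Data.Bool using (Bool; true; false; if_then_else_)
open import Data.Unit using (⊤)
open import Data.Maybe using (Maybe; just; nothing)
open import Data.Product using (Σ; _×_; ∃; ∃-syntax)
open import Relation.Binary.PropositionalEquality using (_≡_)
open import Data.Nat using (NonZero)
open import Data.Nat.Properties using (m^n≢0)

_mod2^_ : ℕ → ℕ → ℕ
m mod2^ k = _%_ m (2 ^ k) {{m^n≢0 2 k}}

count : (ℕ → Bool) → ℕ → ℕ
count p zero = 0
count p (suc n) = (if p (suc n) then 1 else 0) + count p n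

φ : ℕ → ℕ
φ n = count (λ k → gcd k n ≡ᵇ 1) n

-- A(m) = |φ⁻¹(m)| = #{n ≥ 1 : φ n = m}.  Every n ≥ 1 has φ n ≥ √(n/2), so
-- φ n = m implies n ≤ 2 m², and the preimage is exactly counted in [1, 2 m²].
-- (φ 0 = 0 is not a totient value; n = 0 is excluded as in the paper.)
A : ℕ → ℕ
A m = count (λ n → φ n ≡ᵇ m) (2 * (m * m))

InV : ℕ → Set
InV m = ∃[ n ] (1 ≤ n × φ n ≡ m)

InVℓ : ℕ → ℕ → Set
InVℓ ℓ m = InV m × (m mod2^ (suc ℓ) ≡ 2 ^ ℓ)

-- V(x) = #{m ∈ 𝒱 : m ≤ x}  (for real x this depends only on ⌊x⌋ = N)
V : ℕ → ℕ
V N = count (λ m → 0 <ᵇ A m) N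

-- S^ℓ(x) = Σ_{m ∈ 𝒱^ℓ, m ≤ x} A(m)  (A m = 0 for m ∉ 𝒱)
sumTo : (ℕ → ℕ) → ℕ → ℕ
sumTo f zero = 0
sumTo f (suc n) = f (suc n) + sumTo f n

S : ℕ → ℕ → ℕ
S ℓ N = sumTo (λ m → if m mod2^ (suc ℓ) ≡ᵇ 2 ^ ℓ then A m else 0) N

-- the condition S^ℓ(x) > 2^(-ℓ) V(x), i.e. 2^ℓ S^ℓ(x) > V(x)
good : ℕ → ℕ → Bool
good N ℓ = V N <ᵇ (2 ^ ℓ) * S ℓ N

search : ℕ → ℕ → ℕ → Maybe ℕ
search N ℓ zero = nothing
search N ℓ (suc fuel) = if good N ℓ then just ℓ else search N (suc ℓ) fuel

-- ℓ(x) for x with ⌊x⌋ = N: least ℓ ∈ [2, ⌊log₂ N⌋] with the condition,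
-- nothing standing for ∞.  (⌊log x / log 2⌋ = ⌊log₂ ⌊x⌋⌋.)
ellx : ℕ → Maybe ℕ
ellx N = search N 2 (⌊log₂ N ⌋ ∸ 1)

_≤∞_ : ℕ → Maybe ℕ → Set
L ≤∞ just v = L ≤ v
L ≤∞ nothing = ⊤

LiminfIs : ℕ → Set
LiminfIs L = ((M : ℕ) → ∃[ N ] (M ≤ N × ellx N ≡ just L))
           × (∃[ M ] ((N : ℕ) → M ≤ N → L ≤∞ ellx N))

UnboundedOn : ℕ → Set
UnboundedOn ℓ = (K : ℕ) → ∃[ m ] (InVℓ ℓ m × K ≤ A m)

{-# OPTIONS --safe #-}

-- The hypothesis is contradictory: S^ℓ(x) > 2^(−ℓ) V(x) fails for all large x, for every fixed ℓ.
--
-- If 2^ℓ exactly divides φ(n), then n is a product of at most ℓ + 1 prime powers and n ≤ 2^(ℓ+1) φ(n), so Chebyshev's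
-- upper bound gives S^ℓ(x) ≪ x (log log x)^(ℓ+1) / log x. On the other hand V(x) ≫ x (log log x)^k / log x for every
-- k (Erdős). Indeed (p − 1) e is a totient whenever e is one and p is a large prime. Taking e ≤ y with log y a small
-- power of log x, two such products rarely coincide: (p − 1) e = (p′ − 1) e′ forces p = k v + 1 and p′ = k u + 1 with
-- u / v = e / e′, and Selberg's sieve bounds the number of such k. Hence V(x) ≫ (x / log x) Σ 1/e over the totients
-- e ≤ y, and feeding the bound for k into this sum gains a factor log log x. All scales are powers of 2, so that only
-- natural numbers occur.

module Submission where

open import Defs
open import Data.Bool using (Bool; true; false; if_then_else_; T)
open import Data.Empty using (⊥; ⊥-elim)
open import Data.Nat
open import Data.Nat.Properties
open import Data.Nat.Divisibility
open import Data.Nat.DivMod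
open import Data.Nat.Primality using (Prime; prime?; euclidsLemma; prime⇒nonZero; prime⇒nonTrivial)
open import Data.Nat.Tactic.RingSolver using (solve-∀)
open import Data.Product using (_×_; ∃-syntax; _,_; proj₁; proj₂)
open import Data.Sum using (_⊎_; inj₁; inj₂; [_,_]′)
open import Function using (_∘_; id; case_of_)
open import Relation.Binary.PropositionalEquality
open import Relation.Nullary using (Dec; yes; no; ¬_; contradiction)
open import Relation.Nullary.Decidable using (_×-dec_; ¬?; ⌊_⌋; toWitness; fromWitness; toWitnessFalse)
open import Data.List using (List; []; _∷_; length; _++_; map)
open import Data.Nat.ListAction using (product)
open import Data.List.Relation.Unary.All using (_∷_)
open import Data.Nat.Coprimality using (Coprime; coprime-/gcd; coprime⇒gcd≡1; gcd≡1⇒coprime; coprime-divisor; prime⇒coprime)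
open import Data.Nat.GCD using (gcd; gcd[m,n]∣m; gcd[m,n]∣n; gcd[m,n]≡0⇒m≡0)
open import Data.Nat.Induction using (<-rec)
open import Data.Nat.Primality.Factorisation using (factorise)
open import Data.Nat.Combinatorics using (_C_; nCk+nC[k+1]≡[n+1]C[k+1]; nCk≡n!/k![n-k]!; k![n∸k]!∣n!; k>n⇒nCk≡0)
open import Data.Nat.Logarithm using (⌊log₂[2*b]⌋≡1+⌊log₂b⌋; ⌊log₂_⌋; ⌊log₂⌋-mono-≤; ⌊log₂⌊n/2⌋⌋≡⌊log₂n⌋∸1; ⌊log₂[2^n]⌋≡n)
open import Data.List using (cartesianProductWith)
open import Data.List.Properties using (length-++; length-map)
open import Data.List.Membership.Propositional using (_∈_)
open import Data.List.Membership.Propositional.Properties using (∈-++⁺ˡ; ∈-++⁺ʳ; ∈-map⁺; ∈-cartesianProductWith⁺)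
open import Data.Maybe using (just)
open import Data.List.Relation.Unary.Any using (here; there)
open import Data.Integer using (ℤ) renaming (+_ to ⁺_; ∣_∣ to ‖_‖)
import Data.Integer as ℤ
import Data.Integer.Properties as ℤₚ
import Data.Integer.Tactic.RingSolver as ℤ-Ring
open import Data.Nat.Coprimality using (coprime-Bézout)
open import Data.Nat.GCD using (module Bézout)

-- Everything lost in counting coincidences is a power of log y, whereas the gain is log log y. When
-- log y is a small fixed power of log x, log log y is still comparable to log log x, and a power of
-- log y is harmless against log x. This permits very crude estimates: the singular series of a
-- prime pair is replaced by a square of a linear function of s = log₂ y, because the product of p /
-- (p - 1) over a set of primes is at most one more than their number, and a number B has at most
-- log₂ B prime divisors. Likewise the sieve level is only a small power of x, so that its remainder
-- needs nothing better than a polynomial bound.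
--
-- Reciprocals are avoided throughout. Each sum over squarefree d in the sieve is multiplied by the
-- product of p - 2 or p - 1 over all sieving primes, so that a prime contributes one factor if it
-- divides d and another if it does not; 1 / n becomes N ! / n; sums of 1 / m over totients become
-- sums over dyadic scales.

-- Indicators and finite sums

𝟙 : ∀ {a} {P : Set a} → Dec P → ℕ
𝟙 (yes _) = 1
𝟙 (no _) = 0

module _ {a} {P : Set a} where

  𝟙-yes : (d : Dec P) → P → 𝟙 d ≡ 1
  𝟙-yes (yes _) _ = refl
  𝟙-yes (no ¬p) p = contradiction p ¬p

  𝟙-no : (d : Dec P) → ¬ P → 𝟙 d ≡ 0
  𝟙-no (yes p) ¬p = contradiction p ¬p
  𝟙-no (no _) _ = refl

  𝟙≤1 : (d : Dec P) → 𝟙 d ≤ 1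
  𝟙≤1 (yes _) = ≤-refl
  𝟙≤1 (no _) = z≤n

  𝟙-≤ : ∀ {x} (d : Dec P) → (P → 1 ≤ x) → 𝟙 d ≤ x
  𝟙-≤ (yes p) f = f p
  𝟙-≤ (no _) f = z≤n

  𝟙*-≤ : ∀ {x y} (d : Dec P) → (P → x ≤ y) → 𝟙 d * x ≤ y
  𝟙*-≤ {x} (yes p) f = ≤-trans (≤-reflexive (*-identityˡ x)) (f p)
  𝟙*-≤ (no _) f = z≤n

  𝟙*-≡ : ∀ {x} (d : Dec P) → P → 𝟙 d * x ≡ x
  𝟙*-≡ {x} d p = trans (cong (_* x) (𝟙-yes d p)) (*-identityˡ x)

𝟙-mono : ∀ {a b} {P : Set a} {Q : Set b} (d : Dec P) (e : Dec Q) → (P → Q) → 𝟙 d ≤ 𝟙 e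
𝟙-mono d e f = 𝟙-≤ d (λ p → ≤-reflexive (sym (𝟙-yes e (f p))))

sum-cong : ∀ {f g} n → (∀ i → 1 ≤ i → i ≤ n → f i ≡ g i) → sumTo f n ≡ sumTo g n
sum-cong zero h = refl
sum-cong (suc n) h = cong₂ _+_ (h (suc n) (s≤s z≤n) ≤-refl) (sum-cong n λ i l u → h i l (m≤n⇒m≤1+n u))

sum-mono : ∀ {f g} n → (∀ i → 1 ≤ i → i ≤ n → f i ≤ g i) → sumTo f n ≤ sumTo g n
sum-mono zero h = z≤n
sum-mono (suc n) h = +-mono-≤ (h (suc n) (s≤s z≤n) ≤-refl) (sum-mono n λ i l u → h i l (m≤n⇒m≤1+n u))

sum-+ : ∀ f g n → sumTo (λ i → f i + g i) n ≡ sumTo f n + sumTo g n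
sum-+ f g zero = refl
sum-+ f g (suc n) = trans (cong (f (suc n) + g (suc n) +_) (sum-+ f g n)) (lem (f (suc n)) (g (suc n)) _ _)
  where
  lem : ∀ a b c d → a + b + (c + d) ≡ a + c + (b + d)
  lem = solve-∀

sum-*ˡ : ∀ c f n → sumTo (λ i → c * f i) n ≡ c * sumTo f n
sum-*ˡ c f zero = sym (*-zeroʳ c)
sum-*ˡ c f (suc n) = trans (cong (c * f (suc n) +_) (sum-*ˡ c f n)) (sym (*-distribˡ-+ c _ _))

sum-*ʳ : ∀ c f n → sumTo (λ i → f i * c) n ≡ sumTo f n * c
sum-*ʳ c f zero = refl
sum-*ʳ c f (suc n) = trans (cong (f (suc n) * c +_) (sum-*ʳ c f n)) (sym (*-distribʳ-+ c (f (suc n)) _))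

sum-0 : ∀ n → sumTo (λ _ → 0) n ≡ 0
sum-0 zero = refl
sum-0 (suc n) = sum-0 n

sum-const : ∀ c n → sumTo (λ _ → c) n ≡ n * c
sum-const c zero = refl
sum-const c (suc n) = cong (c +_) (sum-const c n)

sum-≤-const : ∀ {f} c n → (∀ i → 1 ≤ i → i ≤ n → f i ≤ c) → sumTo f n ≤ n * c
sum-≤-const c n h = ≤-trans (sum-mono n h) (≤-reflexive (sum-const c n))

sum-swap : ∀ (f : ℕ → ℕ → ℕ) m n → sumTo (λ i → sumTo (f i) n) m ≡ sumTo (λ j → sumTo (λ i → f i j) m) n
sum-swap f zero n = sym (sum-0 n)
sum-swap f (suc m) n = trans (cong (sumTo (f (suc m)) n +_) (sum-swap f m n)) (sym (sum-+ (f (suc m)) _ n))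

sum-term : ∀ f n i → 1 ≤ i → i ≤ n → f i ≤ sumTo f n
sum-term f zero i l u = contradiction (≤-trans l u) λ ()
sum-term f (suc n) i l u with m≤n⇒m<n∨m≡n u
... | inj₁ i<1+n = ≤-trans (sum-term f n i l (≤-pred i<1+n)) (m≤n+m _ (f (suc n)))
... | inj₂ refl = m≤m+n _ _

sum-add : ∀ f m n → sumTo f (m + n) ≡ sumTo f m + sumTo (λ i → f (m + i)) n
sum-add f m zero = trans (cong (sumTo f) (+-identityʳ m)) (sym (+-identityʳ _))
sum-add f m (suc n) = trans (cong (sumTo f) (+-suc m n))
  (trans (cong₂ _+_ (cong f (sym (+-suc m n))) (sum-add f m n)) (lem (f (m + suc n)) (sumTo f m) _))
  where
  lem : ∀ a b c → a + (b + c) ≡ b + (a + c)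
  lem = solve-∀

sum-monoʳ : ∀ f {m n} → m ≤ n → sumTo f m ≤ sumTo f n
sum-monoʳ f {m} {n} m≤n = ≤-trans (m≤m+n _ _)
  (≤-reflexive (trans (sym (sum-add f m (n ∸ m))) (cong (sumTo f) (m+[n∸m]≡n m≤n))))

sum-suc : ∀ f n → sumTo f (suc n) ≡ f 1 + sumTo (f ∘ suc) n
sum-suc f n = trans (sum-add f 1 n) (cong (_+ sumTo (f ∘ suc) n) (+-identityʳ (f 1)))

sum-unique : ∀ {P : ℕ → Set} (P? : ∀ i → Dec (P i)) n → (∀ i j → P i → P j → i ≡ j) →
             sumTo (λ i → 𝟙 (P? i)) n ≤ 1
sum-unique P? zero u = z≤n
sum-unique P? (suc n) u with P? (suc n)
... | no _ = sum-unique P? n u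
... | yes p = ≤-reflexive (cong suc (trans (sum-cong n (λ i _ i≤n → 𝟙-no (P? i)
                (λ q → <⇒≢ (s≤s i≤n) (u i (suc n) q p)))) (sum-0 n)))

-- In each block of d consecutive indices only the last is a multiple of d, and the incomplete block
-- at the end contains none.
sum-multiples : ∀ f d .{{_ : NonZero d}} y → sumTo (λ i → 𝟙 (d ∣? i) * f i) y ≡ sumTo (λ k → f (d * k)) (y / d)
sum-multiples f d y = trans (cong (sumTo g) (trans (m≡m%n+[m/n]*n y d) (+-comm (y % d) _)))
    (trans (sum-add g (y / d * d) (y % d)) (trans (cong₂ _+_ (blocks (y / d)) (tail {y / d} (y % d) (m%n<n y d))) (+-identityʳ _)))
  where
  g : ℕ → ℕ
  g i = 𝟙 (d ∣? i) * f i
  tail : ∀ {q} r → r < d → sumTo (λ i → g (q * d + i)) r ≡ 0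
  tail {q} r r<d = trans (sum-cong r (λ i 1≤i i≤r → cong (_* f (q * d + i)) (𝟙-no (d ∣? (q * d + i))
    (λ d∣ → <⇒≱ (≤-<-trans i≤r r<d) (∣⇒≤ {{>-nonZero 1≤i}} (∣m+n∣m⇒∣n d∣ (n∣m*n q))))))) (sum-0 r)
  blocks : ∀ q → sumTo g (q * d) ≡ sumTo (λ k → f (d * k)) q
  blocks zero = refl
  blocks (suc q) = begin
    sumTo g (d + q * d) ≡⟨ cong (sumTo g) (+-comm d (q * d)) ⟩
    sumTo g (q * d + d) ≡⟨ sum-add g (q * d) d ⟩
    sumTo g (q * d) + sumTo (λ i → g (q * d + i)) d ≡⟨ cong₂ _+_ (blocks q) (last d refl) ⟩
    sumTo (λ k → f (d * k)) q + f (d * suc q) ≡⟨ +-comm _ (f (d * suc q)) ⟩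
    f (d * suc q) + sumTo (λ k → f (d * k)) q ∎
    where
    open ≡-Reasoning
    -- The block length is named e so that it can be matched against `suc` while d stays the divisor
    -- of the surrounding instance.
    last : ∀ e → e ≡ d → sumTo (λ i → g (q * d + i)) e ≡ f (d * suc q)
    last zero e≡d = contradiction (sym e≡d) (≢-nonZero⁻¹ d)
    last (suc e) refl = trans (cong₂ _+_
      (trans (𝟙*-≡ (d ∣? (q * d + suc e)) (∣m∣n⇒∣m+n (n∣m*n q) ∣-refl)) (cong f (lem q e)))
      (tail {q} e ≤-refl)) (+-identityʳ _)
      where
      lem : ∀ q e → q * suc e + suc e ≡ suc e * suc q
      lem = solve-∀

-- Primes and induction over prime powers

prime⇒2≤ : ∀ {p} → Prime p → 2 ≤ p
prime⇒2≤ {p} pp = nonTrivial⇒n>1 p {{prime⇒nonTrivial pp}}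

prime⇒1≤ : ∀ {p} → Prime p → 1 ≤ p
prime⇒1≤ pp = <⇒≤ (prime⇒2≤ pp)

prime∤1 : ∀ {p} → Prime p → p ∤ 1
prime∤1 pp p∣1 = <⇒≢ (prime⇒2≤ pp) (sym (∣1⇒≡1 p∣1))

prime∤prime : ∀ {p q} → Prime p → Prime q → p ≢ q → p ∤ q
prime∤prime {p} {q} pp pq p≢q p∣q with m≤n⇒m<n∨m≡n (∣⇒≤ {{prime⇒nonZero pq}} p∣q)
... | inj₁ p<q = prime∤1 pp (subst (p ∣_) (prime⇒coprime pq {{prime⇒nonZero pp}} p<q (p∣q , ∣-refl)) ∣-refl)
... | inj₂ p≡q = p≢q p≡q

prime∤-* : ∀ {p} m n → Prime p → p ∤ m → p ∤ n → p ∤ m * n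
prime∤-* m n pp p∤m p∤n p∣mn = [ p∤m , p∤n ]′ (euclidsLemma m n pp p∣mn)

prime∤⇒coprime : ∀ {p k} → Prime p → p ∤ k → Coprime k p
prime∤⇒coprime {p} {k} pp p∤k {d} (d∣k , d∣p) with m≤n⇒m<n∨m≡n (∣⇒≤ {{prime⇒nonZero pp}} d∣p)
... | inj₂ refl = contradiction d∣k p∤k
... | inj₁ d<p with d | d∣p
...   | zero | 0∣p = contradiction (0∣⇒≡0 0∣p) (≢-nonZero⁻¹ p {{prime⇒nonZero pp}})
...   | suc e | d∣p′ = prime⇒coprime pp d<p (d∣p′ , ∣-refl)

∃-prime-divisor : ∀ n → 2 ≤ n → ∃[ p ] (Prime p × p ∣ n)
∃-prime-divisor n 2≤n with factorise n {{>-nonZero (<⇒≤ 2≤n)}}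
... | record { factors = [] ; isFactorisation = n≡1 } = contradiction n≡1 (<⇒≢ 2≤n ∘ sym)
... | record { factors = p ∷ ps ; isFactorisation = eq ; factorsPrime = pp ∷ _ } =
  p , pp , subst (p ∣_) (sym eq) (m∣m*n (product ps))

strip : ∀ {p} → Prime p → ∀ n → 1 ≤ n → ∃[ a ] ∃[ m ] (n ≡ p ^ a * m × p ∤ m)
strip {p} pp = <-rec _ go
  where
  go : ∀ n → (∀ {k} → k < n → 1 ≤ k → ∃[ a ] ∃[ m ] (k ≡ p ^ a * m × p ∤ m)) →
       1 ≤ n → ∃[ a ] ∃[ m ] (n ≡ p ^ a * m × p ∤ m)
  go n rec 1≤n with p ∣? n
  ... | no p∤n = 0 , n , sym (*-identityˡ n) , p∤n
  ... | yes (divides q n≡q*p) with q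
  ...   | zero = contradiction n≡q*p (<⇒≢ 1≤n ∘ sym)
  ...   | suc q′ with rec (≤-trans (m<m*n (suc q′) p (prime⇒2≤ pp)) (≤-reflexive (sym n≡q*p))) (s≤s z≤n)
  ...     | a , m , q≡ , p∤m = suc a , m , trans n≡q*p (trans (cong (_* p) q≡) (lem (p ^ a) m p)) , p∤m
    where
    lem : ∀ x m p → x * m * p ≡ p * x * m
    lem = solve-∀

-- Removing the full power of a prime at once leaves a factor prime to it, which is the situation in
-- which `φ` is multiplicative.
primePower-ind : ∀ {ℓ} (P : ℕ → Set ℓ) → P 1 →
  (∀ p a m → Prime p → p ∤ m → 1 ≤ m → P m → P (p ^ suc a * m)) → ∀ n → 1 ≤ n → P n
primePower-ind P P1 step = <-rec _ go
  where
  go : ∀ n → (∀ {k} → k < n → 1 ≤ k → P k) → 1 ≤ n → P n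
  go n rec 1≤n with m≤n⇒m<n∨m≡n 1≤n
  ... | inj₂ refl = P1
  ... | inj₁ 2≤n with ∃-prime-divisor n 2≤n
  ...   | p , pp , p∣n with strip pp n 1≤n
  ...     | zero , m , eq , p∤m = contradiction (subst (p ∣_) (trans eq (*-identityˡ m)) p∣n) p∤m
  ...     | suc a , zero , eq , p∤m = contradiction (p ∣0) p∤m
  ...     | suc a , suc m′ , eq , p∤m = subst P (sym eq) (step p a (suc m′) pp p∤m (s≤s z≤n) (rec m<n (s≤s z≤n)))
    where
    m<n : suc m′ < n
    m<n = ≤-trans (m<m*n (suc m′) (p ^ suc a)
            (≤-trans (prime⇒2≤ pp) (m≤m*n p (p ^ a) {{m^n≢0 p a {{prime⇒nonZero pp}}}})))
            (≤-reflexive (trans (*-comm (suc m′) _) (sym eq)))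

-- By induction D = t m for the part m of n prime to p; the power of p divides t m, hence t, as p
-- does not divide m.
∣-primePowers : ∀ D n → 1 ≤ n → (∀ p a → Prime p → p ^ a ∣ n → p ^ a ∣ D) → n ∣ D
∣-primePowers D = primePower-ind (λ n → (∀ p a → Prime p → p ^ a ∣ n → p ^ a ∣ D) → n ∣ D) (λ _ → 1∣ D) step
  where
  cancel : ∀ {p} → Prime p → ∀ a m t → p ∤ m → p ^ a ∣ m * t → p ^ a ∣ t
  cancel pp zero m t p∤m _ = 1∣ t
  cancel {p} pp (suc a) m t p∤m pa∣ with euclidsLemma m t pp (∣-trans (m∣m*n (p ^ a)) pa∣)
  ... | inj₁ p∣m = contradiction p∣m p∤m
  ... | inj₂ (divides t′ refl) = subst (p ^ suc a ∣_) (*-comm p t′) (*-monoʳ-∣ p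
          (cancel pp a m t′ p∤m (*-cancelˡ-∣ p {{prime⇒nonZero pp}} (subst (p ^ suc a ∣_) (lem m t′ p) pa∣))))
    where
    lem : ∀ m t p → m * (t * p) ≡ p * (m * t)
    lem = solve-∀
  step : ∀ p a m → Prime p → p ∤ m → 1 ≤ m → ((∀ q b → Prime q → q ^ b ∣ m → q ^ b ∣ D) → m ∣ D) →
         (∀ q b → Prime q → q ^ b ∣ p ^ suc a * m → q ^ b ∣ D) → p ^ suc a * m ∣ D
  step p a m pp p∤m _ ih h with ih (λ q b pq qb∣m → h q b pq (∣n⇒∣m*n (p ^ suc a) qb∣m))
  ... | divides t refl = *-pres-∣ (cancel pp (suc a) m t p∤m
          (subst (p ^ suc a ∣_) (*-comm t m) (h p (suc a) pp (m∣m*n m)))) ∣-refl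

primeProd : (ℕ → Bool) → (ℕ → ℕ) → ℕ → ℕ
primeProd b f zero = 1
primeProd b f (suc w) = if b (suc w) then f (suc w) * primeProd b f w else primeProd b f w

prime∤primeProd : ∀ b → (∀ p → T (b p) → Prime p) → ∀ p w → Prime p → w < p → p ∤ primeProd b id w
prime∤primeProd b bp p zero pp _ = prime∤1 pp
prime∤primeProd b bp p (suc w) pp w<p with b (suc w) | bp (suc w)
... | false | _ = prime∤primeProd b bp p w pp (<⇒≤ w<p)
... | true | h = prime∤-* (suc w) _ pp (prime∤prime pp (h _) (<⇒≢ w<p ∘ sym)) (prime∤primeProd b bp p w pp (<⇒≤ w<p))

primeProd∣ : ∀ b B → (∀ p → T (b p) → Prime p) → (∀ p → T (b p) → p ∣ B) → ∀ w → primeProd b id w ∣ B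
primeProd∣ b B bp b∣ zero = 1∣ B
primeProd∣ b B bp b∣ (suc w) with b (suc w) in eq
... | false = primeProd∣ b B bp b∣ w
... | true with primeProd∣ b B bp b∣ w
...   | divides t refl with euclidsLemma t (primeProd b id w) (bp _ Tb) (b∣ _ Tb)
  where
  Tb : T (b (suc w))
  Tb = subst T (sym eq) _
...     | inj₁ p∣t = *-pres-∣ p∣t ∣-refl
...     | inj₂ p∣D = contradiction p∣D (prime∤primeProd b bp (suc w) w (bp _ (subst T (sym eq) _)) ≤-refl)

-- Euler's totient function

if-𝟙 : ∀ {a} {P : Set a} (b : Bool) (d : Dec P) → (T b → P) → (P → T b) → (if b then 1 else 0) ≡ 𝟙 d
if-𝟙 true (yes _) _ _ = refl
if-𝟙 true (no ¬p) f _ = contradiction (f _) ¬p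
if-𝟙 false (yes p) _ g = ⊥-elim (g p)
if-𝟙 false (no _) _ _ = refl

count≡sum : ∀ {P : ℕ → Set} (b : ℕ → Bool) (P? : ∀ k → Dec (P k)) →
            (∀ k → T (b k) → P k) → (∀ k → P k → T (b k)) → ∀ n → count b n ≡ sumTo (λ k → 𝟙 (P? k)) n
count≡sum b P? f g zero = refl
count≡sum b P? f g (suc n) = cong₂ _+_ (if-𝟙 (b (suc n)) (P? (suc n)) (f _) (g _)) (count≡sum b P? f g n)

coprimeTo : ℕ → ℕ → ℕ
coprimeTo m k = 𝟙 (gcd k m ≟ 1)

φ≡sum : ∀ n → φ n ≡ sumTo (coprimeTo n) n
φ≡sum n = count≡sum _ (λ k → gcd k n ≟ 1) (λ k → ≡ᵇ⇒≡ _ _) (λ k → ≡⇒≡ᵇ _ _) n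

𝟙-cong : ∀ {a b} {P : Set a} {Q : Set b} (d : Dec P) (e : Dec Q) → (P → Q) → (Q → P) → 𝟙 d ≡ 𝟙 e
𝟙-cong d e f g = ≤-antisym (𝟙-mono d e f) (𝟙-mono e d g)

sum-periodic : ∀ f m → (∀ k → f (m + k) ≡ f k) → ∀ q → sumTo f (q * m) ≡ q * sumTo f m
sum-periodic f m per zero = refl
sum-periodic f m per (suc q) = trans (sum-add f m (q * m))
  (cong (sumTo f m +_) (trans (sum-cong (q * m) (λ k _ _ → per k)) (sum-periodic f m per q)))

coprimeTo-periodic : ∀ m k → coprimeTo m (m + k) ≡ coprimeTo m k
coprimeTo-periodic m k = 𝟙-cong (gcd (m + k) m ≟ 1) (gcd k m ≟ 1)
  (λ e → coprime⇒gcd≡1 λ (d∣k , d∣m) → gcd≡1⇒coprime {m + k} {m} e (∣m∣n⇒∣m+n d∣m d∣k , d∣m))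
  (λ e → coprime⇒gcd≡1 λ (d∣mk , d∣m) → gcd≡1⇒coprime {k} {m} e (∣m+n∣m⇒∣n d∣mk d∣m , d∣m))

coprime-*ʳ : ∀ {k p m} → Coprime k p → Coprime k m → Coprime k (p * m)
coprime-*ʳ {k} {p} {m} cp cm (d∣k , d∣pm) =
  cm (d∣k , coprime-divisor {m = _} {n = p} (λ (e∣d , e∣p) → cp (∣-trans e∣d d∣k , e∣p)) d∣pm)

-- Being coprime to p m and to m is the same thing here, so p full periods of length m are counted.
φ-∣ : ∀ {p m} → Prime p → p ∣ m → φ (p * m) ≡ p * φ m
φ-∣ {p} {m} pp p∣m = begin
  φ (p * m) ≡⟨ φ≡sum (p * m) ⟩
  sumTo (coprimeTo (p * m)) (p * m) ≡⟨ sum-cong (p * m) (λ k _ _ → 𝟙-cong (gcd k (p * m) ≟ 1) (gcd k m ≟ 1) (to k) (from k)) ⟩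
  sumTo (coprimeTo m) (p * m) ≡⟨ sum-periodic (coprimeTo m) m (coprimeTo-periodic m) p ⟩
  p * sumTo (coprimeTo m) m ≡⟨ cong (p *_) (φ≡sum m) ⟨
  p * φ m ∎
  where
  open ≡-Reasoning
  to : ∀ k → gcd k (p * m) ≡ 1 → gcd k m ≡ 1
  to k e = coprime⇒gcd≡1 λ (d∣k , d∣m) → gcd≡1⇒coprime {k} {p * m} e (d∣k , ∣n⇒∣m*n p d∣m)
  from : ∀ k → gcd k m ≡ 1 → gcd k (p * m) ≡ 1
  from k e = coprime⇒gcd≡1 (coprime-*ʳ {k} {p} {m}
    (λ (d∣k , d∣p) → gcd≡1⇒coprime {k} {m} e (d∣k , ∣-trans d∣p p∣m)) (gcd≡1⇒coprime e))

-- Of the p · φ m numbers up to p m that are coprime to m, those divisible by p are p k with k ≤ m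
-- coprime to m. They are moved to the left side to avoid a subtraction.
φ-∤ : ∀ {p m} → Prime p → p ∤ m → φ (p * m) ≡ (p ∸ 1) * φ m
φ-∤ {p} {m} pp p∤m = +-cancelʳ-≡ (φ m) _ _ (begin
  φ (p * m) + φ m ≡⟨ cong₂ _+_ (φ≡sum (p * m)) (φ≡sum m) ⟩
  sumTo (coprimeTo (p * m)) (p * m) + sumTo (coprimeTo m) m ≡⟨ cong (sumTo (coprimeTo (p * m)) (p * m) +_) (sym mult) ⟩
  sumTo (coprimeTo (p * m)) (p * m) + sumTo (λ k → 𝟙 (p ∣? k) * coprimeTo m k) (p * m) ≡⟨ sum-+ _ _ (p * m) ⟨
  sumTo (λ k → coprimeTo (p * m) k + 𝟙 (p ∣? k) * coprimeTo m k) (p * m) ≡⟨ sum-cong (p * m) (λ k _ _ → split k) ⟩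
  sumTo (coprimeTo m) (p * m) ≡⟨ sum-periodic (coprimeTo m) m (coprimeTo-periodic m) p ⟩
  p * sumTo (coprimeTo m) m ≡⟨ cong (p *_) (φ≡sum m) ⟨
  p * φ m ≡⟨ cong (_* φ m) (sym (m∸n+n≡m (prime⇒1≤ pp))) ⟩
  (p ∸ 1 + 1) * φ m ≡⟨ *-distribʳ-+ (φ m) (p ∸ 1) 1 ⟩
  (p ∸ 1) * φ m + 1 * φ m ≡⟨ cong ((p ∸ 1) * φ m +_) (*-identityˡ (φ m)) ⟩
  (p ∸ 1) * φ m + φ m ∎)
  where
  open ≡-Reasoning
  instance
    _ : NonZero p
    _ = prime⇒nonZero pp
  mult : sumTo (λ k → 𝟙 (p ∣? k) * coprimeTo m k) (p * m) ≡ sumTo (coprimeTo m) m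
  mult = trans (sum-multiples (coprimeTo m) p (p * m))
    (trans (cong (sumTo (λ k → coprimeTo m (p * k))) (trans (cong (_/ p) (*-comm p m)) (m*n/n≡m m p)))
    (sum-cong m (λ k _ _ → 𝟙-cong (gcd (p * k) m ≟ 1) (gcd k m ≟ 1)
      (λ e → coprime⇒gcd≡1 λ (d∣k , d∣m) → gcd≡1⇒coprime {p * k} {m} e (∣n⇒∣m*n p d∣k , d∣m))
      (λ e → coprime⇒gcd≡1 λ (d∣pk , d∣m) → coprime-*ʳ {m} {p} {k} (prime∤⇒coprime pp p∤m)
         (λ (d∣m , d∣k) → gcd≡1⇒coprime {k} {m} e (d∣k , d∣m)) (d∣m , d∣pk)))))
  split : ∀ k → coprimeTo (p * m) k + 𝟙 (p ∣? k) * coprimeTo m k ≡ coprimeTo m k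
  split k with p ∣? k
  ... | yes p∣k = cong₂ _+_ (𝟙-no (gcd k (p * m) ≟ 1) λ e → prime∤1 pp (subst (p ∣_)
          (gcd≡1⇒coprime {k} {p * m} e (p∣k , m∣m*n m)) ∣-refl)) (*-identityˡ _)
  ... | no p∤k = trans (+-identityʳ _) (𝟙-cong (gcd k (p * m) ≟ 1) (gcd k m ≟ 1)
      (λ e → coprime⇒gcd≡1 λ (d∣k , d∣m) → gcd≡1⇒coprime {k} {p * m} e (d∣k , ∣n⇒∣m*n p d∣m))
      (λ e → coprime⇒gcd≡1 (coprime-*ʳ {k} {p} {m} (prime∤⇒coprime pp p∤k) (gcd≡1⇒coprime e))))

φ-primePower : ∀ {p m} → Prime p → p ∤ m → ∀ a → φ (p ^ suc a * m) ≡ p ^ a * ((p ∸ 1) * φ m)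
φ-primePower {p} {m} pp p∤m zero = trans (cong (λ x → φ (x * m)) (*-identityʳ p)) (trans (φ-∤ pp p∤m) (sym (*-identityˡ _)))
φ-primePower {p} {m} pp p∤m (suc a) = begin
  φ (p * (p * p ^ a) * m) ≡⟨ cong φ (*-assoc p (p * p ^ a) m) ⟩
  φ (p * (p * p ^ a * m)) ≡⟨ φ-∣ pp (∣m⇒∣m*n m (m∣m*n (p ^ a))) ⟩
  p * φ (p * p ^ a * m) ≡⟨ cong (p *_) (φ-primePower pp p∤m a) ⟩
  p * (p ^ a * ((p ∸ 1) * φ m)) ≡⟨ *-assoc p (p ^ a) _ ⟨
  p * p ^ a * ((p ∸ 1) * φ m) ∎
  where open ≡-Reasoning

odd-prime : ∀ {p} → Prime p → p ≢ 2 → ∃[ q ] p ≡ suc (suc (suc q))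
odd-prime {0} () _
odd-prime {1} () _
odd-prime {2} _ h = contradiction refl h
odd-prime {suc (suc (suc q))} _ _ = q , refl

prime-2 : Prime 2
prime-2 = toWitness {a? = prime? 2} _

1≤m^n : ∀ m n → 1 ≤ m → 1 ≤ m ^ n
1≤m^n m n 1≤m = m^n>0 m {{>-nonZero 1≤m}} n

-- This justifies the cutoff in `A`. An odd prime satisfies p ≤ (p - 1)², so only the prime 2 costs
-- a factor 2, and it does so once: at that prime the cofactor is odd and the sharper second bound
-- applies to it.
φ-bound : ∀ n → 1 ≤ n → n ≤ 2 * (φ n * φ n) × (2 ∤ n → n ≤ φ n * φ n)
φ-bound = primePower-ind _ (s≤s z≤n , λ _ → s≤s z≤n) step
  where
  open ≤-Reasoning
  step : ∀ p a m → Prime p → p ∤ m → 1 ≤ m → m ≤ 2 * (φ m * φ m) × (2 ∤ m → m ≤ φ m * φ m) →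
         p ^ suc a * m ≤ 2 * (φ (p ^ suc a * m) * φ (p ^ suc a * m)) ×
         (2 ∤ p ^ suc a * m → p ^ suc a * m ≤ φ (p ^ suc a * m) * φ (p ^ suc a * m))
  step p a m pp p∤m 1≤m (b₁ , b₂) rewrite φ-primePower pp p∤m a with p ≟ 2
  ... | yes refl = (begin
      2 * 2 ^ a * m ≤⟨ *-monoʳ-≤ (2 * 2 ^ a) (b₂ p∤m) ⟩
      2 * 2 ^ a * (φ m * φ m) ≤⟨ m≤m*n _ (2 ^ a) {{m^n≢0 2 a}} ⟩
      2 * 2 ^ a * (φ m * φ m) * 2 ^ a ≡⟨ lem (2 ^ a) (φ m) ⟩
      2 * (2 ^ a * (1 * φ m) * (2 ^ a * (1 * φ m))) ∎) ,
    λ 2∤ → contradiction (∣m⇒∣m*n m (m∣m*n (2 ^ a))) 2∤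
    where
    lem : ∀ x y → 2 * x * (y * y) * x ≡ 2 * (x * (1 * y) * (x * (1 * y)))
    lem = solve-∀
  ... | no p≢2 with odd-prime pp p≢2
  ...   | q , refl = grow 2 b₁ , λ 2∤ → ≤-trans (grow 1 (≤-trans (b₂ (2∤ ∘ ∣n⇒∣m*n (p ^ suc a))) (≤-reflexive (sym (*-identityˡ (φ m * φ m))))))
      (≤-reflexive (*-identityˡ _))
    where
    lem : ∀ c x y q → (4 + 4 * q + q * q) * (x * x) * (c * (y * y)) ≡ c * (x * ((2 + q) * y) * (x * ((2 + q) * y)))
    lem = solve-∀
    lem₂ : ∀ q → 3 + q + (1 + 3 * q + q * q) ≡ 4 + 4 * q + q * q
    lem₂ = solve-∀
    grow : ∀ c → m ≤ c * (φ m * φ m) → p ^ suc a * m ≤ c * (p ^ a * ((p ∸ 1) * φ m) * (p ^ a * ((p ∸ 1) * φ m)))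
    grow c h = begin
      p * p ^ a * m ≤⟨ *-mono-≤ (*-mono-≤ (≤-trans (m≤m+n p _) (≤-reflexive (lem₂ q))) (m≤m*n (p ^ a) (p ^ a) {{m^n≢0 p a}})) h ⟩
      (4 + 4 * q + q * q) * (p ^ a * p ^ a) * (c * (φ m * φ m)) ≡⟨ lem c (p ^ a) (φ m) q ⟩
      c * (p ^ a * ((2 + q) * φ m) * (p ^ a * ((2 + q) * φ m))) ∎

-- `skip` makes the index an upper bound for the number of factors. The primes may repeat, which
-- keeps the enumeration below simple and only enlarges it.
data PrimePowers : ℕ → ℕ → Set where
  one : PrimePowers 0 1
  skip : ∀ {r n} → PrimePowers r n → PrimePowers (suc r) n
  times : ∀ {r n} p a → Prime p → PrimePowers r n → PrimePowers (suc r) (p ^ suc a * n)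

-- i is 0 for odd n; in general the prime 2, which contributes no factor 2 to φ n, costs i = 1.
FewPrimes : ℕ → ℕ → Set
FewPrimes i n = ∃[ r ] (PrimePowers (i + r) n × 2 ^ r ∣ φ n × n ≤ 2 ^ (i + r) * φ n)

-- Every odd prime p dividing n puts the even number p - 1 into φ n, hence one factor 2, and p ≤ 2
-- (p - 1) costs one factor 2 in comparing n with φ n.
odd-fewPrimes : ∀ n → 1 ≤ n → 2 ∤ n → FewPrimes 0 n
odd-fewPrimes = primePower-ind (λ n → 2 ∤ n → FewPrimes 0 n) (λ _ → 0 , one , ∣-refl , s≤s z≤n) step
  where
  step : ∀ p a m → Prime p → p ∤ m → 1 ≤ m → (2 ∤ m → FewPrimes 0 m) → 2 ∤ p ^ suc a * m → FewPrimes 0 (p ^ suc a * m)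
  step p a m pp p∤m 1≤m ih 2∤ with ih (2∤ ∘ ∣n⇒∣m*n (p ^ suc a)) | odd-prime pp (λ { refl → 2∤ (∣m⇒∣m*n m (m∣m*n (2 ^ a))) })
  ... | r , t , d , b | q , refl rewrite φ-primePower pp p∤m a =
    suc r , times p a pp t , ∣n⇒∣m*n (p ^ a) (*-pres-∣ 2∣p-1 d) , (begin
      p * p ^ a * m ≤⟨ *-mono-≤ (*-monoˡ-≤ (p ^ a) (≤-trans (m≤m+n p (1 + q)) (≤-reflexive (lem₂ q)))) b ⟩
      2 * (2 + q) * p ^ a * (2 ^ r * φ m) ≡⟨ lem (2 ^ r) (p ^ a) (φ m) q ⟩
      2 * 2 ^ r * (p ^ a * ((2 + q) * φ m)) ∎)
    where
    open ≤-Reasoning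
    lem₂ : ∀ q → 3 + q + (1 + q) ≡ 2 * (2 + q)
    lem₂ = solve-∀
    lem : ∀ c x y q → 2 * (2 + q) * x * (c * y) ≡ 2 * c * (x * ((2 + q) * y))
    lem = solve-∀
    2∣p-1 : 2 ∣ 2 + q
    2∣p-1 with 2 ∣? 2 + q
    ... | yes d = d
    ... | no ¬d = contradiction (∣m⇒∣m*n m (∣m⇒∣m*n (p ^ a) even)) 2∤
      where
      even-or : ∀ n → 2 ∣ n ⊎ 2 ∣ suc n
      even-or zero = inj₁ (2 ∣0)
      even-or (suc n) with even-or n
      ... | inj₁ d = inj₂ (∣m∣n⇒∣m+n {m = 2} ∣-refl d)
      ... | inj₂ d = inj₁ d
      even : 2 ∣ 3 + q
      even with even-or (2 + q)
      ... | inj₁ d = contradiction d ¬d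
      ... | inj₂ d = d

fewPrimes : ∀ n → 1 ≤ n → FewPrimes 1 n
fewPrimes n 1≤n with strip prime-2 n 1≤n
... | a , zero , _ , 2∤m = contradiction (2 ∣0) 2∤m
... | a , m@(suc _) , refl , 2∤m with a | odd-fewPrimes m (s≤s z≤n) 2∤m
...   | zero | r , t , d , b rewrite +-identityʳ (m ∸ 1) = r , skip t , d , ≤-trans b (*-monoˡ-≤ (φ m) (m≤m+n (2 ^ r) _))
...   | suc a′ | r , t , d , b rewrite φ-primePower prime-2 2∤m a′ =
    r , times 2 a′ prime-2 t , ∣n⇒∣m*n (2 ^ a′) (subst (2 ^ r ∣_) (sym (*-identityˡ (φ m))) d) ,
    (begin
      2 * 2 ^ a′ * m ≤⟨ *-monoʳ-≤ (2 * 2 ^ a′) b ⟩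
      2 * 2 ^ a′ * (2 ^ r * φ m) ≡⟨ lem (2 ^ a′) (2 ^ r) (φ m) ⟩
      2 * 2 ^ r * (2 ^ a′ * (1 * φ m)) ∎)
  where
  open ≤-Reasoning
  lem : ∀ x y z → 2 * x * (y * z) ≡ 2 * y * (x * (1 * z))
  lem = solve-∀

-- Chebyshev's bounds

count-mono : ∀ b {m n} → m ≤ n → count b m ≤ count b n
count-mono b {m} {zero} z≤n = ≤-refl
count-mono b {m} {suc n} m≤n with m≤n⇒m<n∨m≡n m≤n
... | inj₁ m<n = ≤-trans (count-mono b (≤-pred m<n)) (m≤n+m _ _)
... | inj₂ refl = ≤-refl

count≤ : ∀ b n → count b n ≤ n
count≤ b zero = z≤n
count≤ b (suc n) with b (suc n)
... | true = s≤s (count≤ b n)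
... | false = m≤n⇒m≤1+n (count≤ b n)

primeProd-≤ : ∀ b f c w → (∀ p → 1 ≤ p → p ≤ w → T (b p) → f p ≤ c) → primeProd b f w ≤ c ^ count b w
primeProd-≤ b f c zero h = ≤-refl
primeProd-≤ b f c (suc w) h with b (suc w) | h (suc w) (s≤s z≤n) ≤-refl
... | true | h₁ = *-mono-≤ (h₁ _) (primeProd-≤ b f c w λ p l u → h p l (m≤n⇒m≤1+n u))
... | false | _ = primeProd-≤ b f c w λ p l u → h p l (m≤n⇒m≤1+n u)

primeProd-≥ : ∀ b f c w → (∀ p → 1 ≤ p → p ≤ w → T (b p) → c ≤ f p) → c ^ count b w ≤ primeProd b f w
primeProd-≥ b f c zero h = ≤-refl
primeProd-≥ b f c (suc w) h with b (suc w) | h (suc w) (s≤s z≤n) ≤-refl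
... | true | h₁ = *-mono-≤ (h₁ _) (primeProd-≥ b f c w λ p l u → h p l (m≤n⇒m≤1+n u))
... | false | _ = primeProd-≥ b f c w λ p l u → h p l (m≤n⇒m≤1+n u)

∣primeProd : ∀ b f p w → 1 ≤ p → p ≤ w → T (b p) → f p ∣ primeProd b f w
∣primeProd b f p zero 1≤p p≤0 _ = contradiction (≤-trans 1≤p p≤0) λ ()
∣primeProd b f p (suc w) 1≤p p≤w Tb with m≤n⇒m<n∨m≡n p≤w
∣primeProd b f p (suc w) 1≤p p≤w Tb | inj₁ p<w with b (suc w)
... | true = ∣n⇒∣m*n (f (suc w)) (∣primeProd b f p w 1≤p (≤-pred p<w) Tb)
... | false = ∣primeProd b f p w 1≤p (≤-pred p<w) Tb
∣primeProd b f p (suc w) 1≤p p≤w Tb | inj₂ refl with b (suc w)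
... | true = m∣m*n _

isPrime : ℕ → Bool
isPrime p = ⌊ prime? p ⌋

π : ℕ → ℕ
π = count isPrime

C-absorb : ∀ n m → suc m * (suc n C suc m) ≡ suc n * (n C m)
C-absorb zero zero = refl
C-absorb zero (suc m) = *-zeroʳ (2 + m)
C-absorb (suc n) m = begin
  suc m * (suc (suc n) C suc m) ≡⟨ cong (suc m *_) (nCk+nC[k+1]≡[n+1]C[k+1] (suc n) m) ⟨
  suc m * (suc n C m + suc n C suc m) ≡⟨ *-distribˡ-+ (suc m) (suc n C m) _ ⟩
  suc m * (suc n C m) + suc m * (suc n C suc m) ≡⟨ cong (suc m * (suc n C m) +_) (C-absorb n m) ⟩
  suc m * (suc n C m) + suc n * (n C m) ≡⟨ go m ⟩
  suc (suc n) * (suc n C m) ∎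
  where
  open ≡-Reasoning
  lem : ∀ n a b → (a + b) + suc n * a + suc n * b ≡ (a + b) + suc n * (a + b)
  lem = solve-∀
  go : ∀ m → suc m * (suc n C m) + suc n * (n C m) ≡ suc (suc n) * (suc n C m)
  go zero = lem₀ n
    where
    lem₀ : ∀ n → 1 * 1 + suc n * 1 ≡ suc (suc n) * 1
    lem₀ = solve-∀
  go (suc m) = begin
    suc n C suc m + suc m * (suc n C suc m) + suc n * (n C suc m) ≡⟨ cong (λ x → suc n C suc m + x + suc n * (n C suc m)) (C-absorb n m) ⟩
    suc n C suc m + suc n * (n C m) + suc n * (n C suc m) ≡⟨ cong (λ x → x + suc n * (n C m) + suc n * (n C suc m)) (sym (nCk+nC[k+1]≡[n+1]C[k+1] n m)) ⟩
    (n C m + n C suc m) + suc n * (n C m) + suc n * (n C suc m) ≡⟨ lem n (n C m) (n C suc m) ⟩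
    (n C m + n C suc m) + suc n * (n C m + n C suc m) ≡⟨ cong (λ x → x + suc n * x) (nCk+nC[k+1]≡[n+1]C[k+1] n m) ⟩
    suc (suc n) * (suc n C suc m) ∎

1≤nCk : ∀ n m → m ≤ n → 1 ≤ n C m
1≤nCk n zero _ = ≤-refl
1≤nCk (suc n) (suc m) (s≤s m≤n) = ≤-trans (≤-trans (1≤nCk n m m≤n) (m≤m+n _ _)) (≤-reflexive (nCk+nC[k+1]≡[n+1]C[k+1] n m))

nCk≤2^n : ∀ n m → n C m ≤ 2 ^ n
nCk≤2^n n zero = m^n>0 2 n
nCk≤2^n zero (suc m) = z≤n
nCk≤2^n (suc n) (suc m) = ≤-trans (≤-reflexive (sym (nCk+nC[k+1]≡[n+1]C[k+1] n m)))
  (≤-trans (+-mono-≤ (nCk≤2^n n m) (nCk≤2^n n (suc m))) (≤-reflexive (cong (2 ^ n +_) (sym (+-identityʳ (2 ^ n))))))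

binomial-sum : ∀ n → sumTo (λ i → n C (i ∸ 1)) (suc n) ≡ 2 ^ n
binomial-sum zero = refl
binomial-sum (suc n) = begin
  sumTo (λ i → suc n C (i ∸ 1)) (suc (suc n)) ≡⟨ sum-suc (λ i → suc n C (i ∸ 1)) (suc n) ⟩
  1 + sumTo (λ i → suc n C i) (suc n) ≡⟨ cong (1 +_) (sum-cong (suc n) pascal) ⟩
  1 + sumTo (λ i → n C (i ∸ 1) + n C i) (suc n) ≡⟨ cong (1 +_) (sum-+ (λ i → n C (i ∸ 1)) (n C_) (suc n)) ⟩
  1 + (sumTo (λ i → n C (i ∸ 1)) (suc n) + sumTo (n C_) (suc n)) ≡⟨ lem _ _ ⟩
  sumTo (λ i → n C (i ∸ 1)) (suc n) + (1 + sumTo (n C_) (suc n)) ≡⟨ cong₂ _+_ (binomial-sum n) last ⟩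
  2 ^ n + 2 ^ n ≡⟨ cong (2 ^ n +_) (sym (+-identityʳ (2 ^ n))) ⟩
  2 * 2 ^ n ∎
  where
  open ≡-Reasoning
  lem : ∀ a b → 1 + (a + b) ≡ a + (1 + b)
  lem = solve-∀
  pascal : ∀ i → 1 ≤ i → i ≤ suc n → suc n C i ≡ n C (i ∸ 1) + n C i
  pascal (suc i) _ _ = sym (nCk+nC[k+1]≡[n+1]C[k+1] n i)
  last : 1 + sumTo (n C_) (suc n) ≡ 2 ^ n
  last = begin
    1 + (n C suc n + sumTo (n C_) n) ≡⟨ cong (λ x → 1 + (x + sumTo (n C_) n)) (k>n⇒nCk≡0 (n<1+n n)) ⟩
    1 + sumTo (n C_) n ≡⟨ sum-suc (λ i → n C (i ∸ 1)) n ⟨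
    sumTo (λ i → n C (i ∸ 1)) (suc n) ≡⟨ binomial-sum n ⟩
    2 ^ n ∎

-- Leibniz's harmonic triangle: the reciprocals of x, y, w below satisfy 1/w = 1/x + 1/y.
leibniz∣ : ∀ D N → (∀ n → 1 ≤ n → n ≤ N → n ∣ D) → ∀ m n → m ≤ n → suc n ≤ N → suc n * (n C m) ∣ D
leibniz∣ D N h zero n _ n<N = subst (_∣ D) (sym (*-identityʳ (suc n))) (h (suc n) (s≤s z≤n) n<N)
leibniz∣ D N h (suc m) (suc n) (s≤s m≤n) n<N = go (leibniz∣ D N h m (suc n) (m≤n⇒m≤1+n m≤n) n<N) (leibniz∣ D N h m n m≤n (<⇒≤ n<N))
  where
  open ≡-Reasoning
  x y w : ℕ
  x = suc (suc n) * (suc n C m)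
  y = suc (suc n) * (suc n C suc m)
  w = suc n * (n C m)
  lem : ∀ a b c m → (a * b + a * c) * m ≡ a * (m * (b + c))
  lem = solve-∀
  lem₁ : ∀ a b w → a * (a * b) * w ≡ a * b * (a * w)
  lem₁ = solve-∀
  lem₂ : ∀ a b c m → a * b * (a * (m * c)) ≡ a * b * (a * c) * m
  lem₂ = solve-∀
  identity : (x + y) * w ≡ x * y
  identity = *-cancelʳ-≡ _ _ (suc m) (begin
    (x + y) * w * suc m ≡⟨ *-assoc (x + y) w (suc m) ⟩
    (x + y) * (w * suc m) ≡⟨ cong ((x + y) *_) (*-comm w (suc m)) ⟩
    (x + y) * (suc m * w) ≡⟨ *-assoc (x + y) (suc m) w ⟨
    (x + y) * suc m * w ≡⟨ cong (_* w) (lem (suc (suc n)) (suc n C m) (suc n C suc m) (suc m)) ⟩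
    suc (suc n) * (suc m * (suc n C m + suc n C suc m)) * w ≡⟨ cong (λ z → suc (suc n) * (suc m * z) * w) (nCk+nC[k+1]≡[n+1]C[k+1] (suc n) m) ⟩
    suc (suc n) * (suc m * (suc (suc n) C suc m)) * w ≡⟨ cong (λ z → suc (suc n) * z * w) (C-absorb (suc n) m) ⟩
    suc (suc n) * x * w ≡⟨ lem₁ (suc (suc n)) (suc n C m) w ⟩
    x * (suc (suc n) * w) ≡⟨ cong (λ z → x * (suc (suc n) * z)) (C-absorb n m) ⟨
    x * (suc (suc n) * (suc m * (suc n C suc m))) ≡⟨ lem₂ (suc (suc n)) (suc n C m) (suc n C suc m) (suc m) ⟩
    x * y * suc m ∎)
  instance
    _ : NonZero w
    _ = m*n≢0 (suc n) (n C m) {{_}} {{>-nonZero (1≤nCk n m m≤n)}}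
    _ : NonZero x
    _ = m*n≢0 (suc (suc n)) (suc n C m) {{_}} {{>-nonZero (1≤nCk (suc n) m (m≤n⇒m≤1+n m≤n))}}
  go : x ∣ D → w ∣ D → y ∣ D
  go (divides a D≡ax) (divides b D≡bw) = ∣m+n∣m⇒∣n (subst (y ∣_) eq (n∣m*n b)) (n∣m*n a)
    where
    lem₃ : ∀ b w x y → b * y * (x * w) ≡ b * w * (x * y)
    lem₃ = solve-∀
    lem₄ : ∀ D x y w → D * ((x + y) * w) ≡ y * D * w + D * (x * w)
    lem₄ = solve-∀
    lem₅ : ∀ a x y w D → y * (a * x) * w + D * (x * w) ≡ (a * y + D) * (x * w)
    lem₅ = solve-∀
    -- With a = D / x and b = D / w this is D / y = D / w - D / x.
    eq : b * y ≡ a * y + D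
    eq = *-cancelʳ-≡ _ _ (x * w) {{m*n≢0 x w}} (begin
      b * y * (x * w) ≡⟨ lem₃ b w x y ⟩
      b * w * (x * y) ≡⟨ cong₂ _*_ (sym D≡bw) (sym identity) ⟩
      D * ((x + y) * w) ≡⟨ lem₄ D x y w ⟩
      y * D * w + D * (x * w) ≡⟨ cong (λ z → y * z * w + D * (x * w)) D≡ax ⟩
      y * (a * x) * w + D * (x * w) ≡⟨ lem₅ a x y w D ⟩
      (a * y + D) * (x * w) ∎)

-- Each of the n + 1 multiples `suc n * (n C i)` divides D and so is at most D, while their sum is
-- (n + 1) 2 ^ n.
2^≤-of-divisible : ∀ D n → 1 ≤ D → (∀ k → 1 ≤ k → k ≤ suc n → k ∣ D) → 2 ^ n ≤ D
2^≤-of-divisible D n 1≤D h = *-cancelˡ-≤ (suc n) (begin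
  suc n * 2 ^ n ≡⟨ cong (suc n *_) (binomial-sum n) ⟨
  suc n * sumTo (λ i → n C (i ∸ 1)) (suc n) ≡⟨ sum-*ˡ (suc n) (λ i → n C (i ∸ 1)) (suc n) ⟨
  sumTo (λ i → suc n * (n C (i ∸ 1))) (suc n) ≤⟨ sum-≤-const D (suc n) (λ { (suc i) _ (s≤s i≤n) → ∣⇒≤ {{>-nonZero 1≤D}} (leibniz∣ D (suc n) h i n i≤n ≤-refl) }) ⟩
  suc n * D ∎)
  where open ≤-Reasoning

maxPower : ℕ → ℕ → ℕ → ℕ
maxPower p N zero = 1
maxPower p N (suc a) = if ⌊ p ^ suc a ≤? N ⌋ then p ^ suc a else maxPower p N a

maxPower-≤ : ∀ p N a → 1 ≤ N → maxPower p N a ≤ N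
maxPower-≤ p N zero 1≤N = 1≤N
maxPower-≤ p N (suc a) 1≤N with p ^ suc a ≤? N
... | yes h = h
... | no _ = maxPower-≤ p N a 1≤N

∣maxPower : ∀ p N a b → b ≤ a → p ^ b ≤ N → p ^ b ∣ maxPower p N a
∣maxPower p N zero .zero z≤n _ = ∣-refl
∣maxPower p N (suc a) b b≤a h with p ^ suc a ≤? N | m≤n⇒m<n∨m≡n b≤a
... | yes _ | _ = subst (p ^ b ∣_) (trans (sym (^-distribˡ-+-* p b (suc a ∸ b))) (cong (p ^_) (m+[n∸m]≡n b≤a))) (m∣m*n (p ^ (suc a ∸ b)))
... | no _ | inj₁ b<a = ∣maxPower p N a b (≤-pred b<a) h
... | no ¬h | inj₂ refl = contradiction h ¬h

n<2^n : ∀ n → n < 2 ^ n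
n<2^n zero = s≤s z≤n
n<2^n (suc n) = ≤-trans (+-mono-≤ (m^n>0 2 n) (n<2^n n)) (≤-reflexive (cong (2 ^ n +_) (sym (+-identityʳ (2 ^ n)))))

n<p^n : ∀ {p} n → 2 ≤ p → n < p ^ n
n<p^n {p} n 2≤p = <-≤-trans (n<2^n n) (^-monoˡ-≤ n 2≤p)

-- Each factor is at most N, so the product is at most N ^ π N. Exponents up to N suffice, as p ^ a
-- ≤ N forces a < N.
lcmUpTo : ℕ → ℕ
lcmUpTo N = primeProd isPrime (λ p → maxPower p N N) N

∣lcmUpTo : ∀ N n → 1 ≤ n → n ≤ N → n ∣ lcmUpTo N
∣lcmUpTo N n 1≤n n≤N = ∣-primePowers (lcmUpTo N) n 1≤n go
  where
  go : ∀ p a → Prime p → p ^ a ∣ n → p ^ a ∣ lcmUpTo N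
  go p zero _ _ = 1∣ _
  go p (suc a) pp d = ∣-trans (∣maxPower p N N (suc a) (≤-trans (<⇒≤ (n<p^n (suc a) (prime⇒2≤ pp))) pa≤N) pa≤N)
    (∣primeProd isPrime (λ p → maxPower p N N) p N (prime⇒1≤ pp) p≤N (fromWitness pp))
    where
    pa≤N : p ^ suc a ≤ N
    pa≤N = ≤-trans (∣⇒≤ {{>-nonZero 1≤n}} d) n≤N
    p≤N : p ≤ N
    p≤N = ≤-trans (m≤m*n p (p ^ a) {{m^n≢0 p a {{prime⇒nonZero pp}}}}) pa≤N

2^-cancel-≤ : ∀ a b → 2 ^ a ≤ 2 ^ b → a ≤ b
2^-cancel-≤ a b h with a ≤? b
... | yes a≤b = a≤b
... | no a≰b = contradiction h (<⇒≱ (^-monoʳ-< 2 (s≤s (s≤s z≤n)) (≰⇒> a≰b)))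

-- With 2 ^ j = N + 1, the least common multiple of 1, ..., N + 1 lies between 2 ^ N and (N + 1) ^ π
-- = 2 ^ (j π), and the exponents are compared.
chebyshev-lower : ∀ j → 2 ^ j ≤ j * π (2 ^ j) + 1
chebyshev-lower j with 2 ^ j in eq | m^n>0 2 j
... | suc N | _ = ≤-trans (s≤s (2^-cancel-≤ N (j * π (suc N)) (begin
  2 ^ N ≤⟨ 2^≤-of-divisible (lcmUpTo (suc N)) N 1≤D (∣lcmUpTo (suc N)) ⟩
  lcmUpTo (suc N) ≤⟨ primeProd-≤ isPrime _ (suc N) (suc N) (λ p _ _ _ → maxPower-≤ p (suc N) (suc N) (s≤s z≤n)) ⟩
  suc N ^ π (suc N) ≡⟨ cong (_^ π (suc N)) (sym eq) ⟩
  (2 ^ j) ^ π (suc N) ≡⟨ ^-*-assoc 2 j (π (suc N)) ⟩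
  2 ^ (j * π (suc N)) ∎))) (≤-reflexive (+-comm 1 _))
  where
  open ≤-Reasoning
  1≤maxPower : ∀ p a → 1 ≤ p → 1 ≤ maxPower p (suc N) a
  1≤maxPower p zero _ = ≤-refl
  1≤maxPower p (suc a) 1≤p with p ^ suc a ≤? suc N
  ... | yes _ = 1≤m^n p (suc a) 1≤p
  ... | no _ = 1≤maxPower p a 1≤p
  1≤D : 1 ≤ lcmUpTo (suc N)
  1≤D = ≤-trans (≤-reflexive (sym (^-zeroˡ (π (suc N)))))
    (primeProd-≥ isPrime _ 1 (suc N) (λ p 1≤p _ _ → 1≤maxPower p (suc N) 1≤p))

prime∣! : ∀ {p} n → Prime p → p ∣ n ! → p ≤ n
prime∣! zero pp d = contradiction d (prime∤1 pp)
prime∣! (suc n) pp d with euclidsLemma (suc n) (n !) pp d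
... | inj₁ d₁ = ∣⇒≤ d₁
... | inj₂ d₂ = m≤n⇒m≤1+n (prime∣! n pp d₂)

∣! : ∀ {p} n → 1 ≤ p → p ≤ n → p ∣ n !
∣! zero 1≤p p≤0 = contradiction (≤-trans 1≤p p≤0) λ ()
∣! (suc n) 1≤p p≤n with m≤n⇒m<n∨m≡n p≤n
... | inj₁ p<n = ∣n⇒∣m*n (suc n) (∣! n 1≤p (≤-pred p<n))
... | inj₂ refl = m∣m*n (n !)

-- Such a prime divides (2 n)! but neither of the two factors n ! in the denominator.
prime∣centralBinomial : ∀ {p} n → Prime p → n < p → p ≤ n + n → p ∣ (n + n) C n
prime∣centralBinomial {p} n pp n<p p≤2n with euclidsLemma ((n + n) C n) (n ! * (n + n ∸ n) !) pp
    (subst (p ∣_) (sym C*≡!) (∣! (n + n) (prime⇒1≤ pp) p≤2n))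
  where
  instance
    _ : NonZero (n ! * (n + n ∸ n) !)
    _ = n !* (n + n ∸ n) !≢0
  C*≡! : ((n + n) C n) * (n ! * (n + n ∸ n) !) ≡ (n + n) !
  C*≡! = trans (cong (_* (n ! * (n + n ∸ n) !)) (nCk≡n!/k![n-k]! (m≤m+n n n))) (m/n*n≡m (k![n∸k]!∣n! (m≤m+n n n)))
... | inj₁ d = d
... | inj₂ d with euclidsLemma (n !) ((n + n ∸ n) !) pp d
...   | inj₁ d₁ = contradiction (prime∣! n pp d₁) (<⇒≱ n<p)
...   | inj₂ d₂ = contradiction (≤-trans (prime∣! _ pp d₂) (≤-reflexive (m+n∸n≡m n n))) (<⇒≱ n<p)

-- The primes between n = 2 ^ j and 2 n are larger than n, and their product divides the central
-- binomial coefficient, which is at most 2 ^ (2 n).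
π-dyadic : ∀ j → j * π (2 ^ suc j) ≤ j * π (2 ^ j) + 2 ^ suc j
π-dyadic j = begin
  j * π (2 ^ suc j) ≤⟨ *-monoʳ-≤ j (split (2 ^ suc j) (≤-reflexive (sym 2n))) ⟩
  j * (π n + count big (2 ^ suc j)) ≡⟨ *-distribˡ-+ j (π n) _ ⟩
  j * π n + j * count big (2 ^ suc j) ≤⟨ +-monoʳ-≤ (j * π n) (2^-cancel-≤ _ _ bound) ⟩
  j * π n + 2 ^ suc j ∎
  where
  open ≤-Reasoning
  n : ℕ
  n = 2 ^ j
  2n : n + n ≡ 2 ^ suc j
  2n = cong (n +_) (sym (+-identityʳ n))
  big? : ∀ p → Dec (Prime p × (n < p × p ≤ n + n))
  big? p = prime? p ×-dec (n <? p ×-dec p ≤? n + n)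
  big : ℕ → Bool
  big p = ⌊ big? p ⌋
  split : ∀ w → w ≤ n + n → π w ≤ π n + count big w
  split zero _ = z≤n
  split (suc w) w≤ with prime? (suc w) | big? (suc w) | suc w ≤? n
  ... | no _ | yes (pp , _) | _ = ≤-trans (split w (<⇒≤ w≤)) (+-monoʳ-≤ (π n) (n≤1+n _))
  ... | no _ | no _ | _ = split w (<⇒≤ w≤)
  ... | yes pp | yes _ | _ = ≤-trans (s≤s (split w (<⇒≤ w≤))) (≤-reflexive (sym (+-suc (π n) _)))
  ... | yes pp | no ¬b | no w≰n = contradiction (pp , ≰⇒> w≰n , w≤) ¬b
  ... | yes pp | no ¬b | yes w≤n = ≤-trans (π-suc pp) (≤-trans (count-mono isPrime w≤n) (m≤m+n (π n) _))
    where
    π-suc : Prime (suc w) → 1 + π w ≤ π (suc w)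
    π-suc pp with prime? (suc w)
    ... | yes _ = ≤-refl
    ... | no ¬pp = contradiction pp ¬pp
  bound : 2 ^ (j * count big (2 ^ suc j)) ≤ 2 ^ (2 ^ suc j)
  bound = begin
    2 ^ (j * count big (2 ^ suc j)) ≡⟨ ^-*-assoc 2 j _ ⟨
    n ^ count big (2 ^ suc j) ≤⟨ primeProd-≥ big id n (2 ^ suc j) (λ p _ _ t → <⇒≤ (proj₁ (proj₂ (toWitness t)))) ⟩
    primeProd big id (2 ^ suc j) ≤⟨ ∣⇒≤ {{>-nonZero (1≤nCk (n + n) n (m≤m+n n n))}} (primeProd∣ big ((n + n) C n)
      (λ p t → proj₁ (toWitness t)) (λ p t → let pp , l , u = toWitness t in prime∣centralBinomial n pp l u) (2 ^ suc j)) ⟩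
    (n + n) C n ≤⟨ nCk≤2^n (n + n) n ⟩
    2 ^ (n + n) ≡⟨ cong (2 ^_) 2n ⟩
    2 ^ (2 ^ suc j) ∎

-- Products of few prime powers

π-upper : ∀ j → j * π (2 ^ j) ≤ 4 * 2 ^ j
π-upper zero = z≤n
-- The constant 4 reproduces itself as soon as (j + 1)(4 + 2) ≤ 8 j; for the first few j the trivial
-- bound π x ≤ x is enough.
π-upper (suc j) with suc j ≤? 4
... | yes j<4 = *-mono-≤ j<4 (count≤ isPrime (2 ^ suc j))
... | no j≮4 = *-cancelˡ-≤ j {{>-nonZero (≤-trans (s≤s z≤n) 4≤j)}} (begin
  j * (suc j * π (2 ^ suc j)) ≡⟨ lem₁ j (suc j) _ ⟩
  suc j * (j * π (2 ^ suc j)) ≤⟨ *-monoʳ-≤ (suc j) (π-dyadic j) ⟩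
  suc j * (j * π (2 ^ j) + 2 ^ suc j) ≤⟨ *-monoʳ-≤ (suc j) (+-monoˡ-≤ (2 ^ suc j) (π-upper j)) ⟩
  suc j * (4 * 2 ^ j + 2 * 2 ^ j) ≡⟨ lem₂ j (2 ^ j) ⟩
  (4 * j + 2 * j + 6) * 2 ^ j ≤⟨ *-monoˡ-≤ (2 ^ j) (≤-trans (+-monoʳ-≤ (4 * j + 2 * j) (≤-trans (m≤n+m 6 2) (*-monoʳ-≤ 2 4≤j))) (≤-reflexive (lem₃ j))) ⟩
  8 * j * 2 ^ j ≡⟨ lem₄ j (2 ^ j) ⟩
  j * (4 * 2 ^ suc j) ∎)
  where
  open ≤-Reasoning
  4≤j : 4 ≤ j
  4≤j = ≤-pred (≰⇒> j≮4)
  lem₁ : ∀ a b c → a * (b * c) ≡ b * (a * c)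
  lem₁ = solve-∀
  lem₂ : ∀ j x → suc j * (4 * x + 2 * x) ≡ (4 * j + 2 * j + 6) * x
  lem₂ = solve-∀
  lem₃ : ∀ j → 4 * j + 2 * j + 2 * j ≡ 8 * j
  lem₃ = solve-∀
  lem₄ : ∀ j x → 8 * j * x ≡ j * (4 * (2 * x))
  lem₄ = solve-∀

h*h≤2*2^h : ∀ h → h * h ≤ 2 * 2 ^ h
h*h≤2*2^h 0 = z≤n
h*h≤2*2^h 1 = s≤s z≤n
h*h≤2*2^h 2 = m≤m+n 4 4
h*h≤2*2^h 3 = m≤m+n 9 7
h*h≤2*2^h (suc n@(suc (suc (suc h)))) = begin
  (4 + h) * (4 + h) ≤⟨ m≤m+n _ (2 + 4 * h + h * h) ⟩
  (4 + h) * (4 + h) + (2 + 4 * h + h * h) ≡⟨ lem h ⟩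
  2 * ((3 + h) * (3 + h)) ≤⟨ *-monoʳ-≤ 2 (h*h≤2*2^h n) ⟩
  2 * (2 * 2 ^ (3 + h)) ∎
  where
  open ≤-Reasoning
  lem : ∀ h → (4 + h) * (4 + h) + (2 + 4 * h + h * h) ≡ 2 * ((3 + h) * (3 + h))
  lem = solve-∀

select : (ℕ → Bool) → ℕ → List ℕ
select b zero = []
select b (suc n) = if b (suc n) then suc n ∷ select b n else select b n

length-select : ∀ b n → length (select b n) ≡ count b n
length-select b zero = refl
length-select b (suc n) with b (suc n)
... | true = cong suc (length-select b n)
... | false = length-select b n

∈-select : ∀ b n k → 1 ≤ k → k ≤ n → T (b k) → k ∈ select b n
∈-select b zero k 1≤k k≤0 _ = contradiction (≤-trans 1≤k k≤0) λ ()
∈-select b (suc n) k 1≤k k≤n Tb with m≤n⇒m<n∨m≡n k≤n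
∈-select b (suc n) k 1≤k k≤n Tb | inj₁ k<n with b (suc n)
... | true = there (∈-select b n k 1≤k (≤-pred k<n) Tb)
... | false = ∈-select b n k 1≤k (≤-pred k<n) Tb
∈-select b (suc n) k 1≤k k≤n Tb | inj₂ refl with b (suc n)
... | true = here refl

gather : (ℕ → List ℕ) → ℕ → List ℕ
gather f zero = []
gather f (suc n) = f (suc n) ++ gather f n

length-gather : ∀ f n → length (gather f n) ≡ sumTo (length ∘ f) n
length-gather f zero = refl
length-gather f (suc n) = trans (length-++ (f (suc n))) (cong (length (f (suc n)) +_) (length-gather f n))

∈-gather : ∀ f n i {x} → 1 ≤ i → i ≤ n → x ∈ f i → x ∈ gather f n
∈-gather f zero i 1≤i i≤0 _ = contradiction (≤-trans 1≤i i≤0) λ ()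
∈-gather f (suc n) i 1≤i i≤n x∈ with m≤n⇒m<n∨m≡n i≤n
... | inj₁ i<n = ∈-++⁺ʳ (f (suc n)) (∈-gather f n i 1≤i (≤-pred i<n) x∈)
... | inj₂ refl = ∈-++⁺ˡ x∈

occurrences : List ℕ → ℕ → ℕ
occurrences [] k = 0
occurrences (x ∷ xs) k = 𝟙 (x ≟ k) + occurrences xs k

sum-occurrences : ∀ xs n → sumTo (occurrences xs) n ≤ length xs
sum-occurrences [] n = ≤-reflexive (sum-0 n)
sum-occurrences (x ∷ xs) n = ≤-trans (≤-reflexive (sum-+ (λ k → 𝟙 (x ≟ k)) (occurrences xs) n))
  (+-mono-≤ (sum-unique (x ≟_) n (λ i j p q → trans (sym p) q)) (sum-occurrences xs n))

∈⇒occurs : ∀ {xs k} → k ∈ xs → 1 ≤ occurrences xs k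
∈⇒occurs {x ∷ xs} {k} (here refl) = ≤-trans (≤-reflexive (sym (𝟙-yes (x ≟ x) refl))) (m≤m+n _ _)
∈⇒occurs {x ∷ xs} {k} (there k∈) = ≤-trans (∈⇒occurs k∈) (m≤n+m _ (𝟙 (x ≟ k)))

primePowerList : ℕ → List ℕ
primePowerList k = select isPrime (2 ^ k) ++ gather (λ a → map (_^ suc a) (select (λ _ → true) (2 ^ ⌈ k /2⌉))) k

k≤2⌈k/2⌉ : ∀ k → k ≤ ⌈ k /2⌉ + ⌈ k /2⌉
k≤2⌈k/2⌉ k = ≤-trans (≤-reflexive (sym (⌊n/2⌋+⌈n/2⌉≡n k))) (+-monoˡ-≤ ⌈ k /2⌉ (⌊n/2⌋≤⌈n/2⌉ k))

2⌈k/2⌉≤1+k : ∀ k → ⌈ k /2⌉ + ⌈ k /2⌉ ≤ suc k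
2⌈k/2⌉≤1+k k = ≤-trans (+-monoʳ-≤ ⌈ k /2⌉ (⌊n/2⌋≤⌈n/2⌉ (suc k))) (≤-reflexive (⌊n/2⌋+⌈n/2⌉≡n (suc k)))

∈-primePowerList : ∀ p a k → Prime p → p ^ suc a ≤ 2 ^ k → p ^ suc a ∈ primePowerList k
∈-primePowerList p zero k pp h = ∈-++⁺ˡ (subst (_∈ select isPrime (2 ^ k)) (sym (*-identityʳ p))
  (∈-select isPrime (2 ^ k) p (prime⇒1≤ pp) (≤-trans (≤-reflexive (sym (*-identityʳ p))) h) (fromWitness pp)))
∈-primePowerList p (suc a) k pp h = ∈-++⁺ʳ (select isPrime (2 ^ k))
  (∈-gather _ k (suc a) (s≤s z≤n) (≤-trans (n≤1+n _) 2+a≤k)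
    (∈-map⁺ (_^ suc (suc a)) (∈-select (λ _ → true) (2 ^ ⌈ k /2⌉) p (prime⇒1≤ pp) p≤ _)))
  where
  open ≤-Reasoning
  2+a≤k : suc (suc a) ≤ k
  2+a≤k = 2^-cancel-≤ _ k (≤-trans (^-monoˡ-≤ (suc (suc a)) (prime⇒2≤ pp)) h)
  p≤ : p ≤ 2 ^ ⌈ k /2⌉
  p≤ with p ≤? 2 ^ ⌈ k /2⌉
  ... | yes q = q
  ... | no q = contradiction (begin-strict
    2 ^ k ≤⟨ ^-monoʳ-≤ 2 (k≤2⌈k/2⌉ k) ⟩
    2 ^ (⌈ k /2⌉ + ⌈ k /2⌉) ≡⟨ ^-distribˡ-+-* 2 ⌈ k /2⌉ ⌈ k /2⌉ ⟩
    2 ^ ⌈ k /2⌉ * 2 ^ ⌈ k /2⌉ <⟨ *-mono-< (≰⇒> q) (≰⇒> q) ⟩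
    p * p ≤⟨ *-monoʳ-≤ p (m≤m*n p (p ^ a) {{m^n≢0 p a {{prime⇒nonZero pp}}}}) ⟩
    p ^ suc (suc a) ≤⟨ h ⟩
    2 ^ k ∎) (<-irrefl refl)

-- 20 = 4 + 16: the primes give 4 by `π-upper`, and with h = ⌈k / 2⌉ the higher powers give k² 2 ^ h
-- ≤ 4 h² 2 ^ h ≤ 8 · 2 ^ (2 h) ≤ 16 · 2 ^ k.
length-primePowerList : ∀ k → k * length (primePowerList k) ≤ 20 * 2 ^ k
length-primePowerList k = begin
  k * length (primePowerList k) ≡⟨ cong (k *_) (trans (length-++ (select isPrime (2 ^ k))) (cong₂ _+_ (length-select isPrime (2 ^ k)) (length-gather _ k))) ⟩
  k * (π (2 ^ k) + sumTo (λ a → length (map (_^ suc a) all)) k) ≤⟨ *-monoʳ-≤ k (+-monoʳ-≤ (π (2 ^ k)) (sum-≤-const (2 ^ h) k (λ a _ _ → len a))) ⟩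
  k * (π (2 ^ k) + k * 2 ^ h) ≡⟨ lem₁ k (π (2 ^ k)) (2 ^ h) ⟩
  k * π (2 ^ k) + k * k * 2 ^ h ≤⟨ +-mono-≤ (π-upper k) (*-monoˡ-≤ (2 ^ h) (*-mono-≤ (k≤2⌈k/2⌉ k) (k≤2⌈k/2⌉ k))) ⟩
  4 * 2 ^ k + (h + h) * (h + h) * 2 ^ h ≡⟨ cong (4 * 2 ^ k +_) (lem₂ h (2 ^ h)) ⟩
  4 * 2 ^ k + 4 * (h * h) * 2 ^ h ≤⟨ +-monoʳ-≤ (4 * 2 ^ k) (*-monoˡ-≤ (2 ^ h) (*-monoʳ-≤ 4 (h*h≤2*2^h h))) ⟩
  4 * 2 ^ k + 4 * (2 * 2 ^ h) * 2 ^ h ≡⟨ cong (4 * 2 ^ k +_) (lem₃ (2 ^ h)) ⟩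
  4 * 2 ^ k + 8 * (2 ^ h * 2 ^ h) ≡⟨ cong (λ x → 4 * 2 ^ k + 8 * x) (^-distribˡ-+-* 2 h h) ⟨
  4 * 2 ^ k + 8 * 2 ^ (h + h) ≤⟨ +-monoʳ-≤ (4 * 2 ^ k) (*-monoʳ-≤ 8 (^-monoʳ-≤ 2 (2⌈k/2⌉≤1+k k))) ⟩
  4 * 2 ^ k + 8 * 2 ^ suc k ≡⟨ lem₄ (2 ^ k) ⟩
  20 * 2 ^ k ∎
  where
  open ≤-Reasoning
  h : ℕ
  h = ⌈ k /2⌉
  all : List ℕ
  all = select (λ _ → true) (2 ^ h)
  len : ∀ a → length (map (_^ suc a) all) ≤ 2 ^ h
  len a = ≤-trans (≤-reflexive (trans (length-map _ all) (length-select _ (2 ^ h)))) (count≤ _ (2 ^ h))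
  lem₁ : ∀ k x y → k * (x + k * y) ≡ k * x + k * k * y
  lem₁ = solve-∀
  lem₂ : ∀ h x → (h + h) * (h + h) * x ≡ 4 * (h * h) * x
  lem₂ = solve-∀
  lem₃ : ∀ x → 4 * (2 * x) * x ≡ 8 * (x * x)
  lem₃ = solve-∀
  lem₄ : ∀ x → 4 * x + 8 * (2 * x) ≡ 20 * x
  lem₄ = solve-∀

-- The number of binary digits, an upper bound for 1 + 1 / 2 + ... + 1 / n that grows by exactly 1
-- when n is doubled.
lg : ℕ → ℕ
lg n = suc ⌊log₂ n ⌋

lg-half : ∀ n → 2 ≤ n → suc (lg ⌊ n /2⌋) ≡ lg n
lg-half n 2≤n = cong suc (trans (cong suc (⌊log₂⌊n/2⌋⌋≡⌊log₂n⌋∸1 n))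
  (m+[n∸m]≡n {1} (≤-trans (≤-reflexive (sym (⌊log₂[2^n]⌋≡n 1))) (⌊log₂⌋-mono-≤ 2≤n))))

-- After division by 2 ^ n the terms are at most A / i. The indices above m = ⌊n / 2⌋ number at most
-- m + 1 and each contributes at most A / (m + 1), so one halving of n costs A.
harmonic-upper : ∀ (a : ℕ → ℕ) A n → 1 ≤ n → (∀ i → 1 ≤ i → i ≤ n → i * a i ≤ A * 2 ^ i) →
                 sumTo (λ i → 2 ^ (n ∸ i) * a i) n ≤ A * 2 ^ n * lg n
harmonic-upper a A = <-rec _ go
  where
  open ≤-Reasoning
  go : ∀ n → (∀ {k} → k < n → 1 ≤ k → (∀ i → 1 ≤ i → i ≤ k → i * a i ≤ A * 2 ^ i) →
         sumTo (λ i → 2 ^ (k ∸ i) * a i) k ≤ A * 2 ^ k * lg k) →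
       1 ≤ n → (∀ i → 1 ≤ i → i ≤ n → i * a i ≤ A * 2 ^ i) →
       sumTo (λ i → 2 ^ (n ∸ i) * a i) n ≤ A * 2 ^ n * lg n
  go 1 rec _ h = begin
    1 * a 1 + 0 ≡⟨ +-identityʳ (1 * a 1) ⟩
    1 * a 1 ≤⟨ h 1 ≤-refl ≤-refl ⟩
    A * 2 ≡⟨ *-identityʳ (A * 2) ⟨
    A * 2 * 1 ∎
  go n@(suc (suc _)) rec 1≤n h = begin
    sumTo f n ≡⟨ cong (sumTo f) n≡ ⟨
    sumTo f (m + m′) ≡⟨ sum-add f m m′ ⟩
    sumTo f m + sumTo (λ i → f (m + i)) m′ ≤⟨ +-mono-≤ low high ⟩
    A * 2 ^ n * lg m + A * 2 ^ n ≡⟨ lem (A * 2 ^ n) (lg m) ⟩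
    A * 2 ^ n * suc (lg m) ≡⟨ cong (A * 2 ^ n *_) (lg-half n (s≤s (s≤s z≤n))) ⟩
    A * 2 ^ n * lg n ∎
    where
    f : ℕ → ℕ
    f i = 2 ^ (n ∸ i) * a i
    m m′ : ℕ
    m = ⌊ n /2⌋
    m′ = ⌈ n /2⌉
    n≡ : m + m′ ≡ n
    n≡ = ⌊n/2⌋+⌈n/2⌉≡n n
    m≤n : m ≤ n
    m≤n = ⌊n/2⌋≤n n
    lem : ∀ x y → x * y + x ≡ x * suc y
    lem = solve-∀
    lem₁ : ∀ x y A l → x * (A * y * l) ≡ A * (x * y) * l
    lem₁ = solve-∀
    lem₂ : ∀ x y A → x * (A * y) ≡ A * (x * y)
    lem₂ = solve-∀
    lem₃ : ∀ x y z → x * (y * z) ≡ y * (x * z)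
    lem₃ = solve-∀
    pow : ∀ i → i ≤ n → 2 ^ (n ∸ i) * 2 ^ i ≡ 2 ^ n
    pow i i≤n = trans (sym (^-distribˡ-+-* 2 (n ∸ i) i)) (cong (2 ^_) (m∸n+n≡m i≤n))
    low : sumTo f m ≤ A * 2 ^ n * lg m
    low = begin
      sumTo f m ≡⟨ sum-cong m (λ i _ i≤m → trans (cong (λ e → 2 ^ e * a i) (trans (cong (_∸ i) (sym (m∸n+n≡m m≤n))) (+-∸-assoc (n ∸ m) i≤m)))
                     (trans (cong (_* a i) (^-distribˡ-+-* 2 (n ∸ m) (m ∸ i))) (*-assoc (2 ^ (n ∸ m)) _ _))) ⟩
      sumTo (λ i → 2 ^ (n ∸ m) * (2 ^ (m ∸ i) * a i)) m ≡⟨ sum-*ˡ (2 ^ (n ∸ m)) _ m ⟩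
      2 ^ (n ∸ m) * sumTo (λ i → 2 ^ (m ∸ i) * a i) m ≤⟨ *-monoʳ-≤ (2 ^ (n ∸ m)) (rec (⌊n/2⌋<n _) (s≤s z≤n) (λ i l u → h i l (≤-trans u m≤n))) ⟩
      2 ^ (n ∸ m) * (A * 2 ^ m * lg m) ≡⟨ lem₁ (2 ^ (n ∸ m)) (2 ^ m) A (lg m) ⟩
      A * (2 ^ (n ∸ m) * 2 ^ m) * lg m ≡⟨ cong (λ x → A * x * lg m) (pow m m≤n) ⟩
      A * 2 ^ n * lg m ∎
    high : sumTo (λ i → f (m + i)) m′ ≤ A * 2 ^ n
    high = *-cancelˡ-≤ (suc m) (begin
      suc m * sumTo (λ i → f (m + i)) m′ ≡⟨ sum-*ˡ (suc m) (λ i → f (m + i)) m′ ⟨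
      sumTo (λ i → suc m * f (m + i)) m′ ≤⟨ sum-≤-const (A * 2 ^ n) m′ (λ i 1≤i i≤m′ → term (m + i)
         (≤-trans (≤-reflexive (+-comm 1 m)) (+-monoʳ-≤ m 1≤i)) (≤-trans (+-monoʳ-≤ m i≤m′) (≤-reflexive n≡))) ⟩
      m′ * (A * 2 ^ n) ≤⟨ *-monoˡ-≤ (A * 2 ^ n) (⌊n/2⌋-mono (n≤1+n (suc n))) ⟩
      suc m * (A * 2 ^ n) ∎)
      where
      term : ∀ i → suc m ≤ i → i ≤ n → suc m * f i ≤ A * 2 ^ n
      term i m<i i≤n = begin
        suc m * (2 ^ (n ∸ i) * a i) ≤⟨ *-monoˡ-≤ (f i) m<i ⟩
        i * (2 ^ (n ∸ i) * a i) ≡⟨ lem₃ i (2 ^ (n ∸ i)) (a i) ⟩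
        2 ^ (n ∸ i) * (i * a i) ≤⟨ *-monoʳ-≤ (2 ^ (n ∸ i)) (h i (≤-trans (s≤s z≤n) m<i) i≤n) ⟩
        2 ^ (n ∸ i) * (A * 2 ^ i) ≡⟨ lem₂ (2 ^ (n ∸ i)) (2 ^ i) A ⟩
        A * (2 ^ (n ∸ i) * 2 ^ i) ≡⟨ cong (A *_) (pow i i≤n) ⟩
        A * 2 ^ n ∎

sum-rev : ∀ f n → sumTo f n ≡ sumTo (λ i → f (suc n ∸ i)) n
sum-rev f zero = refl
sum-rev f (suc n) = trans (cong (f (suc n) +_) (sum-rev f n)) (sym (sum-suc (λ i → f (suc (suc n) ∸ i)) n))

dyadic : ∀ n m → 1 ≤ m → m < 2 ^ n → ∃[ i ] (i < n × 2 ^ i ≤ m × m < 2 ^ suc i)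
dyadic zero m 1≤m m<1 = contradiction m<1 (≤⇒≯ 1≤m)
dyadic (suc n) m 1≤m m< with 2 ^ n ≤? m
... | yes l = n , ≤-refl , l , m<
... | no ¬l with dyadic n m 1≤m (≰⇒> ¬l)
...   | i , i<n , l , u = i , m≤n⇒m≤1+n i<n , l , u

-- A product q m < 2 ^ n with 2 ^ (i - 1) ≤ m < 2 ^ i has q ≤ 2 ^ (n + 1 - i). Fixing i thus
-- decouples the two factors and turns the count into a convolution.
smallPowerProducts : ℕ → ℕ → List ℕ
smallPowerProducts zero n = 1 ∷ []
smallPowerProducts (suc r) n = smallPowerProducts r n ++
  gather (λ i → cartesianProductWith _*_ (primePowerList (suc n ∸ i)) (smallPowerProducts r i)) n

primePowers≥1 : ∀ {r x} → PrimePowers r x → 1 ≤ x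
primePowers≥1 one = ≤-refl
primePowers≥1 (skip t) = primePowers≥1 t
primePowers≥1 (times p a pp t) = *-mono-≤ (1≤m^n p (suc a) (prime⇒1≤ pp)) (primePowers≥1 t)

∈-smallPowerProducts : ∀ {r x} n → PrimePowers r x → x < 2 ^ n → x ∈ smallPowerProducts r n
∈-smallPowerProducts n one _ = here refl
∈-smallPowerProducts n (skip t) h = ∈-++⁺ˡ (∈-smallPowerProducts n t h)
∈-smallPowerProducts {suc r} n (times {n = m} p a pp t) h
  with dyadic n m (primePowers≥1 t) (≤-<-trans (m≤n*m m (p ^ suc a) {{>-nonZero (1≤m^n p (suc a) (prime⇒1≤ pp))}}) h)
... | i , i<n , l , u = ∈-++⁺ʳ (smallPowerProducts r n) (∈-gather _ n (suc i) (s≤s z≤n) i<n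
        (∈-cartesianProductWith⁺ _*_ (∈-primePowerList p a (n ∸ i) pp q≤) (∈-smallPowerProducts (suc i) t u)))
  where
  open ≤-Reasoning
  q≤ : p ^ suc a ≤ 2 ^ (n ∸ i)
  q≤ = *-cancelʳ-≤ (p ^ suc a) (2 ^ (n ∸ i)) (2 ^ i) {{m^n≢0 2 i}} (begin
    p ^ suc a * 2 ^ i ≤⟨ *-monoʳ-≤ (p ^ suc a) l ⟩
    p ^ suc a * m ≤⟨ <⇒≤ h ⟩
    2 ^ n ≡⟨ cong (2 ^_) (m∸n+n≡m (<⇒≤ i<n)) ⟨
    2 ^ (n ∸ i + i) ≡⟨ ^-distribˡ-+-* 2 (n ∸ i) i ⟩
    2 ^ (n ∸ i) * 2 ^ i ∎)

length-cartesianProductWith : ∀ xs ys → length (cartesianProductWith _*_ xs ys) ≡ length xs * length ys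
length-cartesianProductWith [] ys = refl
length-cartesianProductWith (x ∷ xs) ys = trans (length-++ (map (x *_) ys))
  (cong₂ _+_ (length-map (x *_) ys) (length-cartesianProductWith xs ys))

-- In the convolution the factor n + 1 = i + (n + 1 - i) is split, each part cancelling the
-- denominator of one of the two counts; what remains is a harmonic sum. 81 = 1 + 40 + 40, from the
-- sublist for r and from the two parts.
length-smallPowerProducts : ∀ r n → 1 ≤ n → n * length (smallPowerProducts r n) ≤ 81 ^ r * lg n ^ r * 2 ^ n
length-smallPowerProducts zero n 1≤n = ≤-trans (≤-reflexive (*-identityʳ n)) (≤-trans (<⇒≤ (n<2^n n)) (≤-reflexive (sym (*-identityˡ (2 ^ n)))))
length-smallPowerProducts (suc r) n 1≤n = begin
  n * length (smallPowerProducts (suc r) n) ≡⟨ cong (n *_) (trans (length-++ (smallPowerProducts r n)) (cong (a n +_) (trans (length-gather _ n)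
     (sum-cong n (λ i _ _ → length-cartesianProductWith (primePowerList (suc n ∸ i)) (smallPowerProducts r i)))))) ⟩
  n * (a n + conv) ≤⟨ ≤-trans (≤-reflexive (*-distribˡ-+ n (a n) conv)) (+-monoʳ-≤ (n * a n) (*-monoˡ-≤ conv (n≤1+n n))) ⟩
  n * a n + suc n * conv ≤⟨ +-mono-≤ (bound n 1≤n ≤-refl) convBound ⟩
  B * 2 ^ n + (B * (20 * 2 ^ n * lg n * 2) + 20 * (B * 2 ^ n * lg n * 2)) ≤⟨ +-monoˡ-≤ _ (m≤m*n (B * 2 ^ n) (lg n)) ⟩
  B * 2 ^ n * lg n + (B * (20 * 2 ^ n * lg n * 2) + 20 * (B * 2 ^ n * lg n * 2)) ≡⟨ lem (81 ^ r) (lg n ^ r) (2 ^ n) (lg n) ⟩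
  81 ^ suc r * lg n ^ suc r * 2 ^ n ∎
  where
  open ≤-Reasoning
  a b : ℕ → ℕ
  a i = length (smallPowerProducts r i)
  b i = length (primePowerList i)
  B conv : ℕ
  B = 81 ^ r * lg n ^ r
  conv = sumTo (λ i → b (suc n ∸ i) * a i) n
  lem : ∀ x y z l → x * y * z * l + (x * y * (20 * z * l * 2) + 20 * (x * y * z * l * 2)) ≡ 81 * x * (l * y) * z
  lem = solve-∀
  bound : ∀ i → 1 ≤ i → i ≤ n → i * a i ≤ B * 2 ^ i
  bound i 1≤i i≤n = ≤-trans (length-smallPowerProducts r i 1≤i)
    (*-monoˡ-≤ (2 ^ i) (*-monoʳ-≤ (81 ^ r) (^-monoˡ-≤ r (s≤s (⌊log₂⌋-mono-≤ i≤n)))))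
  lem₁ : ∀ i k x y → (i + k) * (x * y) ≡ x * (i * y) + k * x * y
  lem₁ = solve-∀
  lem₂ : ∀ x B y z w → x * (B * y) + 20 * z * w ≡ B * (y * x) + 20 * (z * w)
  lem₂ = solve-∀
  term : ∀ i → 1 ≤ i → i ≤ n → suc n * (b (suc n ∸ i) * a i) ≤ B * (2 ^ i * b (suc n ∸ i)) + 20 * (2 ^ (suc n ∸ i) * a i)
  term i 1≤i i≤n = begin
    suc n * (b k * a i) ≡⟨ cong (_* (b k * a i)) (m+[n∸m]≡n (m≤n⇒m≤1+n i≤n)) ⟨
    (i + k) * (b k * a i) ≡⟨ lem₁ i k (b k) (a i) ⟩
    b k * (i * a i) + k * b k * a i ≤⟨ +-mono-≤ (*-monoʳ-≤ (b k) (bound i 1≤i i≤n)) (*-monoˡ-≤ (a i) (length-primePowerList k)) ⟩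
    b k * (B * 2 ^ i) + 20 * 2 ^ k * a i ≡⟨ lem₂ (b k) B (2 ^ i) (2 ^ k) (a i) ⟩
    B * (2 ^ i * b k) + 20 * (2 ^ k * a i) ∎
    where
    k : ℕ
    k = suc n ∸ i
  pow : ∀ (f : ℕ → ℕ) i → i ≤ n → 2 ^ (suc n ∸ i) * f i ≡ 2 ^ (n ∸ i) * f i * 2
  pow f i i≤n = trans (cong (λ e → 2 ^ e * f i) (+-∸-assoc 1 i≤n)) (lem₃ (2 ^ (n ∸ i)) (f i))
    where
    lem₃ : ∀ x y → 2 * x * y ≡ x * y * 2
    lem₃ = solve-∀
  shifted : ∀ (f : ℕ → ℕ) D → (∀ i → 1 ≤ i → i ≤ n → i * f i ≤ D * 2 ^ i) → sumTo (λ i → 2 ^ (suc n ∸ i) * f i) n ≤ D * 2 ^ n * lg n * 2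
  shifted f D h = ≤-trans (≤-reflexive (trans (sum-cong n (λ i _ → pow f i)) (sum-*ʳ 2 _ n))) (*-monoˡ-≤ 2 (harmonic-upper f D n 1≤n h))
  convBound : suc n * conv ≤ B * (20 * 2 ^ n * lg n * 2) + 20 * (B * 2 ^ n * lg n * 2)
  convBound = begin
    suc n * conv ≡⟨ sum-*ˡ (suc n) _ n ⟨
    sumTo (λ i → suc n * (b (suc n ∸ i) * a i)) n ≤⟨ sum-mono n term ⟩
    sumTo (λ i → B * (2 ^ i * b (suc n ∸ i)) + 20 * (2 ^ (suc n ∸ i) * a i)) n
      ≡⟨ trans (sum-+ _ _ n) (cong₂ _+_ (sum-*ˡ B _ n) (sum-*ˡ 20 _ n)) ⟩
    B * sumTo (λ i → 2 ^ i * b (suc n ∸ i)) n + 20 * sumTo (λ i → 2 ^ (suc n ∸ i) * a i) n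
      ≡⟨ cong (λ x → B * x + 20 * sumTo (λ i → 2 ^ (suc n ∸ i) * a i) n) (trans (sum-rev _ n)
           (sum-cong n (λ i _ i≤n → cong (λ x → 2 ^ (suc n ∸ i) * b x) (m∸[m∸n]≡n (m≤n⇒m≤1+n i≤n))))) ⟩
    B * sumTo (λ i → 2 ^ (suc n ∸ i) * b i) n + 20 * sumTo (λ i → 2 ^ (suc n ∸ i) * a i) n
      ≤⟨ +-mono-≤ (*-monoʳ-≤ B (shifted b 20 (λ i _ _ → length-primePowerList i))) (*-monoʳ-≤ 20 (shifted a B bound)) ⟩
    B * (20 * 2 ^ n * lg n * 2) + 20 * (B * 2 ^ n * lg n * 2) ∎

A≡sum : ∀ m → A m ≡ sumTo (λ k → 𝟙 (φ k ≟ m)) (2 * (m * m))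
A≡sum m = count≡sum _ (λ k → φ k ≟ m) (λ k → ≡ᵇ⇒≡ _ _) (λ k → ≡⇒≡ᵇ _ _) (2 * (m * m))

more-skips : ∀ {r n} d → PrimePowers r n → PrimePowers (d + r) n
more-skips zero t = t
more-skips (suc d) t = skip (more-skips d t)

2^∣⇒≤ : ∀ r ℓ m → 2 ^ r ∣ m → m mod2^ (suc ℓ) ≡ 2 ^ ℓ → r ≤ ℓ
2^∣⇒≤ r ℓ m d e with r ≤? ℓ
... | yes r≤ℓ = r≤ℓ
... | no r≰ℓ = contradiction (trans (sym e) (n∣m⇒m%n≡0 m (2 ^ suc ℓ) {{m^n≢0 2 (suc ℓ)}}
        (∣-trans (subst (2 ^ suc ℓ ∣_) (trans (sym (^-distribˡ-+-* 2 (suc ℓ) (r ∸ suc ℓ))) (cong (2 ^_) (m+[n∸m]≡n (≰⇒> r≰ℓ)))) (m∣m*n (2 ^ (r ∸ suc ℓ)))) d)))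
        (≢-nonZero⁻¹ (2 ^ ℓ) {{m^n≢0 2 ℓ}})

-- For φ k ≡ 2 ^ ℓ modulo 2 ^ (ℓ + 1), the r of `fewPrimes` is at most ℓ, so k is in the list with r
-- + 1 ≤ ℓ + 1 prime powers and k < 2 ^ (ℓ + 1 + n). Each k is counted for the single value m = φ k.
S-upper : ∀ ℓ n N → N < 2 ^ n → S ℓ N ≤ length (smallPowerProducts (suc ℓ) (suc ℓ + n))
S-upper ℓ n N N< = begin
  S ℓ N ≤⟨ sum-mono N term ⟩
  sumTo (λ m → sumTo (λ k → 𝟙 (φ k ≟ m) * occ k) R) N ≡⟨ sum-swap (λ m k → 𝟙 (φ k ≟ m) * occ k) N R ⟩
  sumTo (λ k → sumTo (λ m → 𝟙 (φ k ≟ m) * occ k) N) R ≤⟨ sum-mono R (λ k _ _ → ≤-trans (≤-reflexive (sum-*ʳ (occ k) (λ m → 𝟙 (φ k ≟ m)) N))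
     (≤-trans (*-monoˡ-≤ (occ k) (sum-unique (φ k ≟_) N (λ i j p q → trans (sym p) q))) (≤-reflexive (*-identityˡ (occ k))))) ⟩
  sumTo occ R ≤⟨ sum-occurrences list R ⟩
  length list ∎
  where
  open ≤-Reasoning
  list : List ℕ
  list = smallPowerProducts (suc ℓ) (suc ℓ + n)
  occ : ℕ → ℕ
  occ = occurrences list
  R : ℕ
  -- One range for k that serves all m ≤ N, so that the two sums can be exchanged.
  R = 2 * (N * N)
  listed : ∀ m k → 1 ≤ k → m ≤ N → m mod2^ (suc ℓ) ≡ 2 ^ ℓ → φ k ≡ m → k ∈ list
  listed .(φ k) k 1≤k m≤N c refl with fewPrimes k 1≤k
  ... | r , t , d , b = ∈-smallPowerProducts (suc ℓ + n)
      (subst (λ x → PrimePowers x k) (trans (+-suc (ℓ ∸ r) r) (cong suc (m∸n+n≡m r≤ℓ))) (more-skips (ℓ ∸ r) t))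
      (begin-strict
        k ≤⟨ b ⟩
        2 ^ suc r * φ k ≤⟨ *-mono-≤ (^-monoʳ-≤ 2 (s≤s r≤ℓ)) m≤N ⟩
        2 ^ suc ℓ * N <⟨ *-monoʳ-< (2 ^ suc ℓ) {{m^n≢0 2 (suc ℓ)}} N< ⟩
        2 ^ suc ℓ * 2 ^ n ≡⟨ ^-distribˡ-+-* 2 (suc ℓ) n ⟨
        2 ^ (suc ℓ + n) ∎)
    where
    r≤ℓ : r ≤ ℓ
    r≤ℓ = 2^∣⇒≤ r ℓ (φ k) d c
  term : ∀ m → 1 ≤ m → m ≤ N → (if m mod2^ (suc ℓ) ≡ᵇ 2 ^ ℓ then A m else 0) ≤ sumTo (λ k → 𝟙 (φ k ≟ m) * occ k) R
  term m 1≤m m≤N with m mod2^ (suc ℓ) ≡ᵇ 2 ^ ℓ in eq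
  ... | false = z≤n
  ... | true = begin
    A m ≡⟨ A≡sum m ⟩
    sumTo (λ k → 𝟙 (φ k ≟ m)) (2 * (m * m)) ≤⟨ sum-monoʳ _ (*-monoʳ-≤ 2 (*-mono-≤ m≤N m≤N)) ⟩
    sumTo (λ k → 𝟙 (φ k ≟ m)) R ≤⟨ sum-mono R (λ k 1≤k _ → 𝟙-≤ (φ k ≟ m) (λ e →
       ≤-trans (∈⇒occurs (listed m k 1≤k m≤N (≡ᵇ⇒≡ _ _ (subst T (sym eq) _)) e)) (≤-reflexive (sym (𝟙*-≡ (φ k ≟ m) e))))) ⟩
    sumTo (λ k → 𝟙 (φ k ≟ m) * occ k) R ∎

-- Selberg's sieve

∑ : ℕ → (ℕ → ℤ) → ℤ
∑ zero f = ⁺ 0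
∑ (suc n) f = ∑ n f ℤ.+ f n

∑-cong : ∀ {f g} n → (∀ i → f i ≡ g i) → ∑ n f ≡ ∑ n g
∑-cong zero h = refl
∑-cong (suc n) h = cong₂ ℤ._+_ (∑-cong n h) (h n)

∑-+ : ∀ f g n → ∑ n (λ i → f i ℤ.+ g i) ≡ ∑ n f ℤ.+ ∑ n g
∑-+ f g zero = refl
∑-+ f g (suc n) = trans (cong (ℤ._+ (f n ℤ.+ g n)) (∑-+ f g n)) (lem (∑ n f) (∑ n g) (f n) (g n))
  where
  lem : ∀ a b c d → a ℤ.+ b ℤ.+ (c ℤ.+ d) ≡ a ℤ.+ c ℤ.+ (b ℤ.+ d)
  lem = ℤ-Ring.solve-∀

∑-*ˡ : ∀ c f n → ∑ n (λ i → c ℤ.* f i) ≡ c ℤ.* ∑ n f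
∑-*ˡ c f zero = sym (ℤₚ.*-zeroʳ c)
∑-*ˡ c f (suc n) = trans (cong (ℤ._+ c ℤ.* f n) (∑-*ˡ c f n)) (sym (ℤₚ.*-distribˡ-+ c (∑ n f) (f n)))

∑-0 : ∀ n → ∑ n (λ _ → ⁺ 0) ≡ ⁺ 0
∑-0 zero = refl
∑-0 (suc n) = trans (ℤₚ.+-identityʳ _) (∑-0 n)

∑-swap : ∀ (f : ℕ → ℕ → ℤ) m n → ∑ m (λ i → ∑ n (f i)) ≡ ∑ n (λ j → ∑ m (λ i → f i j))
∑-swap f zero n = sym (∑-0 n)
∑-swap f (suc m) n = trans (cong (ℤ._+ ∑ n (f m)) (∑-swap f m n)) (sym (∑-+ (λ j → ∑ m (λ i → f i j)) (f m) n))

∑-add : ∀ f m n → ∑ (m + n) f ≡ ∑ m f ℤ.+ ∑ n (λ i → f (m + i))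
∑-add f m zero = trans (cong (λ x → ∑ x f) (+-identityʳ m)) (sym (ℤₚ.+-identityʳ (∑ m f)))
∑-add f m (suc n) = trans (cong (λ x → ∑ x f) (+-suc m n))
  (trans (cong (ℤ._+ f (m + n)) (∑-add f m n)) (ℤₚ.+-assoc (∑ m f) (∑ n (λ i → f (m + i))) (f (m + n))))

∑-blocks : ∀ f p n → ∑ (n * p) f ≡ ∑ n (λ i → ∑ p (λ r → f (i * p + r)))
∑-blocks f p zero = refl
∑-blocks f p (suc n) = trans (cong (λ x → ∑ x f) (+-comm p (n * p)))
  (trans (∑-add f (n * p) p) (cong (ℤ._+ ∑ p (λ r → f (n * p + r))) (∑-blocks f p n)))

∑-truncate : ∀ f p ρ → ρ ≤ p → ∑ ρ f ≡ ∑ p (λ r → ⁺ 𝟙 (r <? ρ) ℤ.* f r)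
∑-truncate f p ρ ρ≤p = sym (trans (cong (λ x → ∑ x g) (sym (m+[n∸m]≡n ρ≤p))) (trans (∑-add g ρ (p ∸ ρ))
    (trans (cong₂ ℤ._+_ (small ρ ≤-refl) (trans (∑-cong (p ∸ ρ) (λ i → cong (λ x → ⁺ x ℤ.* f (ρ + i))
       (𝟙-no (ρ + i <? ρ) (≤⇒≯ (m≤m+n ρ i))))) (∑-0 (p ∸ ρ)))) (ℤₚ.+-identityʳ _))))
  where
  g : ℕ → ℤ
  g r = ⁺ 𝟙 (r <? ρ) ℤ.* f r
  small : ∀ k → k ≤ ρ → ∑ k g ≡ ∑ k f
  small zero _ = refl
  small (suc k) k<ρ = cong₂ ℤ._+_ (small k (<⇒≤ k<ρ)) (trans (cong (λ x → ⁺ x ℤ.* f k) (𝟙-yes (k <? ρ) k<ρ)) (ℤₚ.*-identityˡ (f k)))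

-- For r < p, the number of j < J congruent to r modulo p.
classSize : ∀ p .{{_ : NonZero p}} → ℕ → ℕ → ℕ
classSize p J r = J / p + 𝟙 (r <? J % p)

∑-residues : ∀ f p .{{_ : NonZero p}} J → ∑ J f ≡ ∑ p (λ r → ∑ (classSize p J r) (λ i → f (i * p + r)))
∑-residues f p J = begin
  ∑ J f ≡⟨ cong (λ x → ∑ x f) (trans (m≡m%n+[m/n]*n J p) (+-comm (J % p) _)) ⟩
  ∑ (q * p + ρ) f ≡⟨ ∑-add f (q * p) ρ ⟩
  ∑ (q * p) f ℤ.+ ∑ ρ (λ r → f (q * p + r)) ≡⟨ cong₂ ℤ._+_ (trans (∑-blocks f p q) (∑-swap (λ i r → f (i * p + r)) q p)) (∑-truncate (λ r → f (q * p + r)) p ρ (m%n≤n J p)) ⟩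
  ∑ p (λ r → ∑ q (λ i → f (i * p + r))) ℤ.+ ∑ p (λ r → ⁺ 𝟙 (r <? ρ) ℤ.* f (q * p + r)) ≡⟨ ∑-+ _ _ p ⟨
  ∑ p (λ r → ∑ q (λ i → f (i * p + r)) ℤ.+ ⁺ 𝟙 (r <? ρ) ℤ.* f (q * p + r)) ≡⟨ ∑-cong p extend ⟩
  ∑ p (λ r → ∑ (classSize p J r) (λ i → f (i * p + r))) ∎
  where
  open ≡-Reasoning
  q ρ : ℕ
  q = J / p
  ρ = J % p
  extend : ∀ r → ∑ q (λ i → f (i * p + r)) ℤ.+ ⁺ 𝟙 (r <? ρ) ℤ.* f (q * p + r) ≡ ∑ (classSize p J r) (λ i → f (i * p + r))
  extend r with r <? ρ
  ... | yes _ = trans (cong (λ y → ∑ q (λ i → f (i * p + r)) ℤ.+ y) (ℤₚ.*-identityˡ (f (q * p + r)))) (cong (λ x → ∑ x (λ i → f (i * p + r))) (sym (+-comm q 1)))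
  ... | no _ = trans (ℤₚ.+-identityʳ _) (cong (λ x → ∑ x (λ i → f (i * p + r))) (sym (+-identityʳ q)))

∑-weighted-≤ : ∀ (b : ℕ → ℕ) (x : ℕ → ℤ) e n → (∀ i → ‖ x i ‖ ≤ e) → ‖ ∑ n (λ i → ⁺ b i ℤ.* x i) ‖ ≤ ‖ ∑ n (λ i → ⁺ b i) ‖ * e
∑-weighted-≤ b x e n h = go n
  where
  pos : ∀ n → ∃[ y ] ∑ n (λ i → ⁺ b i) ≡ ⁺ y
  pos zero = 0 , refl
  pos (suc n) with pos n
  ... | y , eq = y + b n , cong (ℤ._+ ⁺ b n) eq
  go : ∀ n → ‖ ∑ n (λ i → ⁺ b i ℤ.* x i) ‖ ≤ ‖ ∑ n (λ i → ⁺ b i) ‖ * e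
  go zero = z≤n
  go (suc n) with pos n | go n
  ... | y , eq | ih rewrite eq = ≤-trans (ℤₚ.∣i+j∣≤∣i∣+∣j∣ (∑ n (λ i → ⁺ b i ℤ.* x i)) (⁺ b n ℤ.* x n))
    (≤-trans (+-mono-≤ ih (≤-trans (≤-reflexive (ℤₚ.abs-* (⁺ b n) (x n))) (*-monoʳ-≤ (b n) (h n))))
      (≤-reflexive (sym (*-distribʳ-+ e y (b n)))))

-- Two of the p residue classes carry the weight b, so weighting scales the average M of F by 2/p.
weighted-average : ∀ (b : ℕ → ℕ) p .{{_ : NonZero p}} h (F : ℕ → ℤ) M E →
  (∀ k i → b (k + p * i) ≡ b k) → (∀ c → ∑ p (λ r → ⁺ b (c + h * r)) ≡ ⁺ 2) →
  (∀ c J → ‖ ∑ J (λ i → F (c + h * p * i)) ℤ.- ⁺ J ℤ.* ⁺ M ‖ ≤ E) →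
  ∀ c J → ‖ ⁺ p ℤ.* ∑ J (λ j → ⁺ b (c + h * j) ℤ.* F (c + h * j)) ℤ.- ⁺ 2 ℤ.* (⁺ J ℤ.* ⁺ M) ‖ ≤ 2 * (p * (E + M))
weighted-average b p h F M E periodic two avg c J = begin
  ‖ ⁺ p ℤ.* ∑ J G ℤ.- ⁺ 2 ℤ.* (⁺ J ℤ.* ⁺ M) ‖ ≡⟨ cong ‖_‖ rearrange ⟩
  ‖ ∑ p (λ r → ⁺ b (c + h * r) ℤ.* x r) ‖ ≤⟨ ∑-weighted-≤ (λ r → b (c + h * r)) x (p * (E + M)) p x-small ⟩
  ‖ ∑ p (λ r → ⁺ b (c + h * r)) ‖ * (p * (E + M)) ≡⟨ cong (λ y → ‖ y ‖ * (p * (E + M))) (two c) ⟩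
  2 * (p * (E + M)) ∎
  where
  open ≤-Reasoning
  G : ℕ → ℤ
  G j = ⁺ b (c + h * j) ℤ.* F (c + h * j)
  N : ℕ → ℕ
  N = classSize p J
  s x : ℕ → ℤ
  s r = ∑ (N r) (λ i → F (c + h * r + h * p * i))
  x r = ⁺ p ℤ.* s r ℤ.- ⁺ J ℤ.* ⁺ M
  index : ∀ c h p r i → c + h * (i * p + r) ≡ c + h * r + h * p * i
  index = solve-∀
  index′ : ∀ c h p r i → c + h * (i * p + r) ≡ c + h * r + p * (h * i)
  index′ = solve-∀
  class : ∀ r i → G (i * p + r) ≡ ⁺ b (c + h * r) ℤ.* F (c + h * r + h * p * i)
  class r i = cong₂ (λ y k → ⁺ y ℤ.* F k) (trans (cong b (index′ c h p r i)) (periodic (c + h * r) (h * i))) (index c h p r i)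
  -- As the weights b over one period add up to 2, the main term can be distributed over the residue
  -- classes, which leaves each class with its own deviation `x r`.
  rearrange : ⁺ p ℤ.* ∑ J G ℤ.- ⁺ 2 ℤ.* (⁺ J ℤ.* ⁺ M) ≡ ∑ p (λ r → ⁺ b (c + h * r) ℤ.* x r)
  rearrange = ≡.begin
    ⁺ p ℤ.* ∑ J G ℤ.- ⁺ 2 ℤ.* (⁺ J ℤ.* ⁺ M) ≡.≡⟨ cong₂ (λ y t → ⁺ p ℤ.* y ℤ.- t ℤ.* (⁺ J ℤ.* ⁺ M)) (trans (∑-residues G p J) (∑-cong p λ r → trans (∑-cong (N r) (class r)) (∑-*ˡ (⁺ b (c + h * r)) _ (N r)))) (sym (two c)) ⟩
    ⁺ p ℤ.* ∑ p (λ r → ⁺ b (c + h * r) ℤ.* s r) ℤ.- ∑ p (λ r → ⁺ b (c + h * r)) ℤ.* (⁺ J ℤ.* ⁺ M) ≡.≡⟨ lem₁ (⁺ p) _ _ (⁺ J ℤ.* ⁺ M) ⟩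
    ⁺ p ℤ.* ∑ p (λ r → ⁺ b (c + h * r) ℤ.* s r) ℤ.+ ℤ.- (⁺ J ℤ.* ⁺ M) ℤ.* ∑ p (λ r → ⁺ b (c + h * r)) ≡.≡⟨ cong₂ ℤ._+_ (∑-*ˡ (⁺ p) _ p) (∑-*ˡ (ℤ.- (⁺ J ℤ.* ⁺ M)) _ p) ⟨
    ∑ p (λ r → ⁺ p ℤ.* (⁺ b (c + h * r) ℤ.* s r)) ℤ.+ ∑ p (λ r → ℤ.- (⁺ J ℤ.* ⁺ M) ℤ.* ⁺ b (c + h * r)) ≡.≡⟨ ∑-+ _ _ p ⟨
    ∑ p (λ r → ⁺ p ℤ.* (⁺ b (c + h * r) ℤ.* s r) ℤ.+ ℤ.- (⁺ J ℤ.* ⁺ M) ℤ.* ⁺ b (c + h * r)) ≡.≡⟨ ∑-cong p (λ r → lem₂ (⁺ p) (⁺ b (c + h * r)) (s r) (⁺ J ℤ.* ⁺ M)) ⟩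
    ∑ p (λ r → ⁺ b (c + h * r) ℤ.* x r) ≡.∎
    where
    module ≡ = ≡-Reasoning
    lem₁ : ∀ p a b m → p ℤ.* a ℤ.- b ℤ.* m ≡ p ℤ.* a ℤ.+ ℤ.- m ℤ.* b
    lem₁ = ℤ-Ring.solve-∀
    lem₂ : ∀ p b s m → p ℤ.* (b ℤ.* s) ℤ.+ ℤ.- m ℤ.* b ≡ b ℤ.* (p ℤ.* s ℤ.- m)
    lem₂ = ℤ-Ring.solve-∀
  defect : ∀ r → ‖ ⁺ p ℤ.* ⁺ N r ℤ.- ⁺ J ‖ ≤ p
  defect r = begin
    ‖ ⁺ p ℤ.* ⁺ N r ℤ.- ⁺ J ‖ ≡⟨ cong ‖_‖ (≡.begin
      ⁺ p ℤ.* ⁺ N r ℤ.- ⁺ J ≡.≡⟨ cong (λ y → ⁺ p ℤ.* ⁺ N r ℤ.- ⁺ y) (m≡m%n+[m/n]*n J p) ⟩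
      ⁺ p ℤ.* ⁺ (q + t) ℤ.- ⁺ (ρ + q * p) ≡.≡⟨ cong₂ (λ y z → ⁺ p ℤ.* y ℤ.- z) (ℤₚ.pos-+ q t) (trans (ℤₚ.pos-+ ρ (q * p)) (cong (λ y → ⁺ ρ ℤ.+ y) (ℤₚ.pos-* q p))) ⟩
      ⁺ p ℤ.* (⁺ q ℤ.+ ⁺ t) ℤ.- (⁺ ρ ℤ.+ ⁺ q ℤ.* ⁺ p) ≡.≡⟨ lem (⁺ p) (⁺ q) (⁺ t) (⁺ ρ) ⟩
      ⁺ p ℤ.* ⁺ t ℤ.- ⁺ ρ ≡.≡⟨ cong (ℤ._- ⁺ ρ) (sym (ℤₚ.pos-* p t)) ⟩
      ⁺ (p * t) ℤ.- ⁺ ρ ≡.≡⟨ ℤₚ.m-n≡m⊖n (p * t) ρ ⟩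
      p * t ℤ.⊖ ρ ≡.∎) ⟩
    ‖ p * t ℤ.⊖ ρ ‖ ≤⟨ ℤₚ.∣m⊝n∣≤m⊔n (p * t) ρ ⟩
    p * t ⊔ ρ ≤⟨ ⊔-lub (≤-trans (*-monoʳ-≤ p (𝟙≤1 (r <? J % p))) (≤-reflexive (*-identityʳ p))) (m%n≤n J p) ⟩
    p ∎
    where
    module ≡ = ≡-Reasoning
    q ρ t : ℕ
    q = J / p
    ρ = J % p
    t = 𝟙 (r <? J % p)
    lem : ∀ p q t ρ → p ℤ.* (q ℤ.+ t) ℤ.- (ρ ℤ.+ q ℤ.* p) ≡ p ℤ.* t ℤ.- ρ
    lem = ℤ-Ring.solve-∀
  x-small : ∀ r → ‖ x r ‖ ≤ p * (E + M)
  x-small r = begin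
    ‖ x r ‖ ≡⟨ cong ‖_‖ (lem (⁺ p) (s r) (⁺ N r) (⁺ J) (⁺ M)) ⟩
    ‖ ⁺ p ℤ.* (s r ℤ.- ⁺ N r ℤ.* ⁺ M) ℤ.+ (⁺ p ℤ.* ⁺ N r ℤ.- ⁺ J) ℤ.* ⁺ M ‖ ≤⟨ ℤₚ.∣i+j∣≤∣i∣+∣j∣ (⁺ p ℤ.* (s r ℤ.- ⁺ N r ℤ.* ⁺ M)) _ ⟩
    ‖ ⁺ p ℤ.* (s r ℤ.- ⁺ N r ℤ.* ⁺ M) ‖ + ‖ (⁺ p ℤ.* ⁺ N r ℤ.- ⁺ J) ℤ.* ⁺ M ‖ ≡⟨ cong₂ _+_ (ℤₚ.abs-* (⁺ p) (s r ℤ.- ⁺ N r ℤ.* ⁺ M)) (ℤₚ.abs-* (⁺ p ℤ.* ⁺ N r ℤ.- ⁺ J) (⁺ M)) ⟩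
    p * ‖ s r ℤ.- ⁺ N r ℤ.* ⁺ M ‖ + ‖ ⁺ p ℤ.* ⁺ N r ℤ.- ⁺ J ‖ * M ≤⟨ +-mono-≤ (*-monoʳ-≤ p (avg (c + h * r) (N r))) (*-monoˡ-≤ M (defect r)) ⟩
    p * E + p * M ≡⟨ *-distribˡ-+ p E M ⟨
    p * (E + M) ∎
    where
    lem : ∀ p s n j m → p ℤ.* s ℤ.- j ℤ.* m ≡ p ℤ.* (s ℤ.- n ℤ.* m) ℤ.+ (p ℤ.* n ℤ.- j) ℤ.* m
    lem = ℤ-Ring.solve-∀

-- The sum of ∏_{p∣d} β(p) · ∏_{p∤d} α(p) over the d ≤ z that are products of distinct primes p ≤ w with g(p).
sieveSum : (ℕ → Bool) → (α β : ℕ → ℕ) → ℕ → ℕ → ℕ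
sieveSum g α β zero zero = 0
sieveSum g α β zero (suc z) = 1
sieveSum g α β (suc w) z =
  if g (suc w) then α (suc w) * sieveSum g α β w z + β (suc w) * sieveSum g α β w (z / suc w) else sieveSum g α β w z

sieveSum-mono : ∀ g α β w {z z′} → z ≤ z′ → sieveSum g α β w z ≤ sieveSum g α β w z′
sieveSum-mono g α β zero {zero} z≤ = z≤n
sieveSum-mono g α β zero {suc z} {suc z′} z≤ = ≤-refl
sieveSum-mono g α β (suc w) z≤ with g (suc w)
... | true = +-mono-≤ (*-monoʳ-≤ (α (suc w)) (sieveSum-mono g α β w z≤)) (*-monoʳ-≤ (β (suc w)) (sieveSum-mono g α β w (/-monoˡ-≤ (suc w) z≤)))
... | false = sieveSum-mono g α β w z≤

sieveSum-zero : ∀ g α β w → sieveSum g α β w 0 ≡ 0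
sieveSum-zero g α β zero = refl
sieveSum-zero g α β (suc w) with g (suc w)
... | true rewrite sieveSum-zero g α β w | *-zeroʳ (α (suc w)) | *-zeroʳ (β (suc w)) = refl
... | false = sieveSum-zero g α β w

-- The right side contains the left side as its term d = 1.
primeProd≤sieveSum : ∀ g α β w z → 1 ≤ z → primeProd g α w ≤ sieveSum g α β w z
primeProd≤sieveSum g α β zero (suc z) _ = ≤-refl
primeProd≤sieveSum g α β (suc w) z 1≤z with g (suc w)
... | true = ≤-trans (*-monoʳ-≤ (α (suc w)) (primeProd≤sieveSum g α β w z 1≤z)) (m≤m+n _ _)
... | false = primeProd≤sieveSum g α β w z 1≤z

⊓-/ : ∀ m n p .{{_ : NonZero p}} → (m / p) ⊓ (n / p) ≡ (m ⊓ n) / p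
⊓-/ m n p with ≤-total m n
... | inj₁ m≤n rewrite m≤n⇒m⊓n≡m m≤n = m≤n⇒m⊓n≡m (/-monoˡ-≤ p m≤n)
... | inj₂ n≤m rewrite m≥n⇒m⊓n≡n n≤m = m≥n⇒m⊓n≡n (/-monoˡ-≤ p n≤m)

∑-const : ∀ n x → ∑ n (λ _ → x) ≡ ⁺ n ℤ.* x
∑-const zero x = sym (ℤₚ.*-zeroˡ x)
∑-const (suc n) x = trans (cong (ℤ._+ x) (∑-const n x)) (trans (lem (⁺ n) x) (cong (ℤ._* x) (sym (ℤₚ.pos-+ 1 n))))
  where
  lem : ∀ n x → n ℤ.* x ℤ.+ x ≡ (⁺ 1 ℤ.+ n) ℤ.* x
  lem = ℤ-Ring.solve-∀

-- The shape of the expanded product in the orthogonality relation: each of the two cross terms and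
-- the last term occurs once plain and once weighted by b, and the cross terms share their
-- coefficients.
combination : (c₁ c₂ c₃ c₄ c₅ x₁ x₂ x₃ x₄ x₅ x₆ x₇ : ℤ) → ℤ
combination c₁ c₂ c₃ c₄ c₅ x₁ x₂ x₃ x₄ x₅ x₆ x₇ =
  c₁ ℤ.* x₁ ℤ.+ c₂ ℤ.* x₂ ℤ.+ c₃ ℤ.* x₃ ℤ.+ c₂ ℤ.* x₄ ℤ.+ c₃ ℤ.* x₅ ℤ.+ c₄ ℤ.* x₆ ℤ.+ c₅ ℤ.* x₇

∑-combination : ∀ c₁ c₂ c₃ c₄ c₅ (f₁ f₂ f₃ f₄ f₅ f₆ f₇ : ℕ → ℤ) n →
  ∑ n (λ i → combination c₁ c₂ c₃ c₄ c₅ (f₁ i) (f₂ i) (f₃ i) (f₄ i) (f₅ i) (f₆ i) (f₇ i)) ≡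
  combination c₁ c₂ c₃ c₄ c₅ (∑ n f₁) (∑ n f₂) (∑ n f₃) (∑ n f₄) (∑ n f₅) (∑ n f₆) (∑ n f₇)
∑-combination c₁ c₂ c₃ c₄ c₅ f₁ f₂ f₃ f₄ f₅ f₆ f₇ zero = lem c₁ c₂ c₃ c₄ c₅
  where
  lem : ∀ c₁ c₂ c₃ c₄ c₅ → ⁺ 0 ≡ c₁ ℤ.* ⁺ 0 ℤ.+ c₂ ℤ.* ⁺ 0 ℤ.+ c₃ ℤ.* ⁺ 0 ℤ.+ c₂ ℤ.* ⁺ 0 ℤ.+ c₃ ℤ.* ⁺ 0 ℤ.+ c₄ ℤ.* ⁺ 0 ℤ.+ c₅ ℤ.* ⁺ 0
  lem = ℤ-Ring.solve-∀
∑-combination c₁ c₂ c₃ c₄ c₅ f₁ f₂ f₃ f₄ f₅ f₆ f₇ (suc n) =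
  trans (cong (ℤ._+ combination c₁ c₂ c₃ c₄ c₅ (f₁ n) (f₂ n) (f₃ n) (f₄ n) (f₅ n) (f₆ n) (f₇ n)) (∑-combination c₁ c₂ c₃ c₄ c₅ f₁ f₂ f₃ f₄ f₅ f₆ f₇ n))
    (lem c₁ c₂ c₃ c₄ c₅ (∑ n f₁) (∑ n f₂) (∑ n f₃) (∑ n f₄) (∑ n f₅) (∑ n f₆) (∑ n f₇) (f₁ n) (f₂ n) (f₃ n) (f₄ n) (f₅ n) (f₆ n) (f₇ n))
  where
  lem : ∀ c₁ c₂ c₃ c₄ c₅ x₁ x₂ x₃ x₄ x₅ x₆ x₇ y₁ y₂ y₃ y₄ y₅ y₆ y₇ →
    c₁ ℤ.* x₁ ℤ.+ c₂ ℤ.* x₂ ℤ.+ c₃ ℤ.* x₃ ℤ.+ c₂ ℤ.* x₄ ℤ.+ c₃ ℤ.* x₅ ℤ.+ c₄ ℤ.* x₆ ℤ.+ c₅ ℤ.* x₇ ℤ.+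
    (c₁ ℤ.* y₁ ℤ.+ c₂ ℤ.* y₂ ℤ.+ c₃ ℤ.* y₃ ℤ.+ c₂ ℤ.* y₄ ℤ.+ c₃ ℤ.* y₅ ℤ.+ c₄ ℤ.* y₆ ℤ.+ c₅ ℤ.* y₇) ≡
    c₁ ℤ.* (x₁ ℤ.+ y₁) ℤ.+ c₂ ℤ.* (x₂ ℤ.+ y₂) ℤ.+ c₃ ℤ.* (x₃ ℤ.+ y₃) ℤ.+ c₂ ℤ.* (x₄ ℤ.+ y₄) ℤ.+ c₃ ℤ.* (x₅ ℤ.+ y₅) ℤ.+ c₄ ℤ.* (x₆ ℤ.+ y₆) ℤ.+ c₅ ℤ.* (x₇ ℤ.+ y₇)
  lem = ℤ-Ring.solve-∀

∣linear∣-≤ : ∀ u₁ u₂ u₃ u₄ u₅ u₆ u₇ x₁ x₂ x₃ x₄ x₅ x₆ x₇ {e₁ e₂ e₃ e₄ e₅ e₆ e₇} →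
  ‖ x₁ ‖ ≤ e₁ → ‖ x₂ ‖ ≤ e₂ → ‖ x₃ ‖ ≤ e₃ → ‖ x₄ ‖ ≤ e₄ → ‖ x₅ ‖ ≤ e₅ → ‖ x₆ ‖ ≤ e₆ → ‖ x₇ ‖ ≤ e₇ →
  ‖ u₁ ℤ.* x₁ ℤ.+ u₂ ℤ.* x₂ ℤ.+ u₃ ℤ.* x₃ ℤ.+ u₄ ℤ.* x₄ ℤ.+ u₅ ℤ.* x₅ ℤ.+ u₆ ℤ.* x₆ ℤ.+ u₇ ℤ.* x₇ ‖ ≤
  ‖ u₁ ‖ * e₁ + ‖ u₂ ‖ * e₂ + ‖ u₃ ‖ * e₃ + ‖ u₄ ‖ * e₄ + ‖ u₅ ‖ * e₅ + ‖ u₆ ‖ * e₆ + ‖ u₇ ‖ * e₇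
∣linear∣-≤ u₁ u₂ u₃ u₄ u₅ u₆ u₇ x₁ x₂ x₃ x₄ x₅ x₆ x₇ h₁ h₂ h₃ h₄ h₅ h₆ h₇ =
  add y₆ (u₇ ℤ.* x₇) (add y₅ (u₆ ℤ.* x₆) (add y₄ (u₅ ℤ.* x₅) (add y₃ (u₄ ℤ.* x₄) (add y₂ (u₃ ℤ.* x₃) (add y₁ (u₂ ℤ.* x₂)
    (scale u₁ x₁ h₁) (scale u₂ x₂ h₂)) (scale u₃ x₃ h₃)) (scale u₄ x₄ h₄)) (scale u₅ x₅ h₅)) (scale u₆ x₆ h₆)) (scale u₇ x₇ h₇)
  where
  y₁ y₂ y₃ y₄ y₅ y₆ : ℤ
  y₁ = u₁ ℤ.* x₁
  y₂ = y₁ ℤ.+ u₂ ℤ.* x₂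
  y₃ = y₂ ℤ.+ u₃ ℤ.* x₃
  y₄ = y₃ ℤ.+ u₄ ℤ.* x₄
  y₅ = y₄ ℤ.+ u₅ ℤ.* x₅
  y₆ = y₅ ℤ.+ u₆ ℤ.* x₆
  add : ∀ x y {a c} → ‖ x ‖ ≤ a → ‖ y ‖ ≤ c → ‖ x ℤ.+ y ‖ ≤ a + c
  add x y h k = ≤-trans (ℤₚ.∣i+j∣≤∣i∣+∣j∣ x y) (+-mono-≤ h k)
  scale : ∀ c x {a} → ‖ x ‖ ≤ a → ‖ c ℤ.* x ‖ ≤ ‖ c ‖ * a
  scale c x h = ≤-trans (≤-reflexive (ℤₚ.abs-* c x)) (*-monoʳ-≤ ‖ c ‖ h)

-- The arithmetic of orthogonality-step for p = 4 + t, after expanding (q x + ψ y)(q x′ + ψ y′)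
-- with q = p − 2, ψ = 2 − p b and b² = b.
combination-bound : ∀ t → 1 ≤ t → ∀ A B C₁ D E F G j m₀ m₁ m₂ m₃ e₀ e₁ e₂ e₃ →
  ‖ A ℤ.- j ℤ.* m₀ ‖ ≤ e₀ →
  ‖ B ℤ.- j ℤ.* m₁ ‖ ≤ e₁ → ‖ ⁺ (4 + t) ℤ.* C₁ ℤ.- ⁺ 2 ℤ.* (j ℤ.* m₁) ‖ ≤ 2 * ((4 + t) * (e₁ + e₁)) →
  ‖ D ℤ.- j ℤ.* m₂ ‖ ≤ e₂ → ‖ ⁺ (4 + t) ℤ.* E ℤ.- ⁺ 2 ℤ.* (j ℤ.* m₂) ‖ ≤ 2 * ((4 + t) * (e₂ + e₂)) →
  ‖ F ℤ.- j ℤ.* m₃ ‖ ≤ e₃ → ‖ ⁺ (4 + t) ℤ.* G ℤ.- ⁺ 2 ℤ.* (j ℤ.* m₃) ‖ ≤ 2 * ((4 + t) * (e₃ + e₃)) →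
  ‖ combination (⁺ (2 + t) ℤ.* ⁺ (2 + t)) (⁺ 2 ℤ.* ⁺ (2 + t)) (ℤ.- (⁺ (2 + t) ℤ.* ⁺ (4 + t))) (⁺ 4) (⁺ t ℤ.* ⁺ (4 + t)) A B C₁ D E F G
    ℤ.- j ℤ.* (⁺ (2 + t) ℤ.* (⁺ (2 + t) ℤ.* m₀ ℤ.+ ⁺ 2 ℤ.* m₃)) ‖ ≤ (2 + t) * (2 + t) * (e₀ + 8 * e₁ + 8 * e₂ + 64 * e₃)
combination-bound t 1≤t A B C₁ D E F G j m₀ m₁ m₂ m₃ e₀ e₁ e₂ e₃ hA hB hC hD hE hF hG = begin
  _ ≡⟨ cong ‖_‖ (lem (⁺ t) A B C₁ D E F G j m₀ m₁ m₂ m₃) ⟩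
  ‖ q ℤ.* q ℤ.* (A ℤ.- j ℤ.* m₀) ℤ.+ ⁺ 2 ℤ.* q ℤ.* (B ℤ.- j ℤ.* m₁) ℤ.+ ℤ.- q ℤ.* (p ℤ.* C₁ ℤ.- ⁺ 2 ℤ.* (j ℤ.* m₁))
    ℤ.+ ⁺ 2 ℤ.* q ℤ.* (D ℤ.- j ℤ.* m₂) ℤ.+ ℤ.- q ℤ.* (p ℤ.* E ℤ.- ⁺ 2 ℤ.* (j ℤ.* m₂))
    ℤ.+ ⁺ 4 ℤ.* (F ℤ.- j ℤ.* m₃) ℤ.+ ⁺ t ℤ.* (p ℤ.* G ℤ.- ⁺ 2 ℤ.* (j ℤ.* m₃)) ‖
    ≤⟨ ∣linear∣-≤ (q ℤ.* q) (⁺ 2 ℤ.* q) (ℤ.- q) (⁺ 2 ℤ.* q) (ℤ.- q) (⁺ 4) (⁺ t) (A ℤ.- j ℤ.* m₀) (B ℤ.- j ℤ.* m₁) (p ℤ.* C₁ ℤ.- ⁺ 2 ℤ.* (j ℤ.* m₁))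
         (D ℤ.- j ℤ.* m₂) (p ℤ.* E ℤ.- ⁺ 2 ℤ.* (j ℤ.* m₂)) (F ℤ.- j ℤ.* m₃) (p ℤ.* G ℤ.- ⁺ 2 ℤ.* (j ℤ.* m₃)) hA hB hC hD hE hF hG ⟩
  ‖ q ℤ.* q ‖ * e₀ + ‖ ⁺ 2 ℤ.* q ‖ * e₁ + ‖ ℤ.- q ‖ * (2 * ((4 + t) * (e₁ + e₁))) + ‖ ⁺ 2 ℤ.* q ‖ * e₂
    + ‖ ℤ.- q ‖ * (2 * ((4 + t) * (e₂ + e₂))) + 4 * e₃ + t * (2 * ((4 + t) * (e₃ + e₃))) ≡⟨ cong₂ (λ x y → x * e₀ + y * e₁ + (2 + t) * (2 * ((4 + t) * (e₁ + e₁))) + y * e₂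
    + (2 + t) * (2 * ((4 + t) * (e₂ + e₂))) + 4 * e₃ + t * (2 * ((4 + t) * (e₃ + e₃)))) (ℤₚ.abs-* q q) (ℤₚ.abs-* (⁺ 2) q) ⟩
  (2 + t) * (2 + t) * e₀ + 2 * (2 + t) * e₁ + (2 + t) * (2 * ((4 + t) * (e₁ + e₁))) + 2 * (2 + t) * e₂
    + (2 + t) * (2 * ((4 + t) * (e₂ + e₂))) + 4 * e₃ + t * (2 * ((4 + t) * (e₃ + e₃))) ≤⟨ arith t 1≤t ⟩
  (2 + t) * (2 + t) * (e₀ + 8 * e₁ + 8 * e₂ + 64 * e₃) ∎
  where
  open ≤-Reasoning
  p q : ℤ
  p = ⁺ (4 + t)
  q = ⁺ (2 + t)
  lem : ∀ t A B C₁ D E F G j m₀ m₁ m₂ m₃ →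
    (⁺ 2 ℤ.+ t) ℤ.* (⁺ 2 ℤ.+ t) ℤ.* A ℤ.+ ⁺ 2 ℤ.* (⁺ 2 ℤ.+ t) ℤ.* B ℤ.+ ℤ.- ((⁺ 2 ℤ.+ t) ℤ.* (⁺ 4 ℤ.+ t)) ℤ.* C₁
      ℤ.+ ⁺ 2 ℤ.* (⁺ 2 ℤ.+ t) ℤ.* D ℤ.+ ℤ.- ((⁺ 2 ℤ.+ t) ℤ.* (⁺ 4 ℤ.+ t)) ℤ.* E ℤ.+ ⁺ 4 ℤ.* F ℤ.+ t ℤ.* (⁺ 4 ℤ.+ t) ℤ.* G
      ℤ.- j ℤ.* ((⁺ 2 ℤ.+ t) ℤ.* ((⁺ 2 ℤ.+ t) ℤ.* m₀ ℤ.+ ⁺ 2 ℤ.* m₃)) ≡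
    (⁺ 2 ℤ.+ t) ℤ.* (⁺ 2 ℤ.+ t) ℤ.* (A ℤ.- j ℤ.* m₀) ℤ.+ ⁺ 2 ℤ.* (⁺ 2 ℤ.+ t) ℤ.* (B ℤ.- j ℤ.* m₁) ℤ.+ ℤ.- (⁺ 2 ℤ.+ t) ℤ.* ((⁺ 4 ℤ.+ t) ℤ.* C₁ ℤ.- ⁺ 2 ℤ.* (j ℤ.* m₁))
      ℤ.+ ⁺ 2 ℤ.* (⁺ 2 ℤ.+ t) ℤ.* (D ℤ.- j ℤ.* m₂) ℤ.+ ℤ.- (⁺ 2 ℤ.+ t) ℤ.* ((⁺ 4 ℤ.+ t) ℤ.* E ℤ.- ⁺ 2 ℤ.* (j ℤ.* m₂))
      ℤ.+ ⁺ 4 ℤ.* (F ℤ.- j ℤ.* m₃) ℤ.+ t ℤ.* ((⁺ 4 ℤ.+ t) ℤ.* G ℤ.- ⁺ 2 ℤ.* (j ℤ.* m₃))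
  lem = ℤ-Ring.solve-∀
  arith : ∀ t → 1 ≤ t → (2 + t) * (2 + t) * e₀ + 2 * (2 + t) * e₁ + (2 + t) * (2 * ((4 + t) * (e₁ + e₁))) + 2 * (2 + t) * e₂
    + (2 + t) * (2 * ((4 + t) * (e₂ + e₂))) + 4 * e₃ + t * (2 * ((4 + t) * (e₃ + e₃))) ≤ (2 + t) * (2 + t) * (e₀ + 8 * e₁ + 8 * e₂ + 64 * e₃)
  -- The cross terms need (2 + 4 p) / (p - 2), which decreases in p and is 22 / 3 at p = 5. This is
  -- the origin of the weight 8 in `R`; 64 = 8² lets the error factor into a product of two values
  -- of `R`.
  arith (suc s) _ = ≤-trans (m≤m+n _ _) (≤-reflexive (lem′ s e₀ e₁ e₂ e₃))
    where
    lem′ : ∀ s e₀ e₁ e₂ e₃ → (3 + s) * (3 + s) * e₀ + 2 * (3 + s) * e₁ + (3 + s) * (2 * ((5 + s) * (e₁ + e₁))) + 2 * (3 + s) * e₂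
      + (3 + s) * (2 * ((5 + s) * (e₂ + e₂))) + 4 * e₃ + (1 + s) * (2 * ((5 + s) * (e₃ + e₃)))
      + ((3 + s) * (2 + 4 * s) * (e₁ + e₂) + (552 + 360 * s + 60 * (s * s)) * e₃) ≡ (3 + s) * (3 + s) * (e₀ + 8 * e₁ + 8 * e₂ + 64 * e₃)
    lem′ = solve-∀

module SieveWeights (g : ℕ → Bool) (g≥5 : ∀ p → T (g p) → 5 ≤ p) where

  -- For d running over the products of sieving primes with d ≤ z, `Λ / W` is Selberg's sum of ∏ 2 /
  -- (p - 2), with two classes removed per prime; `K / W₁` is the sum of 1 / φ(d); `R` is the sum of
  -- 8 ^ ω(d), with ω(d) the number of primes dividing d, and governs the remainder.
  Λ R K : ℕ → ℕ → ℕ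
  Λ = sieveSum g (_∸ 2) (λ _ → 2)
  R = sieveSum g (λ _ → 1) (λ _ → 8)
  K = sieveSum g (_∸ 1) (λ _ → 1)

  W W₁ : ℕ → ℕ
  W = primeProd g (_∸ 2)
  W₁ = primeProd g (_∸ 1)

  1≤W : ∀ w → 1 ≤ W w
  1≤W w = ≤-trans (≤-reflexive (sym (^-zeroˡ (count g w))))
    (primeProd-≥ g (_∸ 2) 1 w (λ p _ _ gp → ∸-monoˡ-≤ 2 (≤-trans (m≤m+n 3 2) (g≥5 p gp))))

  1≤W₁ : ∀ w → 1 ≤ W₁ w
  1≤W₁ w = ≤-trans (≤-reflexive (sym (^-zeroˡ (count g w))))
    (primeProd-≥ g (_∸ 1) 1 w (λ p _ _ gp → ∸-monoˡ-≤ 1 (≤-trans (m≤m+n 2 3) (g≥5 p gp))))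

  Λ≤WR : ∀ w z → Λ w z ≤ W w * R w z
  Λ≤WR zero zero = z≤n
  Λ≤WR zero (suc z) = ≤-refl
  Λ≤WR (suc w) z with g (suc w) in eq
  ... | false = Λ≤WR w z
  ... | true = begin
    q * Λ w z + 2 * Λ w z′ ≤⟨ +-mono-≤ (*-monoʳ-≤ q (Λ≤WR w z)) (*-mono-≤ 2≤8q (Λ≤WR w z′)) ⟩
    q * (W w * R w z) + 8 * q * (W w * R w z′) ≡⟨ lem q (W w) (R w z) (R w z′) ⟩
    q * W w * (1 * R w z + 8 * R w z′) ∎
    where
    open ≤-Reasoning
    q z′ : ℕ
    q = suc w ∸ 2
    z′ = z / suc w
    2≤8q : 2 ≤ 8 * q
    2≤8q = ≤-trans (m≤m+n 2 6) (*-monoʳ-≤ 8 (∸-monoˡ-≤ 2 (≤-trans (m≤m+n 3 2) (g≥5 (suc w) (subst T (sym eq) _)))))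
    lem : ∀ q W x y → q * (W * x) + 8 * q * (W * y) ≡ q * W * (1 * x + 8 * y)
    lem = solve-∀

  1≤R : ∀ w z → 1 ≤ z → 1 ≤ R w z
  1≤R w z 1≤z = ≤-trans (≤-trans (≤-reflexive (sym (^-zeroˡ (count g w)))) (primeProd-≥ g (λ _ → 1) 1 w (λ _ _ _ _ → ≤-refl)))
    (primeProd≤sieveSum g (λ _ → 1) (λ _ → 8) w z 1≤z)

  R⊓≤ : ∀ w z z′ → R w (z ⊓ z′) ≤ R w z * R w z′
  R⊓≤ w zero z′ = ≤-trans (≤-reflexive (sieveSum-zero g (λ _ → 1) (λ _ → 8) w)) z≤n
  R⊓≤ w (suc z) zero = ≤-trans (≤-reflexive (sieveSum-zero g (λ _ → 1) (λ _ → 8) w)) z≤n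
  R⊓≤ w (suc z) (suc z′) = ≤-trans (sieveSum-mono g (λ _ → 1) (λ _ → 8) w (m⊓n≤m (suc z) (suc z′)))
    (m≤m*n _ _ {{>-nonZero (1≤R w (suc z′) (s≤s z≤n))}})

  -- In the form R ≤ (2 - 1 / (w + 1)) z ^ 4 the induction telescopes: a prime p ≥ 5 adds at most 8
  -- · 2 (z / p) ^ 4, which is at most z ^ 4 (1 / p - 1 / (p + 1)) because 16 (p + 1) ≤ p ^ 3.
  R-bound : ∀ w z →
    R w z * suc w + z ^ 4 ≤ 2 * (suc w * z ^ 4)

  R≤2z⁴ : ∀ w z → R w z ≤ 2 * z ^ 4
  R≤2z⁴ w z = *-cancelˡ-≤ (suc w) (begin
    suc w * r ≡⟨ *-comm (suc w) r ⟩
    r * suc w ≤⟨ m≤m+n _ (z ^ 4) ⟩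
    r * suc w + z ^ 4 ≤⟨ R-bound w z ⟩
    2 * (suc w * z ^ 4) ≡⟨ lem w (z ^ 4) ⟩
    suc w * (2 * z ^ 4) ∎)
    where
    open ≤-Reasoning
    r : ℕ
    r = R w z
    lem : ∀ w Z → 2 * (suc w * Z) ≡ suc w * (2 * Z)
    lem = solve-∀

  R-bound zero zero = z≤n
  R-bound zero (suc z) = ≤-trans (+-monoˡ-≤ (suc z ^ 4) (m^n>0 (suc z) 4)) (≤-reflexive (lem (suc z ^ 4)))
    where
    lem : ∀ x → x + x ≡ 2 * (1 * x)
    lem = solve-∀
  R-bound (suc w) z with g (suc w) in eq
  ... | false = begin
      r * (2 + w) + Z ≡⟨ lem₁ r w Z ⟩
      (r * (1 + w) + Z) + r ≤⟨ +-mono-≤ (R-bound w z) (R≤2z⁴ w z) ⟩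
      2 * ((1 + w) * Z) + 2 * Z ≡⟨ lem₂ w Z ⟩
      2 * ((2 + w) * Z) ∎
    where
    open ≤-Reasoning
    r Z : ℕ
    r = R w z
    Z = z ^ 4
    lem₁ : ∀ r w Z → r * (2 + w) + Z ≡ (r * (1 + w) + Z) + r
    lem₁ = solve-∀
    lem₂ : ∀ w Z → 2 * ((1 + w) * Z) + 2 * Z ≡ 2 * ((2 + w) * Z)
    lem₂ = solve-∀
  ... | true = *-cancelʳ-≤ _ _ (p ^ 4) {{m^n≢0 p 4}} (+-cancelʳ-≤ (p ^ 3 * suc p * Z) _ _ (begin
      ((1 * r + 8 * r′) * suc p + Z) * p ^ 4 + p ^ 3 * suc p * Z ≡⟨ lem₁ p r r′ Z ⟩
      (r * p + Z) * (p ^ 3 * suc p) + 8 * (p ^ 4 * suc p) * r′ + Z * p ^ 4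
        ≤⟨ +-monoˡ-≤ (Z * p ^ 4) (+-mono-≤ (*-monoˡ-≤ (p ^ 3 * suc p) (R-bound w z)) (*-monoʳ-≤ (8 * (p ^ 4 * suc p)) (R≤2z⁴ w (z / p)))) ⟩
      2 * (p * Z) * (p ^ 3 * suc p) + 8 * (p ^ 4 * suc p) * (2 * (z / p) ^ 4) + Z * p ^ 4 ≡⟨ lem₂ p Z ((z / p) ^ 4) ⟩
      2 * (p * Z) * (p ^ 3 * suc p) + 16 * suc p * ((z / p) ^ 4 * p ^ 4) + Z * p ^ 4 ≤⟨ +-monoˡ-≤ (Z * p ^ 4) (+-monoʳ-≤ (2 * (p * Z) * (p ^ 3 * suc p)) (*-mono-≤ (cube p (g≥5 p (subst T (sym eq) _))) power)) ⟩
      2 * (p * Z) * (p ^ 3 * suc p) + p ^ 3 * Z + Z * p ^ 4 ≡⟨ lem₃ p Z ⟩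
      2 * (suc p * Z) * p ^ 4 + p ^ 3 * suc p * Z ∎))
    where
    open ≤-Reasoning
    p r r′ Z : ℕ
    p = suc w
    r = R w z
    r′ = R w (z / p)
    Z = z ^ 4
    lem₁ : ∀ p r r′ Z → ((1 * r + 8 * r′) * suc p + Z) * (p * (p * (p * (p * 1)))) + (p * (p * (p * 1))) * suc p * Z ≡
           (r * p + Z) * ((p * (p * (p * 1))) * suc p) + 8 * ((p * (p * (p * (p * 1)))) * suc p) * r′ + Z * (p * (p * (p * (p * 1))))
    lem₁ = solve-∀
    lem₂ : ∀ p Z Y → 2 * (p * Z) * ((p * (p * (p * 1))) * suc p) + 8 * ((p * (p * (p * (p * 1)))) * suc p) * (2 * Y) + Z * (p * (p * (p * (p * 1)))) ≡
           2 * (p * Z) * ((p * (p * (p * 1))) * suc p) + 16 * suc p * (Y * (p * (p * (p * (p * 1))))) + Z * (p * (p * (p * (p * 1))))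
    lem₂ = solve-∀
    lem₃ : ∀ p Z → 2 * (p * Z) * ((p * (p * (p * 1))) * suc p) + (p * (p * (p * 1))) * Z + Z * (p * (p * (p * (p * 1)))) ≡
           2 * (suc p * Z) * (p * (p * (p * (p * 1)))) + (p * (p * (p * 1))) * suc p * Z
    lem₃ = solve-∀
    power : (z / p) ^ 4 * p ^ 4 ≤ Z
    power = ≤-trans (≤-reflexive (lem (z / p) p)) (^-monoˡ-≤ 4 (m/n*n≤m z p))
      where
      lem : ∀ a b → (a * (a * (a * (a * 1)))) * (b * (b * (b * (b * 1)))) ≡ (a * b) * ((a * b) * ((a * b) * ((a * b) * 1)))
      lem = solve-∀
    cube : ∀ p → 5 ≤ p → 16 * suc p ≤ p ^ 3
    cube p 5≤p = subst (λ p → 16 * suc p ≤ p ^ 3) (m+[n∸m]≡n 5≤p)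
        (≤-trans (m≤m+n _ (29 + 59 * s + 15 * (s * s) + s * s * s)) (≤-reflexive (lem s)))
      where
      s : ℕ
      s = p ∸ 5
      lem : ∀ s → 16 * (6 + s) + (29 + 59 * s + 15 * (s * s) + s * s * s) ≡ (5 + s) * ((5 + s) * ((5 + s) * 1))
      lem = solve-∀

  -- Multiplying the two sums `K` and sending (d₁, d₂) to its least common multiple, at most z₁ z₂,
  -- a prime of the latter collects 2 / (p - 1) + 1 / (p - 1)². This is at most 2 / (p - 2), with
  -- slack p once denominators are cleared.
  Λ-lower : ∀ w z₁ z₂ →
    W w * (K w z₁ * K w z₂) ≤
    Λ w (z₁ * z₂) * (W₁ w * W₁ w)
  Λ-lower zero zero z₂ = z≤n
  Λ-lower zero (suc z₁) zero = z≤n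
  Λ-lower zero (suc z₁) (suc z₂) = ≤-refl
  Λ-lower (suc w) z₁ z₂ with g (suc w) | g≥5 (suc w)
  ... | false | _ = Λ-lower w z₁ z₂
  ... | true | ≥5 with w | Λ-lower w | ≥5 _
  ...   | suc v | ih | s≤s 4≤ = begin
      v * D * ((suc v * a + 1 * a′) * (suc v * c + 1 * c′)) ≡⟨ lem₁ v D a a′ c c′ ⟩
      v * (suc v * suc v) * (D * (a * c)) + v * suc v * (D * (a * c′)) + v * suc v * (D * (a′ * c)) + v * (D * (a′ * c′))
        ≤⟨ +-mono-≤ (+-mono-≤ (+-mono-≤ (*-monoʳ-≤ (v * (suc v * suc v)) (ih z₁ z₂)) (*-monoʳ-≤ (v * suc v) (≤-trans (ih z₁ (z₂ / p)) (*-monoˡ-≤ U (mono y₁))))) (*-monoʳ-≤ (v * suc v) (≤-trans (ih (z₁ / p) z₂) (*-monoˡ-≤ U (mono y₂)))))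
             (*-monoʳ-≤ v (≤-trans (ih (z₁ / p) (z₂ / p)) (*-monoˡ-≤ U (mono y₃)))) ⟩
      v * (suc v * suc v) * (Λ₀ * U) + v * suc v * (Λ₁ * U) + v * suc v * (Λ₁ * U) + v * (Λ₁ * U) ≤⟨ m≤m+n _ ((2 + v) * (Λ₁ * U)) ⟩
      v * (suc v * suc v) * (Λ₀ * U) + v * suc v * (Λ₁ * U) + v * suc v * (Λ₁ * U) + v * (Λ₁ * U) + (2 + v) * (Λ₁ * U) ≡⟨ lem₂ v Λ₀ Λ₁ E ⟩
      (v * Λ₀ + 2 * Λ₁) * (suc v * E * (suc v * E)) ∎
    where
    open ≤-Reasoning
    p : ℕ
    p = suc (suc v)
    D E U a a′ c c′ Λ₀ Λ₁ : ℕ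
    D = W (suc v)
    E = W₁ (suc v)
    U = E * E
    a = K (suc v) z₁
    a′ = K (suc v) (z₁ / p)
    c = K (suc v) z₂
    c′ = K (suc v) (z₂ / p)
    Λ₀ = Λ (suc v) (z₁ * z₂)
    Λ₁ = Λ (suc v) (z₁ * z₂ / p)
    mono : ∀ {x y} → x ≤ y → Λ (suc v) x ≤ Λ (suc v) y
    mono = sieveSum-mono g (_∸ 2) (λ _ → 2) (suc v)
    *-/≤ : ∀ m n → m * (n / p) ≤ m * n / p
    *-/≤ m n = ≤-trans (≤-reflexive (sym (m*n/n≡m (m * (n / p)) p))) (/-monoˡ-≤ p (≤-trans (≤-reflexive (*-assoc m (n / p) p)) (*-monoʳ-≤ m (m/n*n≤m n p))))
    y₁ : z₁ * (z₂ / p) ≤ z₁ * z₂ / p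
    y₁ = *-/≤ z₁ z₂
    y₂ : z₁ / p * z₂ ≤ z₁ * z₂ / p
    y₂ = ≤-trans (≤-reflexive (*-comm (z₁ / p) z₂)) (≤-trans (*-/≤ z₂ z₁) (≤-reflexive (cong (_/ p) (*-comm z₂ z₁))))
    y₃ : z₁ / p * (z₂ / p) ≤ z₁ * z₂ / p
    y₃ = ≤-trans (*-monoˡ-≤ (z₂ / p) (m/n≤m z₁ p)) y₁
    lem₁ : ∀ v D a a′ c c′ → v * D * ((suc v * a + 1 * a′) * (suc v * c + 1 * c′)) ≡
      v * (suc v * suc v) * (D * (a * c)) + v * suc v * (D * (a * c′)) + v * suc v * (D * (a′ * c)) + v * (D * (a′ * c′))
    lem₁ = solve-∀
    lem₂ : ∀ v Λ₀ Λ₁ E → v * (suc v * suc v) * (Λ₀ * (E * E)) + v * suc v * (Λ₁ * (E * E)) + v * suc v * (Λ₁ * (E * E)) + v * (Λ₁ * (E * E)) + (2 + v) * (Λ₁ * (E * E))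
      ≡ (v * Λ₀ + 2 * Λ₁) * (suc v * E * (suc v * E))
    lem₂ = solve-∀

-- A sieve of dimension 2 in the abstract: for each sieving prime p, `b p` is the indicator of the
-- two residue classes to be removed.
module Sieve (g : ℕ → Bool) (b : ℕ → ℕ → ℕ)
  (g-prime : ∀ p → T (g p) → Prime p) (g≥5 : ∀ p → T (g p) → 5 ≤ p)
  (b-idem : ∀ p k → T (g p) → b p k * b p k ≡ b p k)
  (b-periodic : ∀ p → T (g p) → ∀ k i → b p (k + p * i) ≡ b p k)
  (b-two : ∀ p → T (g p) → ∀ h → p ∤ h → ∀ c → ∑ p (λ r → ⁺ b p (c + h * r)) ≡ ⁺ 2) where

  open SieveWeights g g≥5

  -- Each ψ_p = 2 − p b_p has mean zero modulo p, so the products of the ψ_p over distinct d are nearly orthogonal on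
  -- any interval. Ψ is the combination of these products that equals the constant Λ on the sifted set; comparing the
  -- mean square of Ψ with Λ² bounds the size of that set.
  Ψ : ℕ → ℕ → ℕ → ℤ
  Ψ zero z k = ⁺ Λ zero z
  Ψ (suc w) z k = if g (suc w)
    then ⁺ (suc w ∸ 2) ℤ.* Ψ w z k ℤ.+ (⁺ 2 ℤ.- ⁺ suc w ℤ.* ⁺ b (suc w) k) ℤ.* Ψ w (z / suc w) k
    else Ψ w z k

  error : ℕ → ℕ → ℕ → ℕ
  error w z z′ = W w * W w * (R w z * R w z′)

  WΛ≤error : ∀ w z z′ → W w * Λ w (z ⊓ z′) ≤ error w z z′
  WΛ≤error w z z′ = ≤-trans (*-monoʳ-≤ (W w) (≤-trans (Λ≤WR w (z ⊓ z′)) (*-monoʳ-≤ (W w) (R⊓≤ w z z′)))) (≤-reflexive (sym (*-assoc (W w) (W w) _)))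

  orthogonality-step : ∀ w → 5 ≤ suc w → T (g (suc w)) → ∀ h c J z z′ →
    let p = suc w; q = suc w ∸ 2; y = z / suc w; y′ = z′ / suc w; k = λ j → c + h * j in
    (∀ x x′ → ‖ ∑ J (λ j → Ψ w x (k j) ℤ.* Ψ w x′ (k j)) ℤ.- ⁺ J ℤ.* ⁺ (W w * Λ w (x ⊓ x′)) ‖ ≤ error w x x′) →
    (∀ x x′ → ‖ ⁺ p ℤ.* ∑ J (λ j → ⁺ b p (k j) ℤ.* (Ψ w x (k j) ℤ.* Ψ w x′ (k j)))
                 ℤ.- ⁺ 2 ℤ.* (⁺ J ℤ.* ⁺ (W w * Λ w (x ⊓ x′))) ‖ ≤ 2 * (p * (error w x x′ + error w x x′))) →
    ‖ ∑ J (λ j → (⁺ q ℤ.* Ψ w z (k j) ℤ.+ (⁺ 2 ℤ.- ⁺ p ℤ.* ⁺ b p (k j)) ℤ.* Ψ w y (k j))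
           ℤ.* (⁺ q ℤ.* Ψ w z′ (k j) ℤ.+ (⁺ 2 ℤ.- ⁺ p ℤ.* ⁺ b p (k j)) ℤ.* Ψ w y′ (k j)))
        ℤ.- ⁺ J ℤ.* ⁺ (q * W w * (q * Λ w (z ⊓ z′) + 2 * Λ w ((z ⊓ z′) / p))) ‖
      ≤ q * W w * (q * W w) * ((1 * R w z + 8 * R w y) * (1 * R w z′ + 8 * R w y′))
  orthogonality-step w@(suc (suc (suc t))) (s≤s (s≤s (s≤s (s≤s 1≤t)))) gp h c J z z′ base weighted = begin
    _ ≡⟨ cong ‖_‖ (cong₂ ℤ._-_ sum-expand main) ⟩
    ‖ combination (q ℤ.* q) (⁺ 2 ℤ.* q) (ℤ.- (q ℤ.* p)) (⁺ 4) (⁺ t ℤ.* p)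
        (∑ J (λ j → X z z′ j)) (∑ J (λ j → X z y′ j)) (∑ J (λ j → B j ℤ.* X z y′ j)) (∑ J (λ j → X y z′ j)) (∑ J (λ j → B j ℤ.* X y z′ j))
        (∑ J (λ j → X y y′ j)) (∑ J (λ j → B j ℤ.* X y y′ j))
      ℤ.- ⁺ J ℤ.* (q ℤ.* (q ℤ.* m z z′ ℤ.+ ⁺ 2 ℤ.* m y y′)) ‖
      ≤⟨ combination-bound t 1≤t (∑ J (X z z′)) (∑ J (X z y′)) (∑ J (λ j → B j ℤ.* X z y′ j)) (∑ J (X y z′)) (∑ J (λ j → B j ℤ.* X y z′ j))
           (∑ J (X y y′)) (∑ J (λ j → B j ℤ.* X y y′ j)) (⁺ J) (m z z′) (m z y′) (m y z′) (m y y′) (error w z z′) (error w z y′) (error w y z′) (error w y y′)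
           (base z z′) (base z y′) (weighted z y′) (base y z′) (weighted y z′) (base y y′) (weighted y y′) ⟩
    (2 + t) * (2 + t) * (error w z z′ + 8 * error w z y′ + 8 * error w y z′ + 64 * error w y y′)
      ≡⟨ error-expand (2 + t) (W w) (R w z) (R w y) (R w z′) (R w y′) ⟩
    (2 + t) * W w * ((2 + t) * W w) * ((1 * R w z + 8 * R w y) * (1 * R w z′ + 8 * R w y′)) ∎
    where
    open ≤-Reasoning
    y y′ : ℕ
    y = z / suc w
    y′ = z′ / suc w
    p q : ℤ
    p = ⁺ (4 + t)
    q = ⁺ (2 + t)
    B : ℕ → ℤ
    B j = ⁺ b (suc w) (c + h * j)
    X : ℕ → ℕ → ℕ → ℤ
    X x x′ j = Ψ w x (c + h * j) ℤ.* Ψ w x′ (c + h * j)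
    m : ℕ → ℕ → ℤ
    m x x′ = ⁺ (W w * Λ w (x ⊓ x′))
    error-expand : ∀ q W r₁ r₂ s₁ s₂ → q * q * (W * W * (r₁ * s₁) + 8 * (W * W * (r₁ * s₂)) + 8 * (W * W * (r₂ * s₁)) + 64 * (W * W * (r₂ * s₂)))
      ≡ q * W * (q * W) * ((1 * r₁ + 8 * r₂) * (1 * s₁ + 8 * s₂))
    error-expand = solve-∀
    pointwise : ∀ t B x y x′ y′ → ((⁺ 2 ℤ.+ t) ℤ.* x ℤ.+ (⁺ 2 ℤ.- (⁺ 4 ℤ.+ t) ℤ.* B) ℤ.* y) ℤ.* ((⁺ 2 ℤ.+ t) ℤ.* x′ ℤ.+ (⁺ 2 ℤ.- (⁺ 4 ℤ.+ t) ℤ.* B) ℤ.* y′) ≡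
      (⁺ 2 ℤ.+ t) ℤ.* (⁺ 2 ℤ.+ t) ℤ.* (x ℤ.* x′) ℤ.+ ⁺ 2 ℤ.* (⁺ 2 ℤ.+ t) ℤ.* (x ℤ.* y′) ℤ.+ ℤ.- ((⁺ 2 ℤ.+ t) ℤ.* (⁺ 4 ℤ.+ t)) ℤ.* (B ℤ.* (x ℤ.* y′))
      ℤ.+ ⁺ 2 ℤ.* (⁺ 2 ℤ.+ t) ℤ.* (y ℤ.* x′) ℤ.+ ℤ.- ((⁺ 2 ℤ.+ t) ℤ.* (⁺ 4 ℤ.+ t)) ℤ.* (B ℤ.* (y ℤ.* x′)) ℤ.+ ⁺ 4 ℤ.* (y ℤ.* y′) ℤ.+ t ℤ.* (⁺ 4 ℤ.+ t) ℤ.* (B ℤ.* (y ℤ.* y′))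
      ℤ.+ (⁺ 4 ℤ.+ t) ℤ.* (⁺ 4 ℤ.+ t) ℤ.* (y ℤ.* y′) ℤ.* (B ℤ.* B ℤ.- B)
    pointwise = ℤ-Ring.solve-∀
    B-idem : ∀ j → B j ℤ.* B j ℤ.- B j ≡ ⁺ 0
    B-idem j = trans (cong (ℤ._- B j) (trans (sym (ℤₚ.pos-* (b (suc w) (c + h * j)) _)) (cong ⁺_ (b-idem (suc w) (c + h * j) gp)))) (ℤₚ.+-inverseʳ (B j))
    sum-expand : ∑ J (λ j → (q ℤ.* Ψ w z (c + h * j) ℤ.+ (⁺ 2 ℤ.- p ℤ.* B j) ℤ.* Ψ w y (c + h * j))
           ℤ.* (q ℤ.* Ψ w z′ (c + h * j) ℤ.+ (⁺ 2 ℤ.- p ℤ.* B j) ℤ.* Ψ w y′ (c + h * j))) ≡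
       combination (q ℤ.* q) (⁺ 2 ℤ.* q) (ℤ.- (q ℤ.* p)) (⁺ 4) (⁺ t ℤ.* p)
        (∑ J (λ j → X z z′ j)) (∑ J (λ j → X z y′ j)) (∑ J (λ j → B j ℤ.* X z y′ j)) (∑ J (λ j → X y z′ j)) (∑ J (λ j → B j ℤ.* X y z′ j))
        (∑ J (λ j → X y y′ j)) (∑ J (λ j → B j ℤ.* X y y′ j))
    sum-expand = trans (∑-cong J λ j → trans (pointwise (⁺ t) (B j) (Ψ w z (c + h * j)) (Ψ w y (c + h * j)) (Ψ w z′ (c + h * j)) (Ψ w y′ (c + h * j)))
        (trans (cong (λ e → main-terms j ℤ.+ p ℤ.* p ℤ.* X y y′ j ℤ.* e) (B-idem j)) (trans (cong (λ e → main-terms j ℤ.+ e) (ℤₚ.*-zeroʳ (p ℤ.* p ℤ.* X y y′ j))) (ℤₚ.+-identityʳ (main-terms j)))))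
      (∑-combination (q ℤ.* q) (⁺ 2 ℤ.* q) (ℤ.- (q ℤ.* p)) (⁺ 4) (⁺ t ℤ.* p) (X z z′) (X z y′) (λ j → B j ℤ.* X z y′ j) (X y z′) (λ j → B j ℤ.* X y z′ j) (X y y′) (λ j → B j ℤ.* X y y′ j) J)
      where
      main-terms : ℕ → ℤ
      main-terms j = combination (q ℤ.* q) (⁺ 2 ℤ.* q) (ℤ.- (q ℤ.* p)) (⁺ 4) (⁺ t ℤ.* p)
        (X z z′ j) (X z y′ j) (B j ℤ.* X z y′ j) (X y z′ j) (B j ℤ.* X y z′ j) (X y y′ j) (B j ℤ.* X y y′ j)
    main : ⁺ J ℤ.* ⁺ ((2 + t) * W w * ((2 + t) * Λ w (z ⊓ z′) + 2 * Λ w ((z ⊓ z′) / suc w))) ≡ ⁺ J ℤ.* (q ℤ.* (q ℤ.* m z z′ ℤ.+ ⁺ 2 ℤ.* m y y′))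
    main = cong (λ x → ⁺ J ℤ.* x) (trans (cong ⁺_ (trans (cong (λ x → (2 + t) * W w * ((2 + t) * Λ w (z ⊓ z′) + 2 * Λ w x)) (sym (⊓-/ z z′ (suc w))))
        (lem (2 + t) (W w) (Λ w (z ⊓ z′)) (Λ w (y ⊓ y′)))))
      (trans (ℤₚ.pos-* (2 + t) ((2 + t) * x₀ + 2 * x₃)) (cong (λ x → q ℤ.* x) (trans (ℤₚ.pos-+ ((2 + t) * x₀) (2 * x₃)) (cong₂ ℤ._+_ (ℤₚ.pos-* (2 + t) x₀) (ℤₚ.pos-* 2 x₃))))))
      where
      x₀ x₃ : ℕ
      x₀ = W w * Λ w (z ⊓ z′)
      x₃ = W w * Λ w (y ⊓ y′)
      lem : ∀ q W x y → q * W * (q * x + 2 * y) ≡ q * (q * (W * x) + 2 * (W * y))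
      lem = solve-∀

  -- The function ψ_p has mean square 2 (p - 2), so the product belonging to d has as its mean
  -- square `W` times the term of d in `Λ`, and only d below both z and z′ occur in both factors.
  -- Arbitrary progressions c + h j are needed in the induction: passing to a residue class modulo
  -- the next prime multiplies h by that prime.
  orthogonality : ∀ w h → (∀ p → T (g p) → p ≤ w → p ∤ h) → ∀ z z′ c J →
    ‖ ∑ J (λ j → Ψ w z (c + h * j) ℤ.* Ψ w z′ (c + h * j)) ℤ.- ⁺ J ℤ.* ⁺ (W w * Λ w (z ⊓ z′)) ‖ ≤ error w z z′
  orthogonality zero h _ z z′ c J = ≤-trans (≤-reflexive (cong ‖_‖ (trans (cong (ℤ._- ⁺ J ℤ.* ⁺ (1 * Λ zero (z ⊓ z′)))
      (trans (∑-const J (⁺ Λ zero z ℤ.* ⁺ Λ zero z′)) (cong (λ x → ⁺ J ℤ.* x) (trans (sym (ℤₚ.pos-* (Λ zero z) (Λ zero z′))) (cong ⁺_ (unit z z′))))))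
      (ℤₚ.+-inverseʳ (⁺ J ℤ.* ⁺ (1 * Λ zero (z ⊓ z′))))))) z≤n
    where
    unit : ∀ z z′ → Λ zero z * Λ zero z′ ≡ 1 * Λ zero (z ⊓ z′)
    unit zero z′ = refl
    unit (suc z) zero = refl
    unit (suc z) (suc z′) = refl
  orthogonality (suc w) h h∤ z z′ c J with g (suc w) in eq
  ... | false = orthogonality w h (λ p gp p≤w → h∤ p gp (m≤n⇒m≤1+n p≤w)) z z′ c J
  ... | true = orthogonality-step w (g≥5 p gp) gp h c J z z′ (λ x x′ → orthogonality w h (λ q gq q≤w → h∤ q gq (m≤n⇒m≤1+n q≤w)) x x′ c J) weighted
    where
    p : ℕ
    p = suc w
    gp : T (g p)
    gp = subst T (sym eq) _
    pp : Prime p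
    pp = g-prime p gp
    weighted : ∀ x x′ → ‖ ⁺ p ℤ.* ∑ J (λ j → ⁺ b p (c + h * j) ℤ.* (Ψ w x (c + h * j) ℤ.* Ψ w x′ (c + h * j)))
                 ℤ.- ⁺ 2 ℤ.* (⁺ J ℤ.* ⁺ (W w * Λ w (x ⊓ x′))) ‖ ≤ 2 * (p * (error w x x′ + error w x x′))
    weighted x x′ = ≤-trans (weighted-average (b p) p h (λ k → Ψ w x k ℤ.* Ψ w x′ k) (W w * Λ w (x ⊓ x′)) (error w x x′)
        (b-periodic p gp) (b-two p gp h (h∤ p gp ≤-refl))
        (orthogonality w (h * p) (λ q gq q≤w → prime∤-* h p (g-prime q gq) (h∤ q gq (m≤n⇒m≤1+n q≤w)) (prime∤prime (g-prime q gq) pp (<⇒≢ (s≤s q≤w)))) x x′) c J)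
      (*-monoʳ-≤ 2 (*-monoʳ-≤ p (+-monoʳ-≤ (error w x x′) (WΛ≤error w x x′))))

  Ψ-sifted : ∀ w z k → (∀ p → p ≤ w → T (g p) → b p k ≡ 0) → Ψ w z k ≡ ⁺ Λ w z
  Ψ-sifted zero z k h = refl
  Ψ-sifted (suc w) z k h with g (suc w) in eq
  ... | false = Ψ-sifted w z k (λ p p≤w → h p (m≤n⇒m≤1+n p≤w))
  ... | true = trans (cong₂ ℤ._+_ (cong (λ x → ⁺ (suc w ∸ 2) ℤ.* x) (Ψ-sifted w z k h′))
      (cong₂ ℤ._*_ (trans (cong (λ x → ⁺ 2 ℤ.- ⁺ suc w ℤ.* ⁺ x) (h (suc w) ≤-refl (subst T (sym eq) _))) (cong (λ x → ⁺ 2 ℤ.- x) (ℤₚ.*-zeroʳ (⁺ suc w)))) (Ψ-sifted w (z / suc w) k h′)))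
      (sym (trans (ℤₚ.pos-+ ((suc w ∸ 2) * Λ w z) (2 * Λ w (z / suc w))) (cong₂ ℤ._+_ (ℤₚ.pos-* (suc w ∸ 2) (Λ w z)) (ℤₚ.pos-* 2 (Λ w (z / suc w))))))
    where
    h′ : ∀ p → p ≤ w → T (g p) → b p k ≡ 0
    h′ p p≤w = h p (m≤n⇒m≤1+n p≤w)

  square : ∀ x → x ℤ.* x ≡ ⁺ (‖ x ‖ * ‖ x ‖)
  square (⁺ n) = sym (ℤₚ.pos-* n n)
  square ℤ.-[1+ n ] = refl

  ∑-squares : ∀ (f : ℕ → ℤ) X → ∑ X (λ j → f (1 + 1 * j) ℤ.* f (1 + 1 * j)) ≡ ⁺ sumTo (λ k → ‖ f k ‖ * ‖ f k ‖) X
  ∑-squares f zero = refl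
  ∑-squares f (suc X) rewrite ∑-squares f X | *-identityˡ X | square (f (suc X)) =
    trans (sym (ℤₚ.pos-+ (sumTo (λ k → ‖ f k ‖ * ‖ f k ‖) X) (‖ f (suc X) ‖ * ‖ f (suc X) ‖))) (cong ⁺_ (+-comm (sumTo (λ k → ‖ f k ‖ * ‖ f k ‖) X) _))

  sieve-bound : ∀ {P : ℕ → Set} (P? : ∀ k → Dec (P k)) w z X → 1 ≤ z →
    (∀ k → P k → ∀ p → p ≤ w → T (g p) → b p k ≡ 0) →
    sumTo (λ k → 𝟙 (P? k)) X * Λ w z ≤ W w * (X + R w z * R w z)
  sieve-bound P? w z X 1≤z sifted = *-cancelʳ-≤ (sumTo (λ k → 𝟙 (P? k)) X * Λ w z) _ (Λ w z) {{>-nonZero (≤-trans (1≤W w) W≤Λ)}} (begin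
    sumTo (λ k → 𝟙 (P? k)) X * Λ w z * Λ w z ≡⟨ *-assoc (sumTo (λ k → 𝟙 (P? k)) X) (Λ w z) (Λ w z) ⟩
    sumTo (λ k → 𝟙 (P? k)) X * (Λ w z * Λ w z) ≡⟨ sum-*ʳ (Λ w z * Λ w z) (λ k → 𝟙 (P? k)) X ⟨
    sumTo (λ k → 𝟙 (P? k) * (Λ w z * Λ w z)) X ≤⟨ sum-mono X (λ k _ _ → 𝟙*-≤ (P? k) (λ pk →
       ≤-reflexive (sym (cong (λ x → ‖ x ‖ * ‖ x ‖) (Ψ-sifted w z k (sifted k pk)))))) ⟩
    a ≤⟨ upper ⟩
    -- Replacing one `W` by `Λ` makes the remainder divisible by `Λ` as well, so that this factor
    -- can be cancelled.
    X * (W w * Λ w z) + W w * W w * (R w z * R w z) ≤⟨ +-monoʳ-≤ (X * (W w * Λ w z)) (*-monoˡ-≤ (R w z * R w z) (*-monoʳ-≤ (W w) W≤Λ)) ⟩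
    X * (W w * Λ w z) + W w * Λ w z * (R w z * R w z) ≡⟨ lem X (W w) (Λ w z) (R w z * R w z) ⟩
    W w * (X + R w z * R w z) * Λ w z ∎)
    where
    open ≤-Reasoning
    lem : ∀ X W l r → X * (W * l) + W * l * r ≡ W * (X + r) * l
    lem = solve-∀
    W≤Λ : W w ≤ Λ w z
    W≤Λ = primeProd≤sieveSum g (_∸ 2) (λ _ → 2) w z 1≤z
    a M : ℕ
    a = sumTo (λ k → ‖ Ψ w z k ‖ * ‖ Ψ w z k ‖) X
    M = X * (W w * Λ w z)
    lemℤ : ∀ a m → a ≡ a ℤ.- m ℤ.+ m
    lemℤ = ℤ-Ring.solve-∀
    near : ‖ ⁺ a ℤ.- ⁺ M ‖ ≤ error w z z
    near = subst (λ x → ‖ x ‖ ≤ error w z z) (cong₂ ℤ._-_ (∑-squares (Ψ w z) X)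
        (trans (cong (λ y → ⁺ X ℤ.* ⁺ (W w * Λ w y)) (⊓-idem z)) (sym (ℤₚ.pos-* X (W w * Λ w z)))))
      (orthogonality w 1 (λ p gp _ → prime∤1 (g-prime p gp)) z z 1 X)
    upper : a ≤ M + error w z z
    upper = begin
      a ≡⟨ cong ‖_‖ (lemℤ (⁺ a) (⁺ M)) ⟩
      ‖ ⁺ a ℤ.- ⁺ M ℤ.+ ⁺ M ‖ ≤⟨ ℤₚ.∣i+j∣≤∣i∣+∣j∣ (⁺ a ℤ.- ⁺ M) (⁺ M) ⟩
      ‖ ⁺ a ℤ.- ⁺ M ‖ + M ≤⟨ +-monoˡ-≤ M near ⟩
      error w z z + M ≡⟨ +-comm (error w z z) M ⟩
      M + error w z z ∎

-- Harmonic sums over smooth numbers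

-- The bound q ≤ n makes the condition decidable; prime divisors of a positive n satisfy it anyway.
Smooth : ℕ → ℕ → Set
Smooth w n = ∀ {q} → q < suc n → ¬ (Prime q × q ∣ n × w < q)

smooth? : ∀ w n → Dec (Smooth w n)
smooth? w n = allUpTo? (λ q → ¬? (prime? q ×-dec q ∣? n ×-dec w <? q)) (suc n)

smooth : ∀ {w n q} → 1 ≤ n → Smooth w n → Prime q → q ∣ n → q ≤ w
smooth {w} {n} {q} 1≤n s pq q∣n with q ≤? w
... | yes q≤w = q≤w
... | no q≰w = contradiction (pq , q∣n , ≰⇒> q≰w) (s (s≤s (∣⇒≤ {{>-nonZero 1≤n}} q∣n)))

mkSmooth : ∀ {w n} → (∀ {q} → Prime q → q ∣ n → q ≤ w) → Smooth w n
mkSmooth h _ (pq , q∣n , w<q) = <⇒≱ w<q (h pq q∣n)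

-- inv n stands for the reciprocal of n, scaled by a common multiple of 1, …, N.
module Harmonic (B : ℕ) (N : ℕ) (inv : ℕ → ℕ) (inv-* : ∀ m p → 1 ≤ m → 1 ≤ p → m * p ≤ N → p * inv (m * p) ≡ inv m) where

  good? : ∀ p → Dec (Prime p × p ∤ B)
  good? p = prime? p ×-dec ¬? (p ∣? B)

  bad? : ∀ p → Dec (Prime p × p ∣ B)
  bad? p = prime? p ×-dec p ∣? B

  g bad : ℕ → Bool
  g p = ⌊ good? p ⌋
  bad p = ⌊ bad? p ⌋

  K : ℕ → ℕ → ℕ
  K = sieveSum g (_∸ 1) (λ _ → 1)

  W₁ badProd badProd₁ : ℕ → ℕ
  W₁ = primeProd g (_∸ 1)
  badProd = primeProd bad id
  badProd₁ = primeProd bad (_∸ 1)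

  -- The parameter m holds the prime factors already split off, so that a scaled reciprocal never
  -- has to be divided.
  H : ℕ → ℕ → ℕ → ℕ
  H w z m = sumTo (λ n → 𝟙 (smooth? w n) * inv (m * n)) z

  -- A number without prime factors above p = w + 1 either has none above w or is p times a number
  -- of the first kind.
  H-peel : ∀ w z m → Prime (suc w) → H (suc w) z m ≤ H w z m + H (suc w) (z / suc w) (m * suc w)
  H-peel w z m pp = begin
    H p z m ≤⟨ sum-mono z (λ n 1≤n _ → pointwise n 1≤n) ⟩
    sumTo (λ n → 𝟙 (smooth? w n) * inv (m * n) + 𝟙 (p ∣? n) * f n) z ≡⟨ sum-+ _ _ z ⟩
    H w z m + sumTo (λ n → 𝟙 (p ∣? n) * f n) z ≡⟨ cong (λ x → H w z m + x) (sum-multiples f p z) ⟩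
    H w z m + sumTo (λ k → f (p * k)) (z / p) ≤⟨ +-monoʳ-≤ (H w z m) (sum-mono (z / p) (λ k 1≤k _ → *-mono-≤
       (𝟙-mono (smooth? p (p * k)) (smooth? p k) (λ s → mkSmooth (λ pq q∣k → smooth (*-mono-≤ {1} {p} (s≤s z≤n) 1≤k) s pq (∣n⇒∣m*n p q∣k))))
       (≤-reflexive (cong inv (sym (*-assoc m p k)))))) ⟩
    H w z m + H p (z / p) (m * p) ∎
    where
    open ≤-Reasoning
    p : ℕ
    p = suc w
    f : ℕ → ℕ
    f n = 𝟙 (smooth? p n) * inv (m * n)
    pointwise : ∀ n → 1 ≤ n → f n ≤ 𝟙 (smooth? w n) * inv (m * n) + 𝟙 (p ∣? n) * f n
    pointwise n 1≤n with p ∣? n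
    ... | yes _ = ≤-trans (≤-reflexive (sym (+-identityʳ (f n)))) (m≤n+m _ (𝟙 (smooth? w n) * inv (m * n)))
    ... | no p∤n = ≤-trans (*-monoˡ-≤ (inv (m * n)) (𝟙-mono (smooth? p n) (smooth? w n) (λ s → mkSmooth (λ {q} pq q∣n → below pq q∣n (smooth 1≤n s pq q∣n)))))
        (m≤m+n _ 0)
      where
      below : ∀ {q} → Prime q → q ∣ n → q ≤ p → q ≤ w
      below pq q∣n q≤p with m≤n⇒m<n∨m≡n q≤p
      ... | inj₁ q<p = ≤-pred q<p
      ... | inj₂ refl = contradiction q∣n p∤n

  H-composite : ∀ w z m → ¬ Prime (suc w) → H (suc w) z m ≤ H w z m
  H-composite w z m ¬pp = sum-mono z (λ n 1≤n _ → *-monoˡ-≤ (inv (m * n)) (𝟙-mono (smooth? (suc w) n) (smooth? w n)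
    (λ s → mkSmooth (λ pq q∣n → below pq (smooth 1≤n s pq q∣n)))))
    where
    below : ∀ {q} → Prime q → q ≤ suc w → q ≤ w
    below pq q≤p with m≤n⇒m<n∨m≡n q≤p
    ... | inj₁ q<p = ≤-pred q<p
    ... | inj₂ refl = contradiction pq ¬pp

  -- Group n by the product d of the good primes dividing it. The powers of a good prime then give
  -- at most 1 / p + 1 / p² + ... = 1 / (p - 1), its weight in `K / W₁`, while a bad prime, which
  -- cannot divide d, gives its whole Euler factor p / (p - 1).
  Claim : ℕ → Set
  Claim w = ∀ z m → 1 ≤ m → m * z ≤ N → W₁ w * badProd₁ w * H w z m ≤ inv m * (badProd w * K w z)

  /-index : ∀ m z p .{{_ : NonZero p}} → m * z ≤ N → m * p * (z / p) ≤ N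
  /-index m z p h = ≤-trans (≤-reflexive (trans (*-assoc m p (z / p)) (cong (m *_) (*-comm p (z / p))))) (≤-trans (*-monoʳ-≤ m (m/n*n≤m z p)) h)

  -- Summing the geometric series over the powers of the prime p = w + 1.
  peeled : ∀ w → Prime (suc w) → Claim w → ∀ z m → 1 ≤ m → m * z ≤ N →
    W₁ w * badProd₁ w * w * H (suc w) z m ≤ suc w * inv m * (badProd w * K w z)
  peeled-tail : ∀ w → Prime (suc w) → (∀ z m → 1 ≤ m → m * z ≤ N →
    W₁ w * badProd₁ w * w * H (suc w) z m ≤ suc w * inv m * (badProd w * K w z)) → ∀ y m → 1 ≤ m → m * suc w * y ≤ N →
    W₁ w * badProd₁ w * w * H (suc w) y (m * suc w) ≤ inv m * (badProd w * K w y)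
  peeled-tail w pp h zero m 1≤m _ = ≤-trans (≤-reflexive (*-zeroʳ (W₁ w * badProd₁ w * w))) z≤n
  peeled-tail w pp h y@(suc _) m 1≤m m≤ = ≤-trans (h y (m * suc w) (*-mono-≤ 1≤m (s≤s z≤n)) m≤)
    (≤-reflexive (cong (_* (badProd w * K w y)) (inv-* m (suc w) 1≤m (s≤s z≤n) (≤-trans (m≤m*n (m * suc w) y) m≤))))
  peeled w pp claim = <-rec _ go
    where
    open ≤-Reasoning
    U : ℕ
    U = W₁ w * badProd₁ w
    go : ∀ z → (∀ {y} → y < z → ∀ m → 1 ≤ m → m * y ≤ N → U * w * H (suc w) y m ≤ suc w * inv m * (badProd w * K w y)) →
         ∀ m → 1 ≤ m → m * z ≤ N → U * w * H (suc w) z m ≤ suc w * inv m * (badProd w * K w z)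
    go zero _ m _ _ = ≤-trans (≤-reflexive (*-zeroʳ (U * w))) z≤n
    go z@(suc _) rec m 1≤m mz≤N = begin
      U * w * H (suc w) z m ≤⟨ *-monoʳ-≤ (U * w) (H-peel w z m pp) ⟩
      U * w * (H w z m + H (suc w) y (m * suc w)) ≡⟨ lem₁ U w (H w z m) _ ⟩
      w * (U * H w z m) + U * w * H (suc w) y (m * suc w) ≤⟨ +-mono-≤ (*-monoʳ-≤ w (claim z m 1≤m mz≤N)) tail ⟩
      w * (inv m * (badProd w * K w z)) + inv m * (badProd w * K w z) ≡⟨ lem₂ w (inv m) (badProd w * K w z) ⟩
      suc w * inv m * (badProd w * K w z) ∎
      where
      y : ℕ
      y = z / suc w
      y<z : y < z
      y<z = m/n<m z (suc w) (prime⇒2≤ pp)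
      lem₁ : ∀ U w a b → U * w * (a + b) ≡ w * (U * a) + U * w * b
      lem₁ = solve-∀
      lem₂ : ∀ w i x → w * (i * x) + i * x ≡ suc w * i * x
      lem₂ = solve-∀
      tail : U * w * H (suc w) y (m * suc w) ≤ inv m * (badProd w * K w z)
      tail with y in eq | /-index m z (suc w) mz≤N
      ... | zero | _ = ≤-trans (≤-reflexive (*-zeroʳ (U * w))) z≤n
      ... | y′@(suc _) | m≤ = begin
        U * w * H (suc w) y′ (m * suc w) ≤⟨ rec (subst (_< z) eq y<z) (m * suc w) (*-mono-≤ 1≤m (s≤s z≤n)) m≤ ⟩
        suc w * inv (m * suc w) * (badProd w * K w y′) ≡⟨ cong (_* (badProd w * K w y′)) (inv-* m (suc w) 1≤m (s≤s z≤n) (≤-trans (m≤m*n (m * suc w) y′) m≤)) ⟩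
        inv m * (badProd w * K w y′) ≤⟨ *-monoʳ-≤ (inv m) (*-monoʳ-≤ (badProd w) (sieveSum-mono g (_∸ 1) (λ _ → 1) w (subst (_≤ z) eq (<⇒≤ y<z)))) ⟩
        inv m * (badProd w * K w z) ∎

  claims : ∀ w → Claim w
  claims zero z m 1≤m mz≤N = begin
    1 * H 0 z m ≡⟨ *-identityˡ (H 0 z m) ⟩
    H 0 z m ≤⟨ sum-mono z (λ n 1≤n _ → only-one n 1≤n) ⟩
    sumTo (λ n → 𝟙 (n ≟ 1) * inv m) z ≡⟨ sum-*ʳ (inv m) _ z ⟩
    sumTo (λ n → 𝟙 (n ≟ 1)) z * inv m ≤⟨ *-monoˡ-≤ (inv m) (count-one z) ⟩
    K 0 z * inv m ≡⟨ lem (K 0 z) (inv m) ⟩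
    inv m * (1 * K 0 z) ∎
    where
    open ≤-Reasoning
    lem : ∀ k i → k * i ≡ i * (1 * k)
    lem = solve-∀
    count-one : ∀ z → sumTo (λ n → 𝟙 (n ≟ 1)) z ≤ K 0 z
    count-one zero = z≤n
    count-one (suc z) = sum-unique (_≟ 1) (suc z) (λ i j p q → trans p (sym q))
    only-one : ∀ n → 1 ≤ n → 𝟙 (smooth? 0 n) * inv (m * n) ≤ 𝟙 (n ≟ 1) * inv m
    only-one n 1≤n with n ≟ 1
    ... | yes refl = *-mono-≤ (𝟙≤1 (smooth? 0 1)) (≤-reflexive (cong inv (*-identityʳ m)))
    ... | no n≢1 = 𝟙*-≤ (smooth? 0 n) (λ s → let q , pq , q∣n = ∃-prime-divisor n (≤∧≢⇒< 1≤n (n≢1 ∘ sym)) in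
                     contradiction (smooth 1≤n s pq q∣n) (<⇒≱ (prime⇒1≤ pq)))
  claims (suc w) z m 1≤m mz≤N with good? (suc w) | bad? (suc w)
  ... | yes (_ , ∤B) | yes (_ , ∣B) = contradiction ∣B ∤B
  ... | no ¬good | no ¬bad = ≤-trans (*-monoʳ-≤ (W₁ w * badProd₁ w) (H-composite w z m ¬prime)) (claims w z m 1≤m mz≤N)
    where
    ¬prime : ¬ Prime (suc w)
    ¬prime pp with suc w ∣? B
    ... | yes d = ¬bad (pp , d)
    ... | no d = ¬good (pp , d)
  ... | no _ | yes (pp , _) = begin
    W₁ w * (w * badProd₁ w) * H (suc w) z m ≡⟨ lem₁ (W₁ w) w (badProd₁ w) (H (suc w) z m) ⟩
    W₁ w * badProd₁ w * w * H (suc w) z m ≤⟨ peeled w pp (claims w) z m 1≤m mz≤N ⟩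
    suc w * inv m * (badProd w * K w z) ≡⟨ lem₂ (suc w) (inv m) (badProd w) (K w z) ⟩
    inv m * (suc w * badProd w * K w z) ∎
    where
    open ≤-Reasoning
    lem₁ : ∀ a w b h → a * (w * b) * h ≡ a * b * w * h
    lem₁ = solve-∀
    lem₂ : ∀ p i b k → p * i * (b * k) ≡ i * (p * b * k)
    lem₂ = solve-∀
  ... | yes (pp , _) | no _ = begin
    w * W₁ w * badProd₁ w * H (suc w) z m ≤⟨ *-monoʳ-≤ (w * W₁ w * badProd₁ w) (H-peel w z m pp) ⟩
    w * W₁ w * badProd₁ w * (H w z m + H (suc w) y (m * suc w)) ≡⟨ lem₁ w (W₁ w) (badProd₁ w) (H w z m) _ ⟩
    w * (W₁ w * badProd₁ w * H w z m) + W₁ w * badProd₁ w * w * H (suc w) y (m * suc w)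
      ≤⟨ +-mono-≤ (*-monoʳ-≤ w (claims w z m 1≤m mz≤N)) (peeled-tail w pp (peeled w pp (claims w)) y m 1≤m (/-index m z (suc w) mz≤N)) ⟩
    w * (inv m * (badProd w * K w z)) + inv m * (badProd w * K w y) ≡⟨ lem₂ w (inv m) (badProd w) (K w z) (K w y) ⟩
    inv m * (badProd w * (w * K w z + 1 * K w y)) ∎
    where
    open ≤-Reasoning
    y : ℕ
    y = z / suc w
    lem₁ : ∀ w a b x y → w * a * b * (x + y) ≡ w * (a * b * x) + a * b * w * y
    lem₁ = solve-∀
    lem₂ : ∀ w i b x y → w * (i * (b * x)) + i * (b * y) ≡ i * (b * (w * x + 1 * y))
    lem₂ = solve-∀

  count-bad-suc : ∀ w → count bad (suc w) ≤ w
  count-bad-suc zero with bad? 1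
  ... | yes (() , _)
  ... | no _ = z≤n
  count-bad-suc (suc w) with bad? (2 + w)
  ... | yes _ = s≤s (count-bad-suc w)
  ... | no _ = m≤n⇒m≤1+n (count-bad-suc w)

  count-bad : ∀ w → count bad w ≤ w ∸ 1
  count-bad zero = z≤n
  count-bad (suc w) = count-bad-suc w

  -- If c bad primes precede the bad prime p, then c + 1 ≤ p - 1, so p / (p - 1) ≤ (c + 2) / (c +
  -- 1), and the product telescopes.
  badProd≤ : ∀ w → badProd w ≤ suc (count bad w) * badProd₁ w
  badProd≤ zero = ≤-refl
  badProd≤ (suc w) with bad? (suc w)
  ... | no _ = badProd≤ w
  ... | yes (pp , _) = begin
    suc w * badProd w ≤⟨ *-monoʳ-≤ (suc w) (badProd≤ w) ⟩
    suc w * (suc c * badProd₁ w) ≡⟨ lem₁ w c (badProd₁ w) ⟩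
    (suc c + w * suc c) * badProd₁ w ≤⟨ *-monoˡ-≤ (badProd₁ w) (+-monoˡ-≤ (w * suc c) suc-c≤w) ⟩
    (w + w * suc c) * badProd₁ w ≡⟨ lem₂ w c (badProd₁ w) ⟩
    suc (suc c) * (w * badProd₁ w) ∎
    where
    open ≤-Reasoning
    c : ℕ
    c = count bad w
    suc-c≤w : suc c ≤ w
    suc-c≤w = ≤-trans (s≤s (count-bad w)) (≤-reflexive (m+[n∸m]≡n {1} (≤-pred (prime⇒2≤ pp))))
    lem₁ : ∀ w c b → suc w * (suc c * b) ≡ (suc c + w * suc c) * b
    lem₁ = solve-∀
    lem₂ : ∀ w c b → (w + w * suc c) * b ≡ suc (suc c) * (w * b)
    lem₂ = solve-∀

  1≤badProd₁ : ∀ w → 1 ≤ badProd₁ w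
  1≤badProd₁ w = ≤-trans (≤-reflexive (sym (^-zeroˡ (count bad w))))
    (primeProd-≥ bad (_∸ 1) 1 w (λ p _ _ t → ∸-monoˡ-≤ 1 (prime⇒2≤ (proj₁ (toWitness t)))))

  harmonic-≤-K : ∀ w z → z ≤ w → 1 * z ≤ N → W₁ w * sumTo inv z ≤ inv 1 * (suc (count bad w) * K w z)
  harmonic-≤-K w z z≤w z≤N = *-cancelʳ-≤ _ _ (badProd₁ w) {{>-nonZero (1≤badProd₁ w)}} (begin
    W₁ w * sumTo inv z * badProd₁ w ≡⟨ lem₁ (W₁ w) (sumTo inv z) (badProd₁ w) ⟩
    W₁ w * badProd₁ w * sumTo inv z ≡⟨ cong (W₁ w * badProd₁ w *_) (sum-cong z all-smooth) ⟩
    W₁ w * badProd₁ w * H w z 1 ≤⟨ claims w z 1 ≤-refl z≤N ⟩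
    inv 1 * (badProd w * K w z) ≤⟨ *-monoʳ-≤ (inv 1) (*-monoˡ-≤ (K w z) (badProd≤ w)) ⟩
    inv 1 * (suc (count bad w) * badProd₁ w * K w z) ≡⟨ lem₂ (inv 1) (suc (count bad w)) (badProd₁ w) (K w z) ⟩
    inv 1 * (suc (count bad w) * K w z) * badProd₁ w ∎)
    where
    open ≤-Reasoning
    lem₁ : ∀ a b c → a * b * c ≡ a * c * b
    lem₁ = solve-∀
    lem₂ : ∀ a b c d → a * (b * c * d) ≡ a * (b * d) * c
    lem₂ = solve-∀
    all-smooth : ∀ n → 1 ≤ n → n ≤ z → inv n ≡ 𝟙 (smooth? w n) * inv (1 * n)
    all-smooth n 1≤n n≤z = trans (cong inv (sym (*-identityˡ n))) (sym (𝟙*-≡ (smooth? w n)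
      (mkSmooth (λ pq q∣n → ≤-trans (∣⇒≤ {{>-nonZero 1≤n}} q∣n) (≤-trans n≤z z≤w)))))

-- Roots of linear congruences, and pairs of primes

∑-unit : ∀ (f : ℕ → ℕ) n r → r < n → f r ≡ 1 → (∀ s → s < n → s ≢ r → f s ≡ 0) → ∑ n (λ s → ⁺ f s) ≡ ⁺ 1
∑-unit f (suc n) r r<n fr other with m≤n⇒m<n∨m≡n (≤-pred r<n)
... | inj₁ r<n′ = cong₂ ℤ._+_ (∑-unit f n r r<n′ fr (λ s s<n → other s (m≤n⇒m≤1+n s<n))) (cong ⁺_ (other n ≤-refl (<⇒≢ r<n′ ∘ sym)))
... | inj₂ refl = cong₂ ℤ._+_ (vanish n ≤-refl) (cong ⁺_ fr)
  where
  vanish : ∀ k → k ≤ r → ∑ k (λ s → ⁺ f s) ≡ ⁺ 0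
  vanish zero _ = refl
  vanish (suc k) k<r = cong₂ ℤ._+_ (vanish k (<⇒≤ k<r)) (cong ⁺_ (other k (m≤n⇒m≤1+n k<r) (<⇒≢ k<r)))

∃-root : ∀ p a c → Prime p → p ∤ a → ∃[ r ] (r < p × p ∣ a * r + c)
∃-root p a c pp p∤a = r % p , m%n<n r p , p∣
  where
  instance
    _ : NonZero p
    _ = prime⇒nonZero pp
  solution : ∃[ r ] p ∣ a * r + c
  solution with coprime-Bézout (prime∤⇒coprime pp p∤a)
  -- Here x inverts a, and c (p - 1) stands for -c modulo p.
  ... | Bézout.+- x y eq = x * (c * (p ∸ 1)) , divides (c + y * (c * (p ∸ 1))) (begin
      a * (x * (c * (p ∸ 1))) + c ≡⟨ lem₁ a x (c * (p ∸ 1)) c ⟩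
      x * a * (c * (p ∸ 1)) + c ≡⟨ cong (λ e → e * (c * (p ∸ 1)) + c) eq ⟨
      (1 + y * p) * (c * (p ∸ 1)) + c ≡⟨ lem₂ y p c (p ∸ 1) ⟩
      c * (1 + (p ∸ 1)) + y * (c * (p ∸ 1)) * p ≡⟨ cong (λ e → c * e + y * (c * (p ∸ 1)) * p) (m+[n∸m]≡n (prime⇒1≤ pp)) ⟩
      c * p + y * (c * (p ∸ 1)) * p ≡⟨ *-distribʳ-+ p c (y * (c * (p ∸ 1))) ⟨
      (c + y * (c * (p ∸ 1))) * p ∎)
    where
    open ≡-Reasoning
    lem₁ : ∀ a x d c → a * (x * d) + c ≡ x * a * d + c
    lem₁ = solve-∀
    lem₂ : ∀ y p c q → (1 + y * p) * (c * q) + c ≡ c * (1 + q) + y * (c * q) * p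
    lem₂ = solve-∀
  ... | Bézout.-+ x y eq = x * c , divides (c * y) (begin
      a * (x * c) + c ≡⟨ lem₁ a x c ⟩
      c * (1 + x * a) ≡⟨ cong (c *_) eq ⟩
      c * (y * p) ≡⟨ *-assoc c y p ⟨
      c * y * p ∎)
    where
    open ≡-Reasoning
    lem₁ : ∀ a x c → a * (x * c) + c ≡ c * (1 + x * a)
    lem₁ = solve-∀
  r : ℕ
  r = proj₁ solution
  p∣ : p ∣ a * (r % p) + c
  p∣ = ∣m+n∣m⇒∣n (subst (p ∣_) (trans (cong (λ e → a * e + c) (m≡m%n+[m/n]*n r p)) (lem a (r % p) (r / p) p c)) (proj₂ solution)) (m∣m*n (a * (r / p)))
    where
    lem : ∀ a x y p c → a * (x + y * p) + c ≡ p * (a * y) + (a * x + c)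
    lem = solve-∀

root-unique : ∀ p a c → Prime p → p ∤ a → ∀ r s → r ≤ s → s < p → p ∣ a * r + c → p ∣ a * s + c → s ≡ r
root-unique p a c pp p∤a r s r≤s s<p dr ds with euclidsLemma a (s ∸ r) pp (∣m+n∣m⇒∣n (subst (p ∣_) split ds) dr)
  where
  split : a * s + c ≡ a * r + c + a * (s ∸ r)
  split = trans (cong (λ e → a * e + c) (sym (m+[n∸m]≡n r≤s))) (lem a r (s ∸ r) c)
    where
    lem : ∀ a r e c → a * (r + e) + c ≡ a * r + c + a * e
    lem = solve-∀
... | inj₁ p∣a = contradiction p∣a p∤a
... | inj₂ p∣s-r with s ∸ r in eq
...   | zero = ≤-antisym (m∸n≡0⇒m≤n eq) r≤s
...   | suc e = contradiction (∣⇒≤ p∣s-r) (<⇒≱ (≤-<-trans (≤-trans (≤-reflexive (sym eq)) (m∸n≤m s r)) s<p))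

root-count : ∀ p a c → Prime p → p ∤ a → ∑ p (λ r → ⁺ 𝟙 (p ∣? (a * r + c))) ≡ ⁺ 1
root-count p a c pp p∤a with ∃-root p a c pp p∤a
... | r , r<p , d = ∑-unit _ p r r<p (𝟙-yes (p ∣? (a * r + c)) d) other
  where
  other : ∀ s → s < p → s ≢ r → 𝟙 (p ∣? (a * s + c)) ≡ 0
  other s s<p s≢r = 𝟙-no (p ∣? (a * s + c)) (λ e → s≢r (case ≤-total r s of λ
    { (inj₁ r≤s) → root-unique p a c pp p∤a r s r≤s s<p d e
    ; (inj₂ s≤r) → sym (root-unique p a c pp p∤a s r s≤r r<p e d) }))

sum-below : ∀ w X → sumTo (λ k → 𝟙 (k ≤? w)) X ≤ w
sum-below w X with ≤-total X w
... | inj₁ X≤w = ≤-trans (sum-≤-const 1 X (λ k _ _ → 𝟙≤1 (k ≤? w))) (≤-trans (≤-reflexive (*-identityʳ X)) X≤w)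
... | inj₂ w≤X = begin
  sumTo (λ k → 𝟙 (k ≤? w)) X ≡⟨ cong (sumTo (λ k → 𝟙 (k ≤? w))) (m+[n∸m]≡n w≤X) ⟨
  sumTo (λ k → 𝟙 (k ≤? w)) (w + (X ∸ w)) ≡⟨ sum-add _ w (X ∸ w) ⟩
  sumTo (λ k → 𝟙 (k ≤? w)) w + sumTo (λ k → 𝟙 (w + k ≤? w)) (X ∸ w) ≤⟨ +-mono-≤ (sum-≤-const 1 w (λ k _ _ → 𝟙≤1 (k ≤? w)))
      (sum-≤-const 0 (X ∸ w) (λ k 1≤k _ → ≤-reflexive (𝟙-no (w + k ≤? w) (<⇒≱ (≤-trans (≤-reflexive (+-comm 1 w)) (+-monoʳ-≤ w 1≤k)))))) ⟩
  w * 1 + (X ∸ w) * 0 ≡⟨ cong₂ _+_ (*-identityʳ w) (*-zeroʳ (X ∸ w)) ⟩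
  w + 0 ≡⟨ +-identityʳ w ⟩
  w ∎
  where open ≤-Reasoning

-- Simultaneous primes u k + 1 and v k + 1, for v = u + d: the primes dividing B are those at which the two linear
-- forms fail to have two distinct roots, together with 2 and 3.
module PrimePairs (u d : ℕ) (1≤u : 1 ≤ u) (1≤d : 1 ≤ d) (s t : ℕ) (v≤2^s : u + d ≤ 2 ^ s) where

  -- `harmonic-≤-K` evaluates K at N ≤ w, and `Λ-lower` turns K(N)² into Λ at N · N, hence the level
  -- z.
  v B N w z : ℕ
  v = u + d
  B = 6 * (u * v * d)
  N = 2 ^ t
  w = N
  z = N * N

  inv : ℕ → ℕ
  inv zero = 0
  inv n@(suc _) = N ! / n

  *-inv : ∀ n → 1 ≤ n → n ≤ N → n * inv n ≡ N !
  *-inv n@(suc _) 1≤n n≤N = m*[n/m]≡n (∣! N 1≤n n≤N)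

  inv-* : ∀ m p → 1 ≤ m → 1 ≤ p → m * p ≤ N → p * inv (m * p) ≡ inv m
  inv-* m p 1≤m 1≤p mp≤N = *-cancelˡ-≡ _ _ m {{>-nonZero 1≤m}} (begin
    m * (p * inv (m * p)) ≡⟨ *-assoc m p _ ⟨
    m * p * inv (m * p) ≡⟨ *-inv (m * p) (*-mono-≤ 1≤m 1≤p) mp≤N ⟩
    N ! ≡⟨ *-inv m 1≤m (≤-trans (m≤m*n m p {{>-nonZero 1≤p}}) mp≤N) ⟨
    m * inv m ∎)
    where open ≡-Reasoning

  open Harmonic B N inv inv-*

  g-prime : ∀ p → T (g p) → Prime p
  g-prime p gp = proj₁ (toWitness gp)

  g∤ : ∀ p → T (g p) → p ∤ B
  g∤ p gp = proj₂ (toWitness gp)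

  g≥5 : ∀ p → T (g p) → 5 ≤ p
  g≥5 p gp = go p (g-prime p gp) (g∤ p gp)
    where
    go : ∀ p → Prime p → p ∤ B → 5 ≤ p
    go 0 () _
    go 1 () _
    go 2 _ ∤B = contradiction (∣m⇒∣m*n (u * v * d) (divides 3 refl)) ∤B
    go 3 _ ∤B = contradiction (∣m⇒∣m*n (u * v * d) (divides 2 refl)) ∤B
    go 4 pp _ = contradiction pp (toWitnessFalse {a? = prime? 4} _)
    go (suc (suc (suc (suc (suc _))))) _ _ = s≤s (s≤s (s≤s (s≤s (s≤s z≤n))))

  g∤u : ∀ p → T (g p) → p ∤ u
  g∤u p gp p∣u = g∤ p gp (∣n⇒∣m*n 6 (∣m⇒∣m*n d (∣m⇒∣m*n v p∣u)))

  g∤v : ∀ p → T (g p) → p ∤ v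
  g∤v p gp p∣v = g∤ p gp (∣n⇒∣m*n 6 (∣m⇒∣m*n d (∣n⇒∣m*n u p∣v)))

  g∤d : ∀ p → T (g p) → p ∤ d
  g∤d p gp p∣d = g∤ p gp (∣n⇒∣m*n 6 (∣n⇒∣m*n (u * v) p∣d))

  hit : ℕ → ℕ → ℕ → ℕ
  hit a p k = 𝟙 (p ∣? (a * k + 1))

  b : ℕ → ℕ → ℕ
  b p k = hit u p k + hit v p k

  -- The two forms differ by d k; p does not divide d, and p ∣ k would give p ∣ 1.
  not-both : ∀ p k → T (g p) → p ∣ u * k + 1 → p ∣ v * k + 1 → ⊥
  not-both p k gp du dv with euclidsLemma d k (g-prime p gp) (∣m+n∣m⇒∣n (subst (p ∣_) (lem u d k) dv) du)
    where
    lem : ∀ u d k → (u + d) * k + 1 ≡ u * k + 1 + d * k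
    lem = solve-∀
  ... | inj₁ p∣d = g∤d p gp p∣d
  ... | inj₂ p∣k = prime∤1 (g-prime p gp) (∣m+n∣m⇒∣n du (∣n⇒∣m*n u p∣k))

  b-idem : ∀ p k → T (g p) → b p k * b p k ≡ b p k
  b-idem p k gp with p ∣? (u * k + 1) | p ∣? (v * k + 1)
  ... | yes du | yes dv = ⊥-elim (not-both p k gp du dv)
  ... | yes _ | no _ = refl
  ... | no _ | yes _ = refl
  ... | no _ | no _ = refl

  hit-periodic : ∀ a p k i → hit a p (k + p * i) ≡ hit a p k
  hit-periodic a p k i = 𝟙-cong (p ∣? (a * (k + p * i) + 1)) (p ∣? (a * k + 1))
    (λ e → ∣m+n∣m⇒∣n (subst (p ∣_) (lem a p k i) e) (m∣m*n (a * i)))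
    (λ e → subst (p ∣_) (sym (lem a p k i)) (∣m∣n⇒∣m+n (m∣m*n (a * i)) e))
    where
    lem : ∀ a p k i → a * (k + p * i) + 1 ≡ p * (a * i) + (a * k + 1)
    lem = solve-∀

  hit-one : ∀ a p → Prime p → p ∤ a → ∀ h → p ∤ h → ∀ c → ∑ p (λ r → ⁺ hit a p (c + h * r)) ≡ ⁺ 1
  hit-one a p pp p∤a h p∤h c = trans (∑-cong p (λ r → cong ⁺_ (𝟙-cong (p ∣? (a * (c + h * r) + 1)) (p ∣? (a * h * r + (a * c + 1)))
      (subst (p ∣_) (lem a c h r)) (subst (p ∣_) (sym (lem a c h r))))))
    (root-count p (a * h) (a * c + 1) pp (prime∤-* a h pp p∤a p∤h))
    where
    lem : ∀ a c h r → a * (c + h * r) + 1 ≡ a * h * r + (a * c + 1)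
    lem = solve-∀

  b-two : ∀ p → T (g p) → ∀ h → p ∤ h → ∀ c → ∑ p (λ r → ⁺ b p (c + h * r)) ≡ ⁺ 2
  b-two p gp h p∤h c = trans (∑-cong p (λ r → ℤₚ.pos-+ (hit u p (c + h * r)) _)) (trans (∑-+ (λ r → ⁺ hit u p (c + h * r)) (λ r → ⁺ hit v p (c + h * r)) p)
    (cong₂ ℤ._+_ (hit-one u p (g-prime p gp) (g∤u p gp) h p∤h c) (hit-one v p (g-prime p gp) (g∤v p gp) h p∤h c)))

  open SieveWeights g g≥5 hiding (K; W₁)
  open Sieve g b g-prime g≥5 b-idem (λ p _ k i → cong₂ _+_ (hit-periodic u p k i) (hit-periodic v p k i)) b-two

  Pair : ℕ → Set
  Pair k = Prime (u * k + 1) × Prime (v * k + 1)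

  pair? : ∀ k → Dec (Pair k)
  pair? k = prime? (u * k + 1) ×-dec prime? (v * k + 1)

  -- For k ≤ w the prime u k + 1 could itself be a sieving prime. These k are left out of the sieve
  -- and counted trivially.
  large? : ∀ k → Dec (w < k × Pair k)
  large? k = w <? k ×-dec pair? k

  unhit : ∀ a k p → 1 ≤ a → w < k → Prime (a * k + 1) → p ≤ w → Prime p → hit a p k ≡ 0
  unhit a k p 1≤a w<k pk p≤w pp = 𝟙-no (p ∣? (a * k + 1)) (prime∤prime pp pk (<⇒≢ (begin-strict
    p ≤⟨ p≤w ⟩
    w <⟨ w<k ⟩
    k ≤⟨ m≤n*m k a {{>-nonZero 1≤a}} ⟩
    a * k ≤⟨ m≤m+n (a * k) 1 ⟩
    a * k + 1 ∎)))
    where open ≤-Reasoning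

  c : ℕ
  c = count bad w

  1≤z : 1 ≤ z
  1≤z = *-mono-≤ (m^n>0 2 t) (m^n>0 2 t)

  -- Each block 2 ^ i < n ≤ 2 ^ (i + 1) contributes at least 1 / 2.
  harmonic-lower : ∀ i → i ≤ t → i * inv 1 ≤ 2 * sumTo inv (2 ^ i)
  harmonic-lower zero _ = z≤n
  harmonic-lower (suc i) i<t = begin
    inv 1 + i * inv 1 ≤⟨ +-mono-≤ block (harmonic-lower i (<⇒≤ i<t)) ⟩
    2 * sumTo (λ j → inv (2 ^ i + j)) (2 ^ i) + 2 * sumTo inv (2 ^ i) ≡⟨ lem (sumTo (λ j → inv (2 ^ i + j)) (2 ^ i)) (sumTo inv (2 ^ i)) ⟩
    2 * (sumTo inv (2 ^ i) + sumTo (λ j → inv (2 ^ i + j)) (2 ^ i)) ≡⟨ cong (2 *_) (sum-add inv (2 ^ i) (2 ^ i)) ⟨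
    2 * sumTo inv (2 ^ i + 2 ^ i) ≡⟨ cong (λ x → 2 * sumTo inv (2 ^ i + x)) (+-identityʳ (2 ^ i)) ⟨
    2 * sumTo inv (2 ^ suc i) ∎
    where
    open ≤-Reasoning
    lem : ∀ x y → 2 * x + 2 * y ≡ 2 * (y + x)
    lem = solve-∀
    lem₂ : ∀ x y → x * (2 * y) ≡ 2 * x * y
    lem₂ = solve-∀
    2^i≤N : 2 ^ suc i ≤ N
    2^i≤N = ^-monoʳ-≤ 2 i<t
    inv1≡ : inv 1 ≡ N !
    inv1≡ = trans (sym (*-identityˡ (inv 1))) (*-inv 1 ≤-refl (m^n>0 2 t))
    block : inv 1 ≤ 2 * sumTo (λ j → inv (2 ^ i + j)) (2 ^ i)
    block = *-cancelˡ-≤ (2 ^ i) {{m^n≢0 2 i}} (begin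
      2 ^ i * inv 1 ≡⟨ sum-const (inv 1) (2 ^ i) ⟨
      sumTo (λ _ → inv 1) (2 ^ i) ≤⟨ sum-mono (2 ^ i) (λ j 1≤j j≤ → term j 1≤j j≤) ⟩
      sumTo (λ j → 2 ^ suc i * inv (2 ^ i + j)) (2 ^ i) ≡⟨ sum-*ˡ (2 ^ suc i) _ (2 ^ i) ⟩
      2 ^ suc i * sumTo (λ j → inv (2 ^ i + j)) (2 ^ i) ≡⟨ lem₂ (2 ^ i) _ ⟨
      2 ^ i * (2 * sumTo (λ j → inv (2 ^ i + j)) (2 ^ i)) ∎)
      where
      term : ∀ j → 1 ≤ j → j ≤ 2 ^ i → inv 1 ≤ 2 ^ suc i * inv (2 ^ i + j)
      term j 1≤j j≤ = ≤-trans (≤-reflexive (trans inv1≡ (sym (*-inv (2 ^ i + j) (≤-trans 1≤j (m≤n+m j _)) (≤-trans ≤2^ 2^i≤N))))) (*-monoˡ-≤ (inv (2 ^ i + j)) ≤2^)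
        where
        ≤2^ : 2 ^ i + j ≤ 2 ^ suc i
        ≤2^ = +-monoʳ-≤ (2 ^ i) (≤-trans j≤ (≤-reflexive (sym (+-identityʳ (2 ^ i)))))

  W₁t≤ : W₁ w * t ≤ 2 * (suc c * K w N)
  W₁t≤ = *-cancelʳ-≤ _ _ (inv 1) {{inv1≢0}} (begin
    W₁ w * t * inv 1 ≡⟨ *-assoc (W₁ w) t (inv 1) ⟩
    W₁ w * (t * inv 1) ≤⟨ *-monoʳ-≤ (W₁ w) (harmonic-lower t ≤-refl) ⟩
    W₁ w * (2 * sumTo inv N) ≡⟨ lem₁ (W₁ w) (sumTo inv N) ⟩
    2 * (W₁ w * sumTo inv N) ≤⟨ *-monoʳ-≤ 2 (harmonic-≤-K w N ≤-refl (≤-reflexive (*-identityˡ N))) ⟩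
    2 * (inv 1 * (suc c * K w N)) ≡⟨ lem₂ (inv 1) (suc c * K w N) ⟩
    2 * (suc c * K w N) * inv 1 ∎)
    where
    open ≤-Reasoning
    lem₁ : ∀ a b → a * (2 * b) ≡ 2 * (a * b)
    lem₁ = solve-∀
    lem₂ : ∀ a b → 2 * (a * b) ≡ 2 * b * a
    lem₂ = solve-∀
    inv1≢0 : NonZero (inv 1)
    inv1≢0 = subst NonZero (trans (sym (*-inv 1 ≤-refl (m^n>0 2 t))) (*-identityˡ (inv 1))) (N !≢0)

  -- By `Λ-lower`, Λ / W ≥ (K / W₁)², and K / W₁ is at least t / (2 (c + 1)) by comparison with the
  -- harmonic sum. The square reflects the two conditions of a prime pair.
  Wt²≤ : W w * (t * t) ≤ 4 * (suc c * suc c) * Λ w z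
  Wt²≤ = *-cancelʳ-≤ _ _ (W₁ w * W₁ w) {{>-nonZero (*-mono-≤ (1≤W₁ w) (1≤W₁ w))}} (begin
    W w * (t * t) * (W₁ w * W₁ w) ≡⟨ lem₁ (W w) t (W₁ w) ⟩
    W w * (W₁ w * t * (W₁ w * t)) ≤⟨ *-monoʳ-≤ (W w) (*-mono-≤ W₁t≤ W₁t≤) ⟩
    W w * (2 * (suc c * K w N) * (2 * (suc c * K w N))) ≡⟨ lem₂ (W w) (suc c) (K w N) ⟩
    4 * (suc c * suc c) * (W w * (K w N * K w N)) ≤⟨ *-monoʳ-≤ (4 * (suc c * suc c)) (Λ-lower w N N) ⟩
    4 * (suc c * suc c) * (Λ w z * (W₁ w * W₁ w)) ≡⟨ *-assoc (4 * (suc c * suc c)) (Λ w z) _ ⟨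
    4 * (suc c * suc c) * Λ w z * (W₁ w * W₁ w) ∎)
    where
    open ≤-Reasoning
    lem₁ : ∀ W t x → W * (t * t) * (x * x) ≡ W * (x * t * (x * t))
    lem₁ = solve-∀
    lem₂ : ∀ W c k → W * (2 * (c * k) * (2 * (c * k))) ≡ 4 * (c * c) * (W * (k * k))
    lem₂ = solve-∀

  R²≤ : R w z * R w z ≤ 4 * 2 ^ (16 * t)
  R²≤ = ≤-trans (*-mono-≤ (R≤2z⁴ w z) (R≤2z⁴ w z)) (≤-reflexive (trans (lem (2 ^ t)) (cong (4 *_) (trans (^-*-assoc 2 t 16) (cong (2 ^_) (*-comm t 16))))))
    where
    lem : ∀ x → 2 * ((x * x) * ((x * x) * ((x * x) * ((x * x) * 1)))) * (2 * ((x * x) * ((x * x) * ((x * x) * ((x * x) * 1)))))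
        ≡ 4 * (x * (x * (x * (x * (x * (x * (x * (x * (x * (x * (x * (x * (x * (x * (x * (x * 1))))))))))))))))
    lem = solve-∀

  -- The product of the bad primes is at least 2 ^ c and divides B ≤ 8 · 2 ^ (3 s).
  c≤ : suc c ≤ 3 * s + 4
  c≤ = ≤-trans (s≤s (2^-cancel-≤ c (3 * s + 3) (begin
    2 ^ c ≤⟨ primeProd-≥ bad id 2 w (λ p _ _ tp → prime⇒2≤ (proj₁ (toWitness tp))) ⟩
    primeProd bad id w ≤⟨ ∣⇒≤ {{>-nonZero 1≤B}} (primeProd∣ bad B (λ p tp → proj₁ (toWitness tp)) (λ p tp → proj₂ (toWitness tp)) w) ⟩
    6 * (u * v * d) ≤⟨ *-mono-≤ (m≤m+n 6 2) (*-mono-≤ (*-mono-≤ (≤-trans (m≤m+n u d) v≤2^s) v≤2^s) (≤-trans (m≤n+m d u) v≤2^s)) ⟩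
    8 * (2 ^ s * 2 ^ s * 2 ^ s) ≡⟨ lem (2 ^ s) ⟩
    2 ^ s * (2 ^ s * (2 ^ s * 1)) * 8 ≡⟨ cong (_* 8) (trans (^-*-assoc 2 s 3) (cong (2 ^_) (*-comm s 3))) ⟩
    2 ^ (3 * s) * 2 ^ 3 ≡⟨ ^-distribˡ-+-* 2 (3 * s) 3 ⟨
    2 ^ (3 * s + 3) ∎))) (≤-reflexive (sym (+-suc (3 * s) 3)))
    where
    open ≤-Reasoning
    1≤B : 1 ≤ B
    1≤B = *-mono-≤ {1} {6} (s≤s z≤n) (*-mono-≤ (*-mono-≤ 1≤u (≤-trans 1≤u (m≤m+n u d))) 1≤d)
    lem : ∀ x → 8 * (x * x * x) ≡ x * (x * (x * 1)) * 8
    lem = solve-∀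

  pair-bound : ∀ X → sumTo (λ k → 𝟙 (pair? k)) X * (t * t) ≤ 4 * ((3 * s + 4) * (3 * s + 4)) * (X + 4 * 2 ^ (16 * t)) + 2 ^ t * (t * t)
  pair-bound X = begin
    sumTo (λ k → 𝟙 (pair? k)) X * (t * t) ≤⟨ *-monoˡ-≤ (t * t) split ⟩
    (n + w) * (t * t) ≡⟨ *-distribʳ-+ (t * t) n w ⟩
    n * (t * t) + w * (t * t) ≤⟨ +-monoˡ-≤ (w * (t * t)) sifted ⟩
    4 * (suc c * suc c) * (X + R w z * R w z) + w * (t * t) ≤⟨ +-monoˡ-≤ (w * (t * t)) (*-mono-≤ (*-monoʳ-≤ 4 (*-mono-≤ c≤ c≤)) (+-monoʳ-≤ X R²≤)) ⟩
    4 * ((3 * s + 4) * (3 * s + 4)) * (X + 4 * 2 ^ (16 * t)) + 2 ^ t * (t * t) ∎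
    where
    open ≤-Reasoning
    n : ℕ
    n = sumTo (λ k → 𝟙 (large? k)) X
    split : sumTo (λ k → 𝟙 (pair? k)) X ≤ n + w
    split = ≤-trans (sum-mono X (λ k _ _ → pointwise k)) (≤-trans (≤-reflexive (sum-+ (λ k → 𝟙 (large? k)) (λ k → 𝟙 (k ≤? w)) X)) (+-monoʳ-≤ n (sum-below w X)))
      where
      pointwise : ∀ k → 𝟙 (pair? k) ≤ 𝟙 (large? k) + 𝟙 (k ≤? w)
      pointwise k = 𝟙-≤ (pair? k) λ pk → case k ≤? w of λ
        { (yes k≤w) → ≤-trans (≤-reflexive (sym (𝟙-yes (k ≤? w) k≤w))) (m≤n+m _ (𝟙 (large? k)))
        ; (no k≰w) → ≤-trans (≤-reflexive (sym (𝟙-yes (large? k) (≰⇒> k≰w , pk)))) (m≤m+n _ _) }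
    sieved : n * Λ w z ≤ W w * (X + R w z * R w z)
    sieved = sieve-bound large? w z X 1≤z (λ k (w<k , pu , pv) p p≤w gp →
      cong₂ _+_ (unhit u k p 1≤u w<k pu p≤w (g-prime p gp)) (unhit v k p (≤-trans 1≤u (m≤m+n u d)) w<k pv p≤w (g-prime p gp)))
    sifted : n * (t * t) ≤ 4 * (suc c * suc c) * (X + R w z * R w z)
    sifted = *-cancelʳ-≤ _ _ (W w) {{>-nonZero (1≤W w)}} (begin
      n * (t * t) * W w ≡⟨ lem₁ n (t * t) (W w) ⟩
      n * (W w * (t * t)) ≤⟨ *-monoʳ-≤ n Wt²≤ ⟩
      n * (4 * (suc c * suc c) * Λ w z) ≡⟨ lem₂ n (4 * (suc c * suc c)) (Λ w z) ⟩
      4 * (suc c * suc c) * (n * Λ w z) ≤⟨ *-monoʳ-≤ (4 * (suc c * suc c)) sieved ⟩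
      4 * (suc c * suc c) * (W w * (X + R w z * R w z)) ≡⟨ lem₃ (4 * (suc c * suc c)) (W w) (X + R w z * R w z) ⟩
      4 * (suc c * suc c) * (X + R w z * R w z) * W w ∎)
      where
      lem₁ : ∀ a b c → a * b * c ≡ a * (c * b)
      lem₁ = solve-∀
      lem₂ : ∀ a b c → a * (b * c) ≡ b * (a * c)
      lem₂ = solve-∀
      lem₃ : ∀ a b c → a * (b * c) ≡ a * c * b
      lem₃ = solve-∀

-- Products of a shifted prime and a totient

pair-bound : ∀ u v s t X → 1 ≤ u → 1 ≤ v → u ≢ v → u ≤ 2 ^ s → v ≤ 2 ^ s →
  sumTo (λ k → 𝟙 (prime? (u * k + 1) ×-dec prime? (v * k + 1))) X * (t * t) ≤
  4 * ((3 * s + 4) * (3 * s + 4)) * (X + 4 * 2 ^ (16 * t)) + 2 ^ t * (t * t)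
pair-bound u v s t X 1≤u 1≤v u≢v u≤ v≤ with ≤-total u v
... | inj₁ u≤v = subst (λ v → sumTo (λ k → 𝟙 (prime? (u * k + 1) ×-dec prime? (v * k + 1))) X * (t * t) ≤ _) (m+[n∸m]≡n u≤v)
  (PrimePairs.pair-bound u (v ∸ u) 1≤u (m<n⇒0<n∸m (≤∧≢⇒< u≤v u≢v)) s t (≤-trans (≤-reflexive (m+[n∸m]≡n u≤v)) v≤) X)
... | inj₂ v≤u = ≤-trans (*-monoˡ-≤ (t * t) (sum-mono X (λ k _ _ → 𝟙-mono (prime? (u * k + 1) ×-dec prime? (v * k + 1)) (prime? (v * k + 1) ×-dec prime? (u * k + 1)) (λ (p , q) → q , p))))
  (subst (λ u → sumTo (λ k → 𝟙 (prime? (v * k + 1) ×-dec prime? (u * k + 1))) X * (t * t) ≤ 4 * ((3 * s + 4) * (3 * s + 4)) * (X + 4 * 2 ^ (16 * t)) + 2 ^ t * (t * t)) (m+[n∸m]≡n v≤u)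
  (PrimePairs.pair-bound v (u ∸ v) 1≤v (m<n⇒0<n∸m (≤∧≢⇒< v≤u (u≢v ∘ sym))) s t (≤-trans (≤-reflexive (m+[n∸m]≡n v≤u)) u≤) X))

totient : ℕ → ℕ
totient m = 𝟙 (1 ≤? A m)

V≡sum : ∀ N → V N ≡ sumTo totient N
V≡sum = count≡sum _ (λ m → 1 ≤? A m) (λ m → <ᵇ⇒< 0 (A m)) (λ m → <⇒<ᵇ)

sum-positive : ∀ f n → 1 ≤ sumTo f n → ∃[ i ] (1 ≤ i × i ≤ n × 1 ≤ f i)
sum-positive f (suc n) h with f (suc n) in eq
... | suc _ = suc n , s≤s z≤n , ≤-refl , ≤-trans (s≤s z≤n) (≤-reflexive (sym eq))
... | zero with sum-positive f n h
...   | i , 1≤i , i≤n , q = i , 1≤i , m≤n⇒m≤1+n i≤n , q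

𝟙-positive : ∀ {a} {P : Set a} (d : Dec P) → 1 ≤ 𝟙 d → P
𝟙-positive (yes p) _ = p

1≤A⇒ : ∀ e → 1 ≤ A e → ∃[ n ] (1 ≤ n × n ≤ 2 * (e * e) × φ n ≡ e)
1≤A⇒ e h with sum-positive _ (2 * (e * e)) (≤-trans h (≤-reflexive (A≡sum e)))
... | n , 1≤n , n≤ , q = n , 1≤n , n≤ , 𝟙-positive (φ n ≟ e) q

⇒1≤A : ∀ n m → 1 ≤ n → φ n ≡ m → 1 ≤ A m
⇒1≤A n m 1≤n refl = ≤-trans (≤-reflexive (sym (𝟙-yes (φ n ≟ φ n) refl)))
  (≤-trans (sum-term (λ k → 𝟙 (φ k ≟ φ n)) (2 * (φ n * φ n)) n 1≤n (proj₁ (φ-bound n 1≤n))) (≤-reflexive (sym (A≡sum (φ n)))))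

-- Since e = φ n for some n ≤ 2 e² ≤ a, the prime a + 1 exceeds n and so does not divide it; then
-- φ((a + 1) n) = a e.
1≤A-* : ∀ a e → Prime (a + 1) → 1 ≤ A e → 2 * (e * e) ≤ a → 1 ≤ A (e * a)
1≤A-* a e pp he h with 1≤A⇒ e he
... | n , 1≤n , n≤ , refl = ⇒1≤A ((a + 1) * n) (φ n * a) (*-mono-≤ {1} {a + 1} (m≤n+m 1 a) 1≤n)
  (trans (φ-∤ pp (λ d → <⇒≱ (≤-trans (s≤s (≤-trans n≤ h)) (≤-reflexive (+-comm 1 a))) (∣⇒≤ {{>-nonZero 1≤n}} d)))
    (trans (cong (_* φ n) (m+n∸n≡m a 1)) (*-comm a (φ n))))

div : ℕ → ℕ → ℕ
div y zero = 0
div y (suc d) = y / suc d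

≤-div : ∀ j d y → 1 ≤ d → j * d ≤ y → j ≤ div y d
≤-div j (suc d) y _ h = ≤-trans (≤-reflexive (sym (m*n/n≡m j (suc d)))) (/-monoˡ-≤ (suc d) h)

-- The 2 ^ s quotients in a dyadic block beyond 2 ^ s are each at most y / 2 ^ s, so every block
-- costs at most y.
sum-div : ∀ y s → sumTo (div y) (2 ^ s) ≤ suc s * y
sum-div y zero = ≤-trans (≤-reflexive (+-identityʳ (y / 1))) (≤-trans (m/n≤m y 1) (≤-reflexive (sym (*-identityˡ y))))
sum-div y (suc s) = begin
  sumTo (div y) (2 ^ s + (2 ^ s + 0)) ≡⟨ cong (λ x → sumTo (div y) (2 ^ s + x)) (+-identityʳ (2 ^ s)) ⟩
  sumTo (div y) (2 ^ s + 2 ^ s) ≡⟨ sum-add (div y) (2 ^ s) (2 ^ s) ⟩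
  sumTo (div y) (2 ^ s) + sumTo (λ j → div y (2 ^ s + j)) (2 ^ s) ≤⟨ +-mono-≤ (sum-div y s) (sum-≤-const (div y (2 ^ s)) (2 ^ s) (λ j _ _ → antitone (2 ^ s) j (m^n>0 2 s))) ⟩
  suc s * y + 2 ^ s * div y (2 ^ s) ≤⟨ +-monoʳ-≤ (suc s * y) (*-div≤ (2 ^ s)) ⟩
  suc s * y + y ≡⟨ +-comm (suc s * y) y ⟩
  suc (suc s) * y ∎
  where
  open ≤-Reasoning
  antitone : ∀ d j → 1 ≤ d → div y (d + j) ≤ div y d
  antitone (suc d) j _ = /-monoʳ-≤ y (m≤m+n (suc d) j)
  *-div≤ : ∀ d → d * div y d ≤ y
  *-div≤ zero = z≤n
  *-div≤ (suc d) = ≤-trans (≤-reflexive (*-comm (suc d) _)) (m/n*n≤m y (suc d))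

gcd-split : ∀ e e′ → 1 ≤ e → ∃[ g ] ∃[ u ] ∃[ v ] (e ≡ g * u × e′ ≡ g * v × Coprime u v)
gcd-split e e′ 1≤e = gcd e e′ , e / gcd e e′ , e′ / gcd e e′ , sym (m*[n/m]≡n (gcd[m,n]∣m e e′)) , sym (m*[n/m]≡n (gcd[m,n]∣n e e′)) , coprime-/gcd e e′
  where
  instance
    _ : NonZero (gcd e e′)
    _ = ≢-nonZero (λ eq → <⇒≢ 1≤e (sym (gcd[m,n]≡0⇒m≡0 eq)))

coprime-cross : ∀ u v k k′ → 1 ≤ v → Coprime u v → u * k ≡ v * k′ → ∃[ j ] (k ≡ v * j × k′ ≡ u * j)
coprime-cross u v k k′ 1≤v cop eq with coprime-divisor {m = v} {n = u} (λ (a , b) → cop (b , a)) (divides k′ (trans eq (*-comm v k′)))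
... | divides j refl = j , *-comm j v , *-cancelˡ-≡ _ _ v {{>-nonZero 1≤v}} (trans (sym eq) (lem u j v))
  where
  lem : ∀ u j v → u * (j * v) ≡ v * (u * j)
  lem = solve-∀

-- Summed over M, this turns a bound on the sum of r(M)² into a lower bound for the number of M with r(M) ≥ 1.
double-≤ : ∀ r → 3 * r ≤ 2 * 𝟙 (1 ≤? r) + r * r
double-≤ 0 = z≤n
double-≤ 1 = ≤-refl
double-≤ 2 = ≤-refl
double-≤ (suc (suc (suc r))) = ≤-trans (*-monoˡ-≤ (3 + r) (m≤m+n 3 r)) (m≤n+m _ 2)

*-positive : ∀ x y → 1 ≤ x * y → 1 ≤ x × 1 ≤ y
*-positive (suc x) (suc y) _ = s≤s z≤n , s≤s z≤n
*-positive (suc x) zero h = contradiction (≤-trans h (≤-reflexive (*-zeroʳ x))) λ ()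

sum-collapse : ∀ (f h : ℕ → ℕ) n m → sumTo (λ e → sumTo (λ x → 𝟙 (f x ≟ e) * h x) n) m ≤ sumTo h n
sum-collapse f h n m = ≤-trans (≤-reflexive (sum-swap (λ e x → 𝟙 (f x ≟ e) * h x) m n)) (sum-mono n (λ x _ _ →
  ≤-trans (≤-reflexive (sum-*ʳ (h x) (λ e → 𝟙 (f x ≟ e)) m)) (≤-trans (*-monoˡ-≤ (h x) (sum-unique (f x ≟_) m (λ i j p q → trans (sym p) q))) (≤-reflexive (*-identityˡ (h x))))))

sum³ : (ℕ → ℕ → ℕ → ℕ) → ℕ → ℕ
sum³ f n = sumTo (λ g → sumTo (λ u → sumTo (λ v → f g u v) n) n) n

sum³-affine : ∀ (f : ℕ → ℕ → ℕ → ℕ) β k n → sum³ (λ g u v → β * f g u v + k) n ≡ β * sum³ f n + n * (n * (n * k))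
sum³-affine f β k n = trans (sum-cong n (λ g _ _ → trans (sum-cong n (λ u _ _ → affine (f g u) k)) (affine (λ u → sumTo (f g u) n) (n * k))))
  (affine (λ g → sumTo (λ u → sumTo (f g u) n) n) (n * (n * k)))
  where
  affine : ∀ (x : ℕ → ℕ) k → sumTo (λ v → β * x v + k) n ≡ β * sumTo x n + n * k
  affine x k = trans (sum-+ (λ v → β * x v) (λ _ → k) n) (cong₂ _+_ (sum-*ˡ β x n) (sum-const k n))

module Products (n s : ℕ) where

  E Y : ℕ
  E = 2 ^ s
  Y = 2 ^ n

  -- The threshold makes `1≤A-*` applicable with every e ≤ E.
  Big : ℕ → Set
  Big a = Prime (a + 1) × 2 * (E * E) ≤ a

  big? : ∀ a → Dec (Big a)
  big? a = prime? (a + 1) ×-dec 2 * (E * E) ≤? a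

  ρ : ℕ → ℕ → ℕ
  ρ M e = sumTo (λ a → 𝟙 (e * a ≟ M) * 𝟙 (big? a)) Y

  r : ℕ → ℕ
  r M = sumTo (λ e → totient e * ρ M e) E

  ρ≤1 : ∀ M e → 1 ≤ e → ρ M e ≤ 1
  ρ≤1 M e 1≤e = ≤-trans (sum-mono Y (λ a _ _ → ≤-trans (*-monoʳ-≤ (𝟙 (e * a ≟ M)) (𝟙≤1 (big? a))) (≤-reflexive (*-identityʳ _))))
    (sum-unique (λ a → e * a ≟ M) Y (λ i j p q → *-cancelˡ-≡ i j e {{>-nonZero 1≤e}} (trans p (sym q))))

  ρ-positive : ∀ M e → 1 ≤ ρ M e → ∃[ a ] (1 ≤ a × e * a ≡ M × Big a)
  ρ-positive M e h with sum-positive (λ a → 𝟙 (e * a ≟ M) * 𝟙 (big? a)) Y h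
  ... | a , 1≤a , _ , q with *-positive (𝟙 (e * a ≟ M)) (𝟙 (big? a)) q
  ...   | q₁ , q₂ = a , 1≤a , 𝟙-positive (e * a ≟ M) q₁ , 𝟙-positive (big? a) q₂

  r-totient : ∀ M → 𝟙 (1 ≤? r M) ≤ totient M
  r-totient M = 𝟙-mono (1 ≤? r M) (1 ≤? A M) go
    where
    go : 1 ≤ r M → 1 ≤ A M
    go h with sum-positive (λ e → totient e * ρ M e) E h
    ... | e , 1≤e , e≤E , q with *-positive (totient e) (ρ M e) q
    ...   | q₁ , q₂ with ρ-positive M e q₂
    ...     | a , _ , refl , pp , big = 1≤A-* a e pp (𝟙-positive (1 ≤? A e) q₁) (≤-trans (*-monoʳ-≤ 2 (*-mono-≤ e≤E e≤E)) big)

  common : ℕ → ℕ → ℕ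
  common e e′ = sumTo (λ M → ρ M e * ρ M e′) Y

  mass off : ℕ
  mass = sumTo r Y
  off = sumTo (λ e → sumTo (λ e′ → 𝟙 (¬? (e ≟ e′)) * common e e′) E) E

  r-square : ∀ M → r M * r M ≤ r M + sumTo (λ e → sumTo (λ e′ → 𝟙 (¬? (e ≟ e′)) * (ρ M e * ρ M e′)) E) E
  r-square M = begin
    r M * r M ≡⟨ sum-*ʳ (r M) x E ⟨
    sumTo (λ e → x e * r M) E ≤⟨ sum-mono E (λ e 1≤e _ → row e 1≤e) ⟩
    sumTo (λ e → x e + sumTo (λ e′ → 𝟙 (¬? (e ≟ e′)) * (ρ M e * ρ M e′)) E) E ≡⟨ sum-+ x _ E ⟩
    r M + sumTo (λ e → sumTo (λ e′ → 𝟙 (¬? (e ≟ e′)) * (ρ M e * ρ M e′)) E) E ∎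
    where
    open ≤-Reasoning
    x : ℕ → ℕ
    x e = totient e * ρ M e
    x≤ρ : ∀ e → x e ≤ ρ M e
    x≤ρ e = ≤-trans (*-monoˡ-≤ (ρ M e) (𝟙≤1 (1 ≤? A e))) (≤-reflexive (*-identityˡ (ρ M e)))
    entry : ∀ e e′ → 1 ≤ e → x e * x e′ ≤ 𝟙 (e ≟ e′) * x e + 𝟙 (¬? (e ≟ e′)) * (ρ M e * ρ M e′)
    entry e e′ 1≤e with e ≟ e′
    ... | yes refl = ≤-trans (*-monoʳ-≤ (x e) (≤-trans (x≤ρ e) (ρ≤1 M e 1≤e))) (≤-trans (≤-reflexive (*-comm (x e) 1)) (m≤m+n _ 0))
    ... | no _ = ≤-trans (*-mono-≤ (x≤ρ e) (x≤ρ e′)) (≤-reflexive (sym (*-identityˡ (ρ M e * ρ M e′))))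
    row : ∀ e → 1 ≤ e → x e * r M ≤ x e + sumTo (λ e′ → 𝟙 (¬? (e ≟ e′)) * (ρ M e * ρ M e′)) E
    row e 1≤e = begin
      x e * r M ≡⟨ sum-*ˡ (x e) x E ⟨
      sumTo (λ e′ → x e * x e′) E ≤⟨ sum-mono E (λ e′ _ _ → entry e e′ 1≤e) ⟩
      sumTo (λ e′ → 𝟙 (e ≟ e′) * x e + 𝟙 (¬? (e ≟ e′)) * (ρ M e * ρ M e′)) E ≡⟨ sum-+ (λ e′ → 𝟙 (e ≟ e′) * x e) _ E ⟩
      sumTo (λ e′ → 𝟙 (e ≟ e′) * x e) E + sumTo (λ e′ → 𝟙 (¬? (e ≟ e′)) * (ρ M e * ρ M e′)) E
        ≤⟨ +-monoˡ-≤ _ (≤-trans (≤-reflexive (sum-*ʳ (x e) (λ e′ → 𝟙 (e ≟ e′)) E)) (≤-trans (*-monoˡ-≤ (x e) (sum-unique (e ≟_) E (λ i j p q → trans (sym p) q))) (≤-reflexive (*-identityˡ (x e))))) ⟩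
      x e + sumTo (λ e′ → 𝟙 (¬? (e ≟ e′)) * (ρ M e * ρ M e′)) E ∎

  -- This is `double-≤` summed over M; the diagonal of the second moment cancels one of the three
  -- copies of `mass`.
  second-moment : 2 * mass ≤ 2 * V Y + off
  second-moment = +-cancelˡ-≤ mass _ _ (begin
    mass + 2 * mass ≡⟨⟩
    3 * mass ≡⟨ sum-*ˡ 3 r Y ⟨
    sumTo (λ M → 3 * r M) Y ≤⟨ sum-mono Y (λ M _ _ → ≤-trans (double-≤ (r M)) (+-mono-≤ (*-monoʳ-≤ 2 (r-totient M)) (r-square M))) ⟩
    sumTo (λ M → 2 * totient M + (r M + offM M)) Y ≡⟨ trans (sum-+ (λ M → 2 * totient M) (λ M → r M + offM M) Y) (cong₂ _+_ (sum-*ˡ 2 totient Y) (sum-+ r offM Y)) ⟩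
    2 * sumTo totient Y + (mass + sumTo offM Y) ≡⟨ cong₂ (λ x y → 2 * x + (mass + y)) (sym (V≡sum Y)) swapped ⟩
    2 * V Y + (mass + off) ≡⟨ lem (2 * V Y) mass off ⟩
    mass + (2 * V Y + off) ∎)
    where
    open ≤-Reasoning
    offM : ℕ → ℕ
    offM M = sumTo (λ e → sumTo (λ e′ → 𝟙 (¬? (e ≟ e′)) * (ρ M e * ρ M e′)) E) E
    lem : ∀ a b c → a + (b + c) ≡ b + (a + c)
    lem = solve-∀
    swapped : sumTo offM Y ≡ off
    swapped = trans (sum-swap (λ M e → sumTo (λ e′ → 𝟙 (¬? (e ≟ e′)) * (ρ M e * ρ M e′)) E) Y E)
      (sum-cong E (λ e _ _ → trans (sum-swap (λ M e′ → 𝟙 (¬? (e ≟ e′)) * (ρ M e * ρ M e′)) Y E)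
        (sum-cong E (λ e′ _ _ → sum-*ˡ (𝟙 (¬? (e ≟ e′))) (λ M → ρ M e * ρ M e′) Y))))

  -- The integer part of Y / (g u v), divided step by step so that `sum-div` applies to one variable
  -- at a time.
  X : ℕ → ℕ → ℕ → ℕ
  X g u v = div (div (div Y g) u) v

  Pair? : ∀ u v j → Dec (Prime (u * j + 1) × Prime (v * j + 1))
  Pair? u v j = prime? (u * j + 1) ×-dec prime? (v * j + 1)

  coincidences : ∀ g u v → 1 ≤ g → 1 ≤ u → 1 ≤ v → Coprime u v →
    common (g * u) (g * v) ≤ sumTo (λ j → 𝟙 (Pair? u v j)) (X g u v)
  coincidences g u v 1≤g 1≤u 1≤v cop = ≤-trans (sum-mono Y (λ M _ M≤Y → pointwise M M≤Y))
      (sum-collapse (λ j → g * u * (v * j)) (λ j → 𝟙 (Pair? u v j)) (X g u v) Y)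
    where
    h : ℕ → ℕ → ℕ
    h M j = 𝟙 (g * u * (v * j) ≟ M) * 𝟙 (Pair? u v j)
    1≤gu : 1 ≤ g * u
    1≤gu = *-mono-≤ 1≤g 1≤u
    1≤gv : 1 ≤ g * v
    1≤gv = *-mono-≤ 1≤g 1≤v
    pointwise : ∀ M → M ≤ Y → ρ M (g * u) * ρ M (g * v) ≤ sumTo (h M) (X g u v)
    pointwise M M≤Y with ρ M (g * u) * ρ M (g * v) in eq
    ... | zero = z≤n
    ... | suc x = ≤-trans (≤-trans (≤-reflexive (sym eq)) (*-mono-≤ (ρ≤1 M (g * u) 1≤gu) (ρ≤1 M (g * v) 1≤gv)))
      (witness (*-positive (ρ M (g * u)) (ρ M (g * v)) (≤-trans (s≤s z≤n) (≤-reflexive (sym eq)))))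
      where
      witness : 1 ≤ ρ M (g * u) × 1 ≤ ρ M (g * v) → 1 ≤ sumTo (h M) (X g u v)
      witness (q₁ , q₂) with ρ-positive M (g * u) q₁ | ρ-positive M (g * v) q₂
      ... | a , 1≤a , gua≡M , pa , _ | a′ , _ , gva′≡M , pa′ , _
        with coprime-cross u v a a′ 1≤v cop (*-cancelˡ-≡ _ _ g {{>-nonZero 1≤g}} (trans (sym (*-assoc g u a)) (trans gua≡M (trans (sym gva′≡M) (*-assoc g v a′)))))
      ... | zero , refl , refl = contradiction (≤-trans 1≤a (≤-reflexive (*-zeroʳ v))) λ ()
      ... | j@(suc _) , refl , refl = ≤-trans (≤-reflexive (sym (cong₂ _*_ (𝟙-yes (g * u * (v * j) ≟ M) gua≡M) (𝟙-yes (Pair? u v j) (pa′ , pa)))))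
            (sum-term (h M) (X g u v) j (s≤s z≤n) (≤-div j v _ 1≤v (≤-div (j * v) u _ 1≤u (≤-div (j * v * u) g Y 1≤g
              (≤-trans (≤-reflexive (trans (lem g u v j) gua≡M)) M≤Y)))))
        where
        lem : ∀ g u v j → j * v * u * g ≡ g * u * (v * j)
        lem = solve-∀

  module _ (t : ℕ) where

    β κ : ℕ
    β = 4 * ((3 * s + 4) * (3 * s + 4))
    κ = β * (4 * 2 ^ (16 * t)) + 2 ^ t * (t * t)

    bound : ℕ → ℕ → ℕ → ℕ
    bound g u v = β * X g u v + κ

    coincidences-≤ : ∀ g u v → 1 ≤ g → 1 ≤ u → 1 ≤ v → Coprime u v → u ≢ v → u ≤ E → v ≤ E →
      common (g * u) (g * v) * (t * t) ≤ bound g u v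
    coincidences-≤ g u v 1≤g 1≤u 1≤v cop u≢v u≤E v≤E = ≤-trans (*-monoˡ-≤ (t * t) (coincidences g u v 1≤g 1≤u 1≤v cop))
      (≤-trans (pair-bound u v s t (X g u v) 1≤u 1≤v u≢v u≤E v≤E) (≤-reflexive (lem β (X g u v) (4 * 2 ^ (16 * t)) (2 ^ t * (t * t)))))
      where
      lem : ∀ b x y z → b * (x + y) + z ≡ b * x + (b * y + z)
      lem = solve-∀

    spread : ℕ → ℕ → ℕ → ℕ
    spread e e′ g = sumTo (λ u → 𝟙 (g * u ≟ e) * sumTo (λ v → 𝟙 (g * v ≟ e′) * bound g u v) E) E

    off-entry : ∀ e e′ → 1 ≤ e → e ≤ E → 1 ≤ e′ → e′ ≤ E →
      𝟙 (¬? (e ≟ e′)) * common e e′ * (t * t) ≤ sumTo (spread e e′) E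
    off-entry e e′ 1≤e e≤E 1≤e′ e′≤E with e ≟ e′
    ... | yes _ = z≤n
    ... | no e≢e′ with gcd-split e e′ 1≤e
    ...   | g , u , v , refl , refl , cop = begin
      1 * D * (t * t) ≡⟨ cong (_* (t * t)) (*-identityˡ D) ⟩
      D * (t * t) ≤⟨ coincidences-≤ g u v 1≤g 1≤u 1≤v cop (λ u≡v → e≢e′ (cong (g *_) u≡v)) u≤E v≤E ⟩
      bound g u v ≡⟨ 𝟙*-≡ (g * v ≟ g * v) refl ⟨
      𝟙 (g * v ≟ g * v) * bound g u v ≤⟨ sum-term (λ v′ → 𝟙 (g * v′ ≟ g * v) * bound g u v′) E v 1≤v v≤E ⟩
      sumTo (λ v′ → 𝟙 (g * v′ ≟ g * v) * bound g u v′) E ≡⟨ 𝟙*-≡ (g * u ≟ g * u) refl ⟨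
      𝟙 (g * u ≟ g * u) * sumTo (λ v′ → 𝟙 (g * v′ ≟ g * v) * bound g u v′) E
        ≤⟨ sum-term (λ u′ → 𝟙 (g * u′ ≟ g * u) * sumTo (λ v′ → 𝟙 (g * v′ ≟ g * v) * bound g u′ v′) E) E u 1≤u u≤E ⟩
      spread (g * u) (g * v) g ≤⟨ sum-term (spread (g * u) (g * v)) E g 1≤g (≤-trans (m≤m*n g u {{>-nonZero 1≤u}}) e≤E) ⟩
      sumTo (spread (g * u) (g * v)) E ∎
      where
      open ≤-Reasoning
      D : ℕ
      D = common (g * u) (g * v)
      1≤g : 1 ≤ g
      1≤g = proj₁ (*-positive g u 1≤e)
      1≤u : 1 ≤ u
      1≤u = proj₂ (*-positive g u 1≤e)
      1≤v : 1 ≤ v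
      1≤v = proj₂ (*-positive g v 1≤e′)
      u≤E : u ≤ E
      u≤E = ≤-trans (m≤n*m u g {{>-nonZero 1≤g}}) e≤E
      v≤E : v ≤ E
      v≤E = ≤-trans (m≤n*m v g {{>-nonZero 1≤g}}) e′≤E

    sum-spread : ∀ g → sumTo (λ e → sumTo (λ e′ → spread e e′ g) E) E ≤ sumTo (λ u → sumTo (bound g u) E) E
    sum-spread g = begin
      sumTo (λ e → sumTo (λ e′ → spread e e′ g) E) E ≡⟨ sum-swap (λ e e′ → spread e e′ g) E E ⟩
      sumTo (λ e′ → sumTo (λ e → spread e e′ g) E) E ≤⟨ sum-mono E (λ e′ _ _ → sum-collapse (g *_) (λ u → sumTo (λ v → 𝟙 (g * v ≟ e′) * bound g u v) E) E E) ⟩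
      sumTo (λ e′ → sumTo (λ u → sumTo (λ v → 𝟙 (g * v ≟ e′) * bound g u v) E) E) E ≡⟨ sum-swap (λ e′ u → sumTo (λ v → 𝟙 (g * v ≟ e′) * bound g u v) E) E E ⟩
      sumTo (λ u → sumTo (λ e′ → sumTo (λ v → 𝟙 (g * v ≟ e′) * bound g u v) E) E) E ≤⟨ sum-mono E (λ u _ _ → sum-collapse (g *_) (bound g u) E E) ⟩
      sumTo (λ u → sumTo (bound g u) E) E ∎
      where open ≤-Reasoning

    sum³-X : sum³ X E ≤ suc s * (suc s * (suc s * Y))
    sum³-X = begin
      sum³ X E ≤⟨ sum-mono E (λ g _ _ → sum-mono E (λ u _ _ → sum-div (div (div Y g) u) s)) ⟩
      sumTo (λ g → sumTo (λ u → suc s * div (div Y g) u) E) E ≡⟨ sum-cong E (λ g _ _ → sum-*ˡ (suc s) (div (div Y g)) E) ⟩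
      sumTo (λ g → suc s * sumTo (div (div Y g)) E) E ≡⟨ sum-*ˡ (suc s) (λ g → sumTo (div (div Y g)) E) E ⟩
      suc s * sumTo (λ g → sumTo (div (div Y g)) E) E ≤⟨ *-monoʳ-≤ (suc s) (sum-mono E (λ g _ _ → sum-div (div Y g) s)) ⟩
      suc s * sumTo (λ g → suc s * div Y g) E ≡⟨ cong (suc s *_) (sum-*ˡ (suc s) (div Y) E) ⟩
      suc s * (suc s * sumTo (div Y) E) ≤⟨ *-monoʳ-≤ (suc s) (*-monoʳ-≤ (suc s) (sum-div Y s)) ⟩
      suc s * (suc s * (suc s * Y)) ∎
      where open ≤-Reasoning

    off-bound : off * (t * t) ≤ β * (suc s * (suc s * (suc s * Y))) + E * (E * (E * κ))
    off-bound = begin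
      off * (t * t) ≡⟨ trans (sym (sum-*ʳ (t * t) (λ e → sumTo (entry e) E) E)) (sum-cong E (λ e _ _ → sym (sum-*ʳ (t * t) (entry e) E))) ⟩
      sumTo (λ e → sumTo (λ e′ → entry e e′ * (t * t)) E) E ≤⟨ sum-mono E (λ e 1≤e e≤E → sum-mono E (λ e′ 1≤e′ e′≤E → off-entry e e′ 1≤e e≤E 1≤e′ e′≤E)) ⟩
      sumTo (λ e → sumTo (λ e′ → sumTo (spread e e′) E) E) E ≡⟨ trans (sum-cong E (λ e _ _ → sum-swap (λ e′ g → spread e e′ g) E E)) (sum-swap (λ e g → sumTo (λ e′ → spread e e′ g) E) E E) ⟩
      sumTo (λ g → sumTo (λ e → sumTo (λ e′ → spread e e′ g) E) E) E ≤⟨ sum-mono E (λ g _ _ → sum-spread g) ⟩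
      sum³ bound E ≡⟨ sum³-affine X β κ E ⟩
      β * sum³ X E + E * (E * (E * κ)) ≤⟨ +-monoˡ-≤ _ (*-monoʳ-≤ β sum³-X) ⟩
      β * (suc s * (suc s * (suc s * Y))) + E * (E * (E * κ)) ∎
      where
      open ≤-Reasoning
      entry : ℕ → ℕ → ℕ
      entry e e′ = 𝟙 (¬? (e ≟ e′)) * common e e′

-- weightedV i = Σ_{j<i} 2^(i−1−j) V(2^j), a dyadic form of 2^i Σ 1/m over the totients m < 2^i.
weightedV : ℕ → ℕ
weightedV zero = 0
weightedV (suc i) = 2 * weightedV i + V (2 ^ i)

1≤V : ∀ i → 1 ≤ V (2 ^ i)
1≤V i = ≤-trans (≤-trans (≤-reflexive (sym (𝟙-yes (1 ≤? A 1) (⇒1≤A 1 1 ≤-refl refl)))) (sum-term totient (2 ^ i) 1 ≤-refl (m^n>0 2 i))) (≤-reflexive (sym (V≡sum (2 ^ i))))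

2^≤1+weightedV : ∀ i → 2 ^ i ≤ 1 + weightedV i
2^≤1+weightedV zero = ≤-refl
2^≤1+weightedV (suc i) = begin
  2 * 2 ^ i ≤⟨ *-monoʳ-≤ 2 (2^≤1+weightedV i) ⟩
  2 * (1 + weightedV i) ≡⟨ lem (weightedV i) ⟩
  1 + (2 * weightedV i + 1) ≤⟨ +-monoʳ-≤ 1 (+-monoʳ-≤ (2 * weightedV i) (1≤V i)) ⟩
  1 + (2 * weightedV i + V (2 ^ i)) ∎
  where
  open ≤-Reasoning
  lem : ∀ x → 2 * (1 + x) ≡ 1 + (2 * x + 1)
  lem = solve-∀

-- By `room`, the numbers below 2 E² that `Big` excludes are few beside 2 ^ (n - s) / n, so
-- Chebyshev's lower bound survives on all ranges 2 ^ (n - i) with i ≤ s.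
module Mass (n s : ℕ) (s≤n : s ≤ n) (room : 2 * (n * (2 * (2 ^ s * 2 ^ s)) + 1) ≤ 2 ^ (n ∸ s)) where

  open Products n s

  Q : ℕ → ℕ
  Q j = sumTo (λ a → 𝟙 (big? a)) (2 ^ j)

  π≤Q : ∀ j → π (2 ^ j) ≤ Q j + 2 * (E * E)
  π≤Q j = begin
    π (2 ^ j) ≡⟨ count≡sum isPrime prime? (λ p → toWitness) (λ p → fromWitness) (2 ^ j) ⟩
    sumTo (λ p → 𝟙 (prime? p)) (2 ^ j) ≤⟨ shift (2 ^ j) ⟩
    sumTo (λ a → 𝟙 (prime? (a + 1))) (2 ^ j) ≤⟨ sum-mono (2 ^ j) (λ a _ _ → pointwise a) ⟩
    sumTo (λ a → 𝟙 (big? a) + 𝟙 (a ≤? 2 * (E * E))) (2 ^ j) ≡⟨ sum-+ (λ a → 𝟙 (big? a)) _ (2 ^ j) ⟩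
    Q j + sumTo (λ a → 𝟙 (a ≤? 2 * (E * E))) (2 ^ j) ≤⟨ +-monoʳ-≤ (Q j) (sum-below (2 * (E * E)) (2 ^ j)) ⟩
    Q j + 2 * (E * E) ∎
    where
    open ≤-Reasoning
    shift : ∀ N → sumTo (λ p → 𝟙 (prime? p)) N ≤ sumTo (λ a → 𝟙 (prime? (a + 1))) N
    shift zero = z≤n
    shift (suc N) = begin
      sumTo (λ p → 𝟙 (prime? p)) (suc N) ≡⟨ sum-suc (λ p → 𝟙 (prime? p)) N ⟩
      𝟙 (prime? 1) + sumTo (λ a → 𝟙 (prime? (suc a))) N ≡⟨ sum-cong N (λ a _ _ → cong (λ x → 𝟙 (prime? x)) (+-comm 1 a)) ⟩
      sumTo (λ a → 𝟙 (prime? (a + 1))) N ≤⟨ m≤n+m _ _ ⟩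
      sumTo (λ a → 𝟙 (prime? (a + 1))) (suc N) ∎
    pointwise : ∀ a → 𝟙 (prime? (a + 1)) ≤ 𝟙 (big? a) + 𝟙 (a ≤? 2 * (E * E))
    pointwise a = 𝟙-≤ (prime? (a + 1)) λ pa → case ≤-total a (2 * (E * E)) of λ
      { (inj₁ a≤) → ≤-trans (≤-reflexive (sym (𝟙-yes (a ≤? 2 * (E * E)) a≤))) (m≤n+m _ (𝟙 (big? a)))
      ; (inj₂ ≤a) → ≤-trans (≤-reflexive (sym (𝟙-yes (big? a) (pa , ≤a)))) (m≤m+n _ _) }

  Q-lower : ∀ j → n ∸ s ≤ j → j ≤ n → 2 ^ j ≤ 2 * n * Q j
  Q-lower j n-s≤j j≤n = +-cancelʳ-≤ (2 ^ j) _ _ (begin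
    2 ^ j + 2 ^ j ≡⟨ cong (2 ^ j +_) (+-identityʳ (2 ^ j)) ⟨
    2 * 2 ^ j ≤⟨ *-monoʳ-≤ 2 (chebyshev-lower j) ⟩
    2 * (j * π (2 ^ j) + 1) ≤⟨ *-monoʳ-≤ 2 (+-monoˡ-≤ 1 (*-mono-≤ j≤n (π≤Q j))) ⟩
    2 * (n * (Q j + 2 * (E * E)) + 1) ≡⟨ lem n (Q j) (2 * (E * E)) ⟩
    2 * n * Q j + 2 * (n * (2 * (E * E)) + 1) ≤⟨ +-monoʳ-≤ (2 * n * Q j) (≤-trans room (^-monoʳ-≤ 2 n-s≤j)) ⟩
    2 * n * Q j + 2 ^ j ∎)
    where
    open ≤-Reasoning
    lem : ∀ n q x → 2 * (n * (q + x) + 1) ≡ 2 * n * q + 2 * (n * x + 1)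
    lem = solve-∀

  c : ℕ → ℕ
  c e = sumTo (λ a → 𝟙 (e * a ≤? Y) * 𝟙 (big? a)) Y

  c-lower : ∀ i e → i ≤ n → e ≤ 2 ^ i → Q (n ∸ i) ≤ c e
  c-lower i e i≤n e≤ = ≤-trans (sum-mono (2 ^ (n ∸ i)) (λ a _ a≤ → ≤-reflexive (sym (𝟙*-≡ (e * a ≤? Y)
      (≤-trans (*-mono-≤ e≤ a≤) (≤-reflexive (trans (sym (^-distribˡ-+-* 2 i (n ∸ i))) (cong (2 ^_) (m+[n∸m]≡n i≤n)))))))))
    (sum-monoʳ (λ a → 𝟙 (e * a ≤? Y) * 𝟙 (big? a)) (^-monoʳ-≤ 2 (m∸n≤m n i)))

  F : ℕ → ℕ
  F = sumTo (λ e → totient e * c e)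

  F≤mass : F E ≤ mass
  F≤mass = begin
    F E ≤⟨ sum-mono E (λ e 1≤e _ → *-monoʳ-≤ (totient e) (c≤ e 1≤e)) ⟩
    sumTo (λ e → totient e * sumTo (λ M → ρ M e) Y) E ≡⟨ sum-cong E (λ e _ _ → sym (sum-*ˡ (totient e) (λ M → ρ M e) Y)) ⟩
    sumTo (λ e → sumTo (λ M → totient e * ρ M e) Y) E ≡⟨ sum-swap (λ e M → totient e * ρ M e) E Y ⟩
    mass ∎
    where
    open ≤-Reasoning
    c≤ : ∀ e → 1 ≤ e → c e ≤ sumTo (λ M → ρ M e) Y
    c≤ e 1≤e = begin
      c e ≤⟨ sum-mono Y (λ a 1≤a _ → *-monoˡ-≤ (𝟙 (big? a)) (𝟙-≤ (e * a ≤? Y) (λ h → ≤-trans (≤-reflexive (sym (𝟙-yes (e * a ≟ e * a) refl)))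
               (sum-term (λ M → 𝟙 (e * a ≟ M)) Y (e * a) (*-mono-≤ 1≤e 1≤a) h)))) ⟩
      sumTo (λ a → sumTo (λ M → 𝟙 (e * a ≟ M)) Y * 𝟙 (big? a)) Y ≡⟨ sum-cong Y (λ a _ _ → sym (sum-*ʳ (𝟙 (big? a)) (λ M → 𝟙 (e * a ≟ M)) Y)) ⟩
      sumTo (λ a → sumTo (λ M → 𝟙 (e * a ≟ M) * 𝟙 (big? a)) Y) Y ≡⟨ sum-swap (λ a M → 𝟙 (e * a ≟ M) * 𝟙 (big? a)) Y Y ⟩
      sumTo (λ M → ρ M e) Y ∎

  -- Partial summation: (V(2 ^ i) + weightedV i) / 2 ^ i is the sum over the totients e ≤ 2 ^ i of
  -- the reciprocal of the least power of 2 not below e. A totient in the newest block 2 ^ i < e ≤ 2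
  -- ^ (i + 1) has at least Q(n - i - 1) admissible partners a.
  F-lower : ∀ i → i ≤ s → 2 ^ n * (V (2 ^ i) + weightedV i) ≤ 2 * n * F (2 ^ i) * 2 ^ i
  F-lower zero _ = begin
    2 ^ n * (V 1 + 0) ≡⟨ cong (2 ^ n *_) (trans (+-identityʳ (V 1)) (V≡sum 1)) ⟩
    2 ^ n * (totient 1 + 0) ≤⟨ *-monoˡ-≤ (totient 1 + 0) (Q-lower n (m∸n≤m n s) ≤-refl) ⟩
    2 * n * Q n * (totient 1 + 0) ≤⟨ *-monoˡ-≤ (totient 1 + 0) (*-monoʳ-≤ (2 * n) (c-lower 0 1 z≤n ≤-refl)) ⟩
    2 * n * c 1 * (totient 1 + 0) ≡⟨ lem (2 * n) (c 1) (totient 1) ⟩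
    2 * n * (totient 1 * c 1 + 0) * 1 ∎
    where
    open ≤-Reasoning
    lem : ∀ m c t → m * c * (t + 0) ≡ m * (t * c + 0) * 1
    lem = solve-∀
  F-lower (suc i) i<s = begin
    2 ^ n * (V (2 ^ suc i) + (2 * weightedV i + V (2 ^ i))) ≡⟨ cong (λ x → 2 ^ n * (x + (2 * weightedV i + V (2 ^ i)))) V-split ⟩
    2 ^ n * (V (2 ^ i) + Δ + (2 * weightedV i + V (2 ^ i))) ≡⟨ lem₁ (2 ^ n) (V (2 ^ i)) Δ (weightedV i) ⟩
    2 * (2 ^ n * (V (2 ^ i) + weightedV i)) + 2 ^ n * Δ ≤⟨ +-mono-≤ (*-monoʳ-≤ 2 (F-lower i (<⇒≤ i<s))) (*-monoˡ-≤ Δ pow) ⟩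
    2 * (2 * n * F (2 ^ i) * 2 ^ i) + 2 ^ suc i * (2 * n * Q (n ∸ suc i)) * Δ ≤⟨ +-monoʳ-≤ _ (≤-trans (≤-reflexive (lem₂ (2 ^ suc i) (2 * n) (Q (n ∸ suc i)) Δ)) (*-monoʳ-≤ (2 ^ suc i * (2 * n)) block)) ⟩
    2 * (2 * n * F (2 ^ i) * 2 ^ i) + 2 ^ suc i * (2 * n) * sumTo (λ j → totient (2 ^ i + j) * c (2 ^ i + j)) (2 ^ i) ≡⟨ lem₃ (2 * n) (F (2 ^ i)) (2 ^ i) _ ⟩
    2 * n * (F (2 ^ i) + sumTo (λ j → totient (2 ^ i + j) * c (2 ^ i + j)) (2 ^ i)) * 2 ^ suc i ≡⟨ cong (λ x → 2 * n * x * 2 ^ suc i) (F-split (λ e → totient e * c e)) ⟨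
    2 * n * F (2 ^ suc i) * 2 ^ suc i ∎
    where
    open ≤-Reasoning
    Δ : ℕ
    Δ = sumTo (λ j → totient (2 ^ i + j)) (2 ^ i)
    F-split : ∀ f → sumTo f (2 ^ suc i) ≡ sumTo f (2 ^ i) + sumTo (λ j → f (2 ^ i + j)) (2 ^ i)
    F-split f = trans (cong (λ x → sumTo f (2 ^ i + x)) (+-identityʳ (2 ^ i))) (sum-add f (2 ^ i) (2 ^ i))
    V-split : V (2 ^ suc i) ≡ V (2 ^ i) + Δ
    V-split = trans (V≡sum (2 ^ suc i)) (trans (F-split totient) (cong (_+ Δ) (sym (V≡sum (2 ^ i)))))
    lem₁ : ∀ x v d g → x * (v + d + (2 * g + v)) ≡ 2 * (x * (v + g)) + x * d
    lem₁ = solve-∀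
    lem₂ : ∀ a b q d → a * (b * q) * d ≡ a * b * (d * q)
    lem₂ = solve-∀
    lem₃ : ∀ m f x y → 2 * (m * f * x) + 2 * x * m * y ≡ m * (f + y) * (2 * x)
    lem₃ = solve-∀
    i<n : suc i ≤ n
    i<n = ≤-trans i<s s≤n
    pow : 2 ^ n ≤ 2 ^ suc i * (2 * n * Q (n ∸ suc i))
    pow = begin
      2 ^ n ≡⟨ cong (2 ^_) (m+[n∸m]≡n i<n) ⟨
      2 ^ (suc i + (n ∸ suc i)) ≡⟨ ^-distribˡ-+-* 2 (suc i) (n ∸ suc i) ⟩
      2 ^ suc i * 2 ^ (n ∸ suc i) ≤⟨ *-monoʳ-≤ (2 ^ suc i) (Q-lower (n ∸ suc i) (∸-monoʳ-≤ n i<s) (m∸n≤m n (suc i))) ⟩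
      2 ^ suc i * (2 * n * Q (n ∸ suc i)) ∎
    block : Δ * Q (n ∸ suc i) ≤ sumTo (λ j → totient (2 ^ i + j) * c (2 ^ i + j)) (2 ^ i)
    block = ≤-trans (≤-reflexive (sym (sum-*ʳ (Q (n ∸ suc i)) (λ j → totient (2 ^ i + j)) (2 ^ i))))
      (sum-mono (2 ^ i) (λ j _ j≤ → *-monoʳ-≤ (totient (2 ^ i + j)) (c-lower (suc i) (2 ^ i + j) i<n
        (+-monoʳ-≤ (2 ^ i) (≤-trans j≤ (≤-reflexive (sym (+-identityʳ (2 ^ i)))))))))

  -- The totient 1 alone yields mass ≥ 2 ^ n / (2 n) ≥ off, so `second-moment` becomes mass ≤ 2 V.
  V-lower : off * (2 * n) ≤ 2 ^ n → 1 ≤ n → 2 ^ n * weightedV s ≤ 4 * n * V (2 ^ n) * 2 ^ s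
  V-lower off≤ 1≤n = begin
    2 ^ n * weightedV s ≤⟨ *-monoʳ-≤ (2 ^ n) (m≤n+m (weightedV s) (V E)) ⟩
    2 ^ n * (V E + weightedV s) ≤⟨ mass-lower ⟩
    2 * n * mass * E ≤⟨ *-monoˡ-≤ E (*-monoʳ-≤ (2 * n) mass≤2V) ⟩
    2 * n * (2 * V Y) * E ≡⟨ lem n (V Y) E ⟩
    4 * n * V Y * E ∎
    where
    open ≤-Reasoning
    lem : ∀ n v e → 2 * n * (2 * v) * e ≡ 4 * n * v * e
    lem = solve-∀
    mass-lower : 2 ^ n * (V E + weightedV s) ≤ 2 * n * mass * E
    mass-lower = ≤-trans (F-lower s ≤-refl) (*-monoˡ-≤ E (*-monoʳ-≤ (2 * n) F≤mass))
    2^n≤mass : 2 ^ n ≤ 2 * n * mass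
    2^n≤mass = *-cancelʳ-≤ (2 ^ n) _ E {{m^n≢0 2 s}} (≤-trans (*-monoʳ-≤ (2 ^ n) (≤-trans (2^≤1+weightedV s) (+-monoˡ-≤ (weightedV s) (1≤V s)))) mass-lower)
    off≤mass : off ≤ mass
    off≤mass = *-cancelʳ-≤ off mass (2 * n) {{>-nonZero (*-mono-≤ {1} {2} (s≤s z≤n) 1≤n)}} (≤-trans off≤ (≤-trans 2^n≤mass (≤-reflexive (*-comm (2 * n) mass))))
    mass≤2V : mass ≤ 2 * V Y
    mass≤2V = +-cancelʳ-≤ mass _ _ (begin
      mass + mass ≡⟨ cong (mass +_) (+-identityʳ mass) ⟨
      2 * mass ≤⟨ second-moment ⟩
      2 * V Y + off ≤⟨ +-monoʳ-≤ (2 * V Y) off≤mass ⟩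
      2 * V Y + mass ∎)

-- The sieve remainder costs about E ^ 3 2 ^ (16 t), and t = n / 32 keeps this near the square root
-- of Y. The main part of `off` has order s ^ 5 Y / t² and must stay below Y / (2 n), so n has to
-- exceed a constant times s ^ 5. Three spare factors s ≥ 256 in s ^ 8 pay for that constant.
module Parameters (n s : ℕ) (256≤s : 256 ≤ s) (s^8≤n : s ^ 8 ≤ n) where

  open ≤-Reasoning

  t E Y : ℕ
  t = n / 32
  E = 2 ^ s
  Y = 2 ^ n

  1≤s : 1 ≤ s
  1≤s = ≤-trans (m≤m+n 1 255) 256≤s

  12s+36≤n : 12 * s + 36 ≤ n
  12s+36≤n = begin
    12 * s + 36 ≤⟨ +-monoʳ-≤ (12 * s) (≤-trans (m≤m+n 36 220) 256≤s) ⟩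
    12 * s + s ≡⟨ +-comm (12 * s) s ⟩
    13 * s ≤⟨ *-monoˡ-≤ s (≤-trans (m≤m+n 13 243) 256≤s) ⟩
    s * s ≤⟨ *-monoʳ-≤ s (m≤m*n s (s ^ 6) {{>-nonZero (1≤m^n s 6 1≤s)}}) ⟩
    s ^ 8 ≤⟨ s^8≤n ⟩
    n ∎

  32t≤n : t * 32 ≤ n
  32t≤n = m/n*n≤m n 32

  n≤64t : n ≤ 64 * t
  n≤64t = begin
    n ≡⟨ m≡m%n+[m/n]*n n 32 ⟩
    n % 32 + t * 32 ≤⟨ +-monoˡ-≤ (t * 32) (≤-trans (m%n≤n n 32) (m≤n*m 32 t {{>-nonZero 1≤t}})) ⟩
    t * 32 + t * 32 ≡⟨ *-distribˡ-+ t 32 32 ⟨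
    t * 64 ≡⟨ *-comm t 64 ⟩
    64 * t ∎
    where
    1≤t : 1 ≤ t
    1≤t = m≥n⇒m/n>0 {n} {32} (≤-trans (≤-trans (m≤m+n 32 4) (m≤n+m 36 (12 * s))) 12s+36≤n)

  3s+9≤16t : 3 * s + 9 ≤ 16 * t
  3s+9≤16t = *-cancelˡ-≤ 4 (begin
    4 * (3 * s + 9) ≡⟨ trans (*-distribˡ-+ 4 (3 * s) 9) (cong (_+ 36) (sym (*-assoc 4 3 s))) ⟩
    12 * s + 36 ≤⟨ 12s+36≤n ⟩
    n ≤⟨ n≤64t ⟩
    64 * t ≡⟨ *-assoc 4 16 t ⟩
    4 * (16 * t) ∎)

  exponent : ∀ x → x ≤ 16 * t → 3 * s + 9 + x ≤ n
  exponent x x≤ = begin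
    3 * s + 9 + x ≤⟨ +-mono-≤ 3s+9≤16t x≤ ⟩
    16 * t + 16 * t ≡⟨ *-distribʳ-+ t 16 16 ⟨
    32 * t ≡⟨ *-comm 32 t ⟩
    t * 32 ≤⟨ 32t≤n ⟩
    n ∎

  t≤16t : t ≤ 16 * t
  t≤16t = m≤n*m t 16

  2t≤16t : t + t ≤ 16 * t
  2t≤16t = ≤-trans (≤-reflexive (cong (t +_) (sym (+-identityʳ t)))) (*-monoˡ-≤ t (m≤m+n 2 14))

  E³2^x≤Y : ∀ k x → k ≤ 9 → x ≤ 16 * t → E * (E * (E * (2 ^ k * 2 ^ x))) ≤ Y
  E³2^x≤Y k x k≤9 x≤ = begin
    E * (E * (E * (2 ^ k * 2 ^ x))) ≡⟨ lem E (2 ^ k) (2 ^ x) ⟩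
    E * (E * (E * 1)) * 2 ^ k * 2 ^ x ≡⟨ cong (λ y → y * 2 ^ k * 2 ^ x) (trans (^-*-assoc 2 s 3) (cong (2 ^_) (*-comm s 3))) ⟩
    2 ^ (3 * s) * 2 ^ k * 2 ^ x ≡⟨ trans (^-distribˡ-+-* 2 (3 * s + k) x) (cong (_* 2 ^ x) (^-distribˡ-+-* 2 (3 * s) k)) ⟨
    2 ^ (3 * s + k + x) ≤⟨ ^-monoʳ-≤ 2 (≤-trans (+-monoˡ-≤ x (+-monoʳ-≤ (3 * s) k≤9)) (exponent x x≤)) ⟩
    2 ^ n ∎
    where
    lem : ∀ e y z → e * (e * (e * (y * z))) ≡ e * (e * (e * 1)) * y * z
    lem = solve-∀

  s≤n : s ≤ n
  s≤n = ≤-trans (≤-trans (m≤n*m s 12) (m≤m+n (12 * s) 36)) 12s+36≤n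

  1≤n : 1 ≤ n
  1≤n = ≤-trans 1≤s s≤n

  room : 2 * (n * (2 * (E * E)) + 1) ≤ 2 ^ (n ∸ s)
  room = *-cancelˡ-≤ E {{m^n≢0 2 s}} (begin
    E * (2 * (n * (2 * (E * E)) + 1)) ≤⟨ *-monoʳ-≤ E (*-monoʳ-≤ 2 (+-monoʳ-≤ (n * (2 * (E * E))) 1≤)) ⟩
    E * (2 * (n * (2 * (E * E)) + n * (2 * (E * E)))) ≡⟨ lem₁ E n ⟩
    E * (E * (E * (8 * n))) ≤⟨ *-monoʳ-≤ E (*-monoʳ-≤ E (*-monoʳ-≤ E (≤-trans (*-monoʳ-≤ 8 (≤-trans n≤64t (*-monoʳ-≤ 64 (<⇒≤ (n<2^n t))))) (≤-reflexive (sym (*-assoc 8 64 (2 ^ t))))))) ⟩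
    E * (E * (E * (2 ^ 9 * 2 ^ t))) ≤⟨ E³2^x≤Y 9 t ≤-refl t≤16t ⟩
    2 ^ n ≡⟨ cong (2 ^_) (m+[n∸m]≡n s≤n) ⟨
    2 ^ (s + (n ∸ s)) ≡⟨ ^-distribˡ-+-* 2 s (n ∸ s) ⟩
    E * 2 ^ (n ∸ s) ∎)
    where
    1≤ : 1 ≤ n * (2 * (E * E))
    1≤ = *-mono-≤ 1≤n (*-mono-≤ {1} {2} (s≤s z≤n) (*-mono-≤ (m^n>0 2 s) (m^n>0 2 s)))
    lem₁ : ∀ e n → e * (2 * (n * (2 * (e * e)) + n * (2 * (e * e)))) ≡ e * (e * (e * (8 * n)))
    lem₁ = solve-∀

  open Products n s using (off; off-bound; β; κ)

  polynomial : β t * (suc s * (suc s * suc s)) + β t + 1 ≤ 2048 * s ^ 5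
  polynomial = begin
    4 * ((3 * s + 4) * (3 * s + 4)) * (suc s * (suc s * suc s)) + 4 * ((3 * s + 4) * (3 * s + 4)) + 1
      ≤⟨ +-mono-≤ (+-mono-≤ (*-mono-≤ b≤ (*-mono-≤ s+1≤ (*-mono-≤ s+1≤ s+1≤))) (≤-trans b≤ (m≤m*n _ (s * (s * s)) {{>-nonZero (*-mono-≤ 1≤s (*-mono-≤ 1≤s 1≤s))}}))) (1≤m^n s 5 1≤s) ⟩
    4 * (7 * s * (7 * s)) * (2 * s * (2 * s * (2 * s))) + 4 * (7 * s * (7 * s)) * (s * (s * s)) + s ^ 5 ≡⟨ lem s ⟩
    (4 * (7 * 7) * (2 * (2 * 2) + 1) + 1) * s ^ 5 ≤⟨ *-monoˡ-≤ (s ^ 5) (m≤m+n 1765 283) ⟩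
    2048 * s ^ 5 ∎
    where
    lem : ∀ s → 4 * (7 * s * (7 * s)) * (2 * s * (2 * s * (2 * s))) + 4 * (7 * s * (7 * s)) * (s * (s * s)) + s * (s * (s * (s * (s * 1)))) ≡
          (4 * (7 * 7) * (2 * (2 * 2) + 1) + 1) * (s * (s * (s * (s * (s * 1)))))
    lem = solve-∀
    s+1≤ : suc s ≤ 2 * s
    s+1≤ = ≤-trans (≤-reflexive (+-comm 1 s)) (≤-trans (+-monoʳ-≤ s 1≤s) (≤-reflexive (cong (s +_) (sym (+-identityʳ s)))))
    b≤ : 4 * ((3 * s + 4) * (3 * s + 4)) ≤ 4 * (7 * s * (7 * s))
    b≤ = *-monoʳ-≤ 4 (*-mono-≤ 7s 7s)
      where
      7s : 3 * s + 4 ≤ 7 * s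
      7s = ≤-trans (+-monoʳ-≤ (3 * s) (≤-trans (≤-reflexive (sym (*-identityʳ 4))) (*-monoʳ-≤ 4 1≤s))) (≤-reflexive (sym (*-distribʳ-+ s 3 4)))

  off-t² : off * (t * t) ≤ 2048 * s ^ 5 * Y
  off-t² = begin
    off * (t * t) ≤⟨ off-bound t ⟩
    β t * (suc s * (suc s * (suc s * Y))) + E * (E * (E * κ t)) ≡⟨ lem₁ (β t) (suc s) Y E (2 ^ (16 * t)) (2 ^ t) t ⟩
    β t * (suc s * (suc s * suc s)) * Y + β t * (E * (E * (E * (4 * 2 ^ (16 * t))))) + E * (E * (E * (2 ^ t * (t * t))))
      ≤⟨ +-mono-≤ (+-monoʳ-≤ (β t * (suc s * (suc s * suc s)) * Y) (*-monoʳ-≤ (β t) (E³2^x≤Y 2 (16 * t) (m≤m+n 2 7) ≤-refl)))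
           (≤-trans (*-monoʳ-≤ E (*-monoʳ-≤ E (*-monoʳ-≤ E t²≤))) (E³2^x≤Y 1 (t + t) (m≤m+n 1 8) 2t≤16t)) ⟩
    β t * (suc s * (suc s * suc s)) * Y + β t * Y + Y ≡⟨ lem₂ (β t * (suc s * (suc s * suc s))) (β t) Y ⟩
    (β t * (suc s * (suc s * suc s)) + β t + 1) * Y ≤⟨ *-monoˡ-≤ Y polynomial ⟩
    2048 * s ^ 5 * Y ∎
    where
    lem₁ : ∀ b x Y E p q t → b * (x * (x * (x * Y))) + E * (E * (E * (b * (4 * p) + q * (t * t)))) ≡
           b * (x * (x * x)) * Y + b * (E * (E * (E * (4 * p)))) + E * (E * (E * (q * (t * t))))
    lem₁ = solve-∀
    lem₂ : ∀ x b y → x * y + b * y + y ≡ (x + b + 1) * y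
    lem₂ = solve-∀
    t²≤ : 2 ^ t * (t * t) ≤ 2 ^ 1 * 2 ^ (t + t)
    t²≤ = ≤-trans (*-monoʳ-≤ (2 ^ t) (h*h≤2*2^h t)) (≤-reflexive (trans (lem₃ (2 ^ t)) (cong (2 *_) (sym (^-distribˡ-+-* 2 t t)))))
      where
      lem₃ : ∀ x → x * (2 * x) ≡ 2 * (x * x)
      lem₃ = solve-∀

  -- One factor 4096 is 2 · 2048 from `off≤`, the other is 64² from n ≤ 64 t, and 4096² = 256³ ≤ s³.
  size : 4096 * s ^ 5 * n ≤ t * t
  size = *-cancelˡ-≤ 4096 (begin
    4096 * (4096 * s ^ 5 * n) ≡⟨ lem₁ 4096 (s ^ 5) n ⟩
    4096 * 4096 * s ^ 5 * n ≤⟨ *-monoˡ-≤ n (≤-trans (*-monoˡ-≤ (s ^ 5) (*-mono-≤ (*-mono-≤ 256≤s 256≤s) 256≤s)) (≤-trans (≤-reflexive (lem₂ s (s ^ 5))) s^8≤n)) ⟩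
    n * n ≤⟨ *-mono-≤ n≤64t n≤64t ⟩
    64 * t * (64 * t) ≡⟨ lem₃ 64 t ⟩
    64 * 64 * (t * t) ∎)
    where
    lem₁ : ∀ k x n → k * (k * x * n) ≡ k * k * x * n
    lem₁ = solve-∀
    lem₂ : ∀ s x → s * s * s * x ≡ s * (s * (s * x))
    lem₂ = solve-∀
    lem₃ : ∀ k t → k * t * (k * t) ≡ k * k * (t * t)
    lem₃ = solve-∀

  off≤ : off * (2 * n) ≤ 2 ^ n
  off≤ = *-cancelʳ-≤ (off * (2 * n)) Y (t * t) {{>-nonZero 1≤tt}} (begin
    off * (2 * n) * (t * t) ≡⟨ lem₁ off (2 * n) (t * t) ⟩
    2 * n * (off * (t * t)) ≤⟨ *-monoʳ-≤ (2 * n) off-t² ⟩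
    2 * n * (2048 * s ^ 5 * Y) ≡⟨ lem₂ 2 n 2048 (s ^ 5) Y ⟩
    Y * (2 * 2048 * s ^ 5 * n) ≤⟨ *-monoʳ-≤ Y size ⟩
    Y * (t * t) ∎)
    where
    1≤tt : 1 ≤ t * t
    1≤tt = ≤-trans (*-mono-≤ {1} {4096 * s ^ 5} (*-mono-≤ {1} {4096} (s≤s z≤n) (1≤m^n s 5 1≤s)) 1≤n) size
    lem₁ : ∀ o m x → o * m * x ≡ m * (o * x)
    lem₁ = solve-∀
    lem₂ : ∀ a n b x y → a * n * (b * x * y) ≡ y * (a * b * x * n)
    lem₂ = solve-∀

  V-lower : 2 ^ n * weightedV s ≤ 4 * n * V (2 ^ n) * 2 ^ s
  V-lower = Mass.V-lower n s s≤n room off≤ 1≤n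

-- Comparison of V and S

2^log₂≤ : ∀ n → 1 ≤ n → 2 ^ ⌊log₂ n ⌋ ≤ n
2^log₂≤ = <-rec _ go
  where
  go : ∀ n → (∀ {m} → m < n → 1 ≤ m → 2 ^ ⌊log₂ m ⌋ ≤ m) → 1 ≤ n → 2 ^ ⌊log₂ n ⌋ ≤ n
  go 1 _ _ = ≤-refl
  go n@(suc (suc m)) rec _ = begin
    2 ^ ⌊log₂ n ⌋ ≡⟨ cong (2 ^_) (suc-injective (lg-half n (s≤s (s≤s z≤n)))) ⟨
    2 * 2 ^ ⌊log₂ ⌊ n /2⌋ ⌋ ≤⟨ *-monoʳ-≤ 2 (rec (⌊n/2⌋<n (suc m)) (s≤s z≤n)) ⟩
    2 * ⌊ n /2⌋ ≡⟨ cong (⌊ n /2⌋ +_) (+-identityʳ ⌊ n /2⌋) ⟩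
    ⌊ n /2⌋ + ⌊ n /2⌋ ≤⟨ +-monoʳ-≤ ⌊ n /2⌋ (⌊n/2⌋≤⌈n/2⌉ n) ⟩
    ⌊ n /2⌋ + ⌈ n /2⌉ ≡⟨ ⌊n/2⌋+⌈n/2⌉≡n n ⟩
    n ∎
    where open ≤-Reasoning

^-distribʳ-* : ∀ e x y → (x * y) ^ e ≡ x ^ e * y ^ e
^-distribʳ-* zero x y = refl
^-distribʳ-* (suc e) x y = trans (cong (x * y *_) (^-distribʳ-* e x y)) (lem x y (x ^ e) (y ^ e))
  where
  lem : ∀ x y a b → x * y * (a * b) ≡ x * a * (y * b)
  lem = solve-∀

≤-log₂ : ∀ x n → 2 ^ x ≤ n → x ≤ ⌊log₂ n ⌋
≤-log₂ x n h = ≤-trans (≤-reflexive (sym (⌊log₂[2^n]⌋≡n x))) (⌊log₂⌋-mono-≤ h)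

-- The case k of Erdős's bound V(x) ≫ x (log log x)^k / log x, at x = 2^n.
LowerBound : ℕ → Set
LowerBound k = ∃[ D ] ∃[ n₀ ] (1 ≤ D × (∀ n → n₀ ≤ n → 2 ^ n * ⌊log₂ n ⌋ ^ k ≤ D * (n * V (2 ^ n))))

-- With μ the scale, s = 2 ^ (2 μ) has s ^ 8 = 2 ^ (16 μ) ≤ n. The double exponent 2 μ leaves μ
-- dyadic blocks, from 2 ^ μ to 2 ^ (2 μ), in which every index has a logarithm of at least μ.
scale : ℕ → ℕ
scale n = ⌊log₂ n ⌋ / 16

V-at-scale : ∀ n → 4 ≤ scale n → let s = 2 ^ (scale n + scale n) in 2 ^ n * weightedV s ≤ 4 * n * V (2 ^ n) * 2 ^ s
V-at-scale n 4≤μ = Parameters.V-lower n s 256≤s s^8≤n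
  where
  open ≤-Reasoning
  μ s : ℕ
  μ = scale n
  s = 2 ^ (μ + μ)
  256≤s : 256 ≤ s
  256≤s = ^-monoʳ-≤ 2 (+-mono-≤ 4≤μ 4≤μ)
  s^8≤n : s ^ 8 ≤ n
  s^8≤n = begin
    s ^ 8 ≡⟨ ^-*-assoc 2 (μ + μ) 8 ⟩
    2 ^ ((μ + μ) * 8) ≡⟨ cong (2 ^_) (lem μ) ⟩
    2 ^ (μ * 16) ≤⟨ ^-monoʳ-≤ 2 (m/n*n≤m ⌊log₂ n ⌋ 16) ⟩
    2 ^ ⌊log₂ n ⌋ ≤⟨ 2^log₂≤ n (positive n 4≤μ) ⟩
    n ∎
    where
    positive : ∀ n → 4 ≤ scale n → 1 ≤ n
    positive (suc _) _ = s≤s z≤n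
    lem : ∀ μ → (μ + μ) * 8 ≡ μ * 16
    lem = solve-∀

scale-large : ∀ n x → 2 ^ (x * 16) ≤ n → x ≤ scale n
scale-large n x h = ≤-trans (≤-reflexive (sym (m*n/n≡m x 16))) (/-monoˡ-≤ 16 (≤-log₂ (x * 16) n h))

-- The totient 1 already makes `weightedV s` at least half of 2 ^ s.
lowerBound-zero : LowerBound 0
lowerBound-zero = 8 , 2 ^ (4 * 16) , s≤s z≤n , λ n n₀≤n → bound n (scale-large n 4 n₀≤n)
  where
  open ≤-Reasoning
  bound : ∀ n → 4 ≤ scale n → 2 ^ n * 1 ≤ 8 * (n * V (2 ^ n))
  bound n 4≤μ = *-cancelʳ-≤ _ _ (2 ^ s) {{m^n≢0 2 s}} (begin
    2 ^ n * 1 * 2 ^ s ≤⟨ *-monoʳ-≤ (2 ^ n * 1) 2^s≤ ⟩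
    2 ^ n * 1 * (2 * weightedV s) ≡⟨ lem₁ (2 ^ n) (weightedV s) ⟩
    2 * (2 ^ n * weightedV s) ≤⟨ *-monoʳ-≤ 2 (V-at-scale n 4≤μ) ⟩
    2 * (4 * n * V (2 ^ n) * 2 ^ s) ≡⟨ lem₂ n (V (2 ^ n)) (2 ^ s) ⟩
    8 * (n * V (2 ^ n)) * 2 ^ s ∎)
    where
    s : ℕ
    s = 2 ^ (scale n + scale n)
    lem₁ : ∀ x w → x * 1 * (2 * w) ≡ 2 * (x * w)
    lem₁ = solve-∀
    lem₂ : ∀ n v e → 2 * (4 * n * v * e) ≡ 8 * (n * v) * e
    lem₂ = solve-∀
    1≤weightedV : 1 ≤ weightedV s
    1≤weightedV = ≤-pred (≤-trans (*-monoʳ-≤ 2 (m^n>0 2 (s ∸ 1))) (≤-trans (≤-reflexive (cong (2 ^_) (m+[n∸m]≡n {1} (m^n>0 2 (scale n + scale n))))) (2^≤1+weightedV s)))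
    2^s≤ : 2 ^ s ≤ 2 * weightedV s
    2^s≤ = ≤-trans (2^≤1+weightedV s) (≤-trans (+-monoˡ-≤ (weightedV s) 1≤weightedV) (≤-reflexive (cong (weightedV s +_) (sym (+-identityʳ (weightedV s))))))

-- Consider weightedV i / 2 ^ i. By the case k each of the 2 ^ a steps from i = 2 ^ a to 2 ^ (a + 1)
-- adds at least a ^ k / (2 D 2 ^ (a + 1)), so the block adds a ^ k / (4 D). The μ blocks with μ ≤ a
-- < 2 μ together give μ ^ (k + 1) / (4 D).
lowerBound-suc : ∀ k → LowerBound k → LowerBound (suc k)
-- 32 ^ (k + 1) comes from log₂ n ≤ 32 μ. In the threshold, 4 ensures s ≥ 256 and n₀ ensures n₀ ≤ 2
-- ^ μ, where the case k begins to apply.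
lowerBound-suc k (D , n₀ , 1≤D , lower) = 16 * D * 32 ^ suc k , 2 ^ ((4 + n₀) * 16) ,
    *-mono-≤ {1} {16 * D} (*-mono-≤ {1} {16} (s≤s z≤n) 1≤D) (1≤m^n 32 (suc k) (s≤s z≤n)) , λ n n₁≤n → bound n (scale-large n (4 + n₀) n₁≤n)
  where
  open ≤-Reasoning
  block-term : ∀ a m → n₀ ≤ 2 ^ a → m < 2 ^ a → 2 ^ (2 ^ a + m) * a ^ k ≤ D * 2 ^ suc a * V (2 ^ (2 ^ a + m))
  block-term a m n₀≤ m< = begin
    2 ^ i * a ^ k ≤⟨ *-monoʳ-≤ (2 ^ i) (^-monoˡ-≤ k (≤-log₂ a i (m≤m+n (2 ^ a) m))) ⟩
    2 ^ i * ⌊log₂ i ⌋ ^ k ≤⟨ lower i (≤-trans n₀≤ (m≤m+n (2 ^ a) m)) ⟩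
    D * (i * V (2 ^ i)) ≤⟨ *-monoʳ-≤ D (*-monoˡ-≤ (V (2 ^ i)) (+-monoʳ-≤ (2 ^ a) (≤-trans (<⇒≤ m<) (≤-reflexive (sym (+-identityʳ (2 ^ a))))))) ⟩
    D * (2 ^ suc a * V (2 ^ i)) ≡⟨ *-assoc D (2 ^ suc a) _ ⟨
    D * 2 ^ suc a * V (2 ^ i) ∎
    where
    i : ℕ
    i = 2 ^ a + m
  block : ∀ a m → n₀ ≤ 2 ^ a → m ≤ 2 ^ a →
    2 * (D * 2 ^ suc a) * (2 ^ m * weightedV (2 ^ a)) + m * (2 ^ (2 ^ a + m) * a ^ k) ≤ 2 * (D * 2 ^ suc a) * weightedV (2 ^ a + m)
  block a zero _ _ = ≤-reflexive (trans (+-identityʳ _) (cong (2 * (D * 2 ^ suc a) *_) (trans (*-identityˡ _) (cong weightedV (sym (+-identityʳ (2 ^ a)))))))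
  block a (suc m) n₀≤ m< = begin
    2 * D′ * (2 * 2 ^ m * weightedV (2 ^ a)) + suc m * (2 ^ (2 ^ a + suc m) * a ^ k) ≡⟨ cong (λ x → 2 * D′ * (2 * 2 ^ m * weightedV (2 ^ a)) + suc m * (2 ^ x * a ^ k)) (+-suc (2 ^ a) m) ⟩
    2 * D′ * (2 * 2 ^ m * weightedV (2 ^ a)) + suc m * (2 * 2 ^ (2 ^ a + m) * a ^ k) ≡⟨ lem₁ D′ (2 ^ m) (weightedV (2 ^ a)) m (2 ^ (2 ^ a + m)) (a ^ k) ⟩
    2 * (2 * D′ * (2 ^ m * weightedV (2 ^ a)) + m * (2 ^ (2 ^ a + m) * a ^ k)) + 2 * (2 ^ (2 ^ a + m) * a ^ k)
      ≤⟨ +-mono-≤ (*-monoʳ-≤ 2 (block a m n₀≤ (<⇒≤ m<))) (*-monoʳ-≤ 2 (block-term a m n₀≤ m<)) ⟩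
    2 * (2 * D′ * weightedV (2 ^ a + m)) + 2 * (D′ * V (2 ^ (2 ^ a + m))) ≡⟨ lem₂ D′ (weightedV (2 ^ a + m)) (V (2 ^ (2 ^ a + m))) ⟩
    2 * D′ * (2 * weightedV (2 ^ a + m) + V (2 ^ (2 ^ a + m))) ≡⟨ cong (λ x → 2 * D′ * weightedV x) (+-suc (2 ^ a) m) ⟨
    2 * D′ * weightedV (2 ^ a + suc m) ∎
    where
    D′ : ℕ
    D′ = D * 2 ^ suc a
    lem₁ : ∀ D x w m y z → 2 * D * (2 * x * w) + suc m * (2 * y * z) ≡ 2 * (2 * D * (x * w) + m * (y * z)) + 2 * (y * z)
    lem₁ = solve-∀
    lem₂ : ∀ D w v → 2 * (2 * D * w) + 2 * (D * v) ≡ 2 * D * (2 * w + v)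
    lem₂ = solve-∀
  doubling : ∀ a → n₀ ≤ 2 ^ a → 4 * D * (2 ^ (2 ^ a) * weightedV (2 ^ a)) + 2 ^ (2 ^ suc a) * a ^ k ≤ 4 * D * weightedV (2 ^ suc a)
  doubling a n₀≤ = *-cancelˡ-≤ (2 ^ a) {{m^n≢0 2 a}} (begin
    2 ^ a * (4 * D * (2 ^ (2 ^ a) * weightedV (2 ^ a)) + 2 ^ (2 ^ suc a) * a ^ k) ≡⟨ lem₁ (2 ^ a) D (2 ^ (2 ^ a) * weightedV (2 ^ a)) (2 ^ (2 ^ suc a) * a ^ k) ⟩
    2 * (D * 2 ^ suc a) * (2 ^ (2 ^ a) * weightedV (2 ^ a)) + 2 ^ a * (2 ^ (2 ^ suc a) * a ^ k) ≡⟨ cong (λ x → 2 * (D * 2 ^ suc a) * (2 ^ (2 ^ a) * weightedV (2 ^ a)) + 2 ^ a * (2 ^ x * a ^ k)) (cong (2 ^ a +_) (+-identityʳ (2 ^ a))) ⟩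
    2 * (D * 2 ^ suc a) * (2 ^ (2 ^ a) * weightedV (2 ^ a)) + 2 ^ a * (2 ^ (2 ^ a + 2 ^ a) * a ^ k) ≤⟨ block a (2 ^ a) n₀≤ ≤-refl ⟩
    2 * (D * 2 ^ suc a) * weightedV (2 ^ a + 2 ^ a) ≡⟨ cong (λ x → 2 * (D * 2 ^ suc a) * weightedV (2 ^ a + x)) (+-identityʳ (2 ^ a)) ⟨
    2 * (D * 2 ^ suc a) * weightedV (2 ^ suc a) ≡⟨ lem₂ (2 ^ a) D (weightedV (2 ^ suc a)) ⟩
    2 ^ a * (4 * D * weightedV (2 ^ suc a)) ∎)
    where
    lem₁ : ∀ p D x y → p * (4 * D * x + y) ≡ 2 * (D * (2 * p)) * x + p * y
    lem₁ = solve-∀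
    lem₂ : ∀ p D w → 2 * (D * (2 * p)) * w ≡ p * (4 * D * w)
    lem₂ = solve-∀
  climb : ∀ μ j → n₀ ≤ 2 ^ μ → j * (2 ^ (2 ^ (μ + j)) * μ ^ k) ≤ 4 * D * weightedV (2 ^ (μ + j))
  climb μ zero _ = z≤n
  climb μ (suc j) n₀≤ = begin
    suc j * (2 ^ (2 ^ (μ + suc j)) * μ ^ k) ≡⟨ cong (λ x → suc j * (2 ^ (2 ^ x) * μ ^ k)) (+-suc μ j) ⟩
    suc j * (2 ^ (2 ^ suc a) * μ ^ k) ≡⟨ +-comm (2 ^ (2 ^ suc a) * μ ^ k) _ ⟩
    j * (2 ^ (2 ^ suc a) * μ ^ k) + 2 ^ (2 ^ suc a) * μ ^ k ≡⟨ cong (λ x → j * (x * μ ^ k) + 2 ^ (2 ^ suc a) * μ ^ k) (trans (cong (λ x → 2 ^ (2 ^ a + x)) (+-identityʳ (2 ^ a))) (^-distribˡ-+-* 2 (2 ^ a) (2 ^ a))) ⟩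
    j * (2 ^ (2 ^ a) * 2 ^ (2 ^ a) * μ ^ k) + 2 ^ (2 ^ suc a) * μ ^ k ≡⟨ cong (_+ 2 ^ (2 ^ suc a) * μ ^ k) (lem₁ j (2 ^ (2 ^ a)) (μ ^ k)) ⟩
    2 ^ (2 ^ a) * (j * (2 ^ (2 ^ a) * μ ^ k)) + 2 ^ (2 ^ suc a) * μ ^ k ≤⟨ +-mono-≤ (*-monoʳ-≤ (2 ^ (2 ^ a)) (climb μ j n₀≤)) (*-monoʳ-≤ (2 ^ (2 ^ suc a)) (^-monoˡ-≤ k (m≤m+n μ j))) ⟩
    2 ^ (2 ^ a) * (4 * D * weightedV (2 ^ a)) + 2 ^ (2 ^ suc a) * a ^ k ≡⟨ cong (_+ 2 ^ (2 ^ suc a) * a ^ k) (lem₂ (2 ^ (2 ^ a)) (4 * D) (weightedV (2 ^ a))) ⟩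
    4 * D * (2 ^ (2 ^ a) * weightedV (2 ^ a)) + 2 ^ (2 ^ suc a) * a ^ k ≤⟨ doubling a (≤-trans n₀≤ (^-monoʳ-≤ 2 (m≤m+n μ j))) ⟩
    4 * D * weightedV (2 ^ suc a) ≡⟨ cong (λ x → 4 * D * weightedV (2 ^ x)) (+-suc μ j) ⟨
    4 * D * weightedV (2 ^ (μ + suc j)) ∎
    where
    a : ℕ
    a = μ + j
    lem₁ : ∀ j p x → j * (p * p * x) ≡ p * (j * (p * x))
    lem₁ = solve-∀
    lem₂ : ∀ p d w → p * (d * w) ≡ d * (p * w)
    lem₂ = solve-∀
  bound : ∀ n → 4 + n₀ ≤ scale n → 2 ^ n * ⌊log₂ n ⌋ ^ suc k ≤ 16 * D * 32 ^ suc k * (n * V (2 ^ n))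
  bound n h = begin
    2 ^ n * ⌊log₂ n ⌋ ^ suc k ≤⟨ *-monoʳ-≤ (2 ^ n) (^-monoˡ-≤ (suc k) log≤32μ) ⟩
    2 ^ n * (32 * μ) ^ suc k ≡⟨ cong (2 ^ n *_) (^-distribʳ-* (suc k) 32 μ) ⟩
    2 ^ n * (32 ^ suc k * μ ^ suc k) ≡⟨ lem₁ (2 ^ n) (32 ^ suc k) (μ ^ suc k) ⟩
    32 ^ suc k * (2 ^ n * μ ^ suc k) ≤⟨ *-monoʳ-≤ (32 ^ suc k) core ⟩
    32 ^ suc k * (16 * D * (n * V (2 ^ n))) ≡⟨ lem₂ (32 ^ suc k) (16 * D) (n * V (2 ^ n)) ⟩
    16 * D * 32 ^ suc k * (n * V (2 ^ n)) ∎
    where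
    μ s : ℕ
    μ = scale n
    s = 2 ^ (μ + μ)
    lem₁ : ∀ x y z → x * (y * z) ≡ y * (x * z)
    lem₁ = solve-∀
    lem₂ : ∀ x y z → x * (y * z) ≡ y * x * z
    lem₂ = solve-∀
    lem₃ : ∀ m e x n → n * (m * x) * e ≡ n * (m * (e * x))
    lem₃ = solve-∀
    lem₄ : ∀ d x w → x * (4 * d * w) ≡ 4 * d * (x * w)
    lem₄ = solve-∀
    lem₅ : ∀ d n v e → 4 * d * (4 * n * v * e) ≡ 16 * d * (n * v) * e
    lem₅ = solve-∀
    1≤μ : 1 ≤ μ
    1≤μ = ≤-trans (m≤m+n 1 (3 + n₀)) h
    log≤32μ : ⌊log₂ n ⌋ ≤ 32 * μ
    log≤32μ = begin
      ⌊log₂ n ⌋ ≡⟨ m≡m%n+[m/n]*n ⌊log₂ n ⌋ 16 ⟩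
      ⌊log₂ n ⌋ % 16 + μ * 16 ≤⟨ +-monoˡ-≤ (μ * 16) (≤-trans (m%n≤n ⌊log₂ n ⌋ 16) (m≤n*m 16 μ {{>-nonZero 1≤μ}})) ⟩
      μ * 16 + μ * 16 ≡⟨ *-distribˡ-+ μ 16 16 ⟨
      μ * 32 ≡⟨ *-comm μ 32 ⟩
      32 * μ ∎
    n₀≤2^μ : n₀ ≤ 2 ^ μ
    n₀≤2^μ = ≤-trans (≤-trans (m≤n+m n₀ 4) h) (<⇒≤ (n<2^n μ))
    core : 2 ^ n * μ ^ suc k ≤ 16 * D * (n * V (2 ^ n))
    core = *-cancelʳ-≤ _ _ (2 ^ s) {{m^n≢0 2 s}} (begin
      2 ^ n * (μ * μ ^ k) * 2 ^ s ≡⟨ lem₃ μ (2 ^ s) (μ ^ k) (2 ^ n) ⟩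
      2 ^ n * (μ * (2 ^ s * μ ^ k)) ≤⟨ *-monoʳ-≤ (2 ^ n) (climb μ μ n₀≤2^μ) ⟩
      2 ^ n * (4 * D * weightedV s) ≡⟨ lem₄ D (2 ^ n) (weightedV s) ⟩
      4 * D * (2 ^ n * weightedV s) ≤⟨ *-monoʳ-≤ (4 * D) (V-at-scale n (≤-trans (m≤m+n 4 n₀) h)) ⟩
      4 * D * (4 * n * V (2 ^ n) * 2 ^ s) ≡⟨ lem₅ D n (V (2 ^ n)) (2 ^ s) ⟩
      16 * D * (n * V (2 ^ n)) * 2 ^ s ∎)

lowerBound : ∀ k → LowerBound k
lowerBound zero = lowerBound-zero
lowerBound (suc k) = lowerBound-suc k (lowerBound k)

-- With exponent ℓ + 2 for V against ℓ + 1 for S, one factor log₂ i is left over and eventually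
-- beats all constants. For 2 ^ i ≤ N < 2 ^ (i + 1), S is bounded at the upper end and V at the
-- lower.
S-eventually-small : ∀ ℓ → LowerBound (suc (suc ℓ)) → ∃[ M ] (∀ N → M ≤ N → 2 ^ ℓ * S ℓ N ≤ V N)
S-eventually-small ℓ (D , n₀ , 1≤D , lower) = 2 ^ i₀ , at
  where
  open ≤-Reasoning
  r C′ L₀ i₀ : ℕ
  r = suc ℓ
  C′ = 81 ^ r * 2 ^ r * 2 ^ (r + 1)
  -- The summand 2 gives lg m ≤ 2 + λ′ ≤ 2 λ′, the other absorbs the constants. In `i₀`, the part r
  -- + 1 gives m ≤ 2 i and 2 ^ L₀ forces log₂ i ≥ L₀.
  L₀ = 2 + 2 ^ ℓ * D * C′
  i₀ = n₀ + (r + 1 + 2 ^ L₀)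
  at : ∀ N → 2 ^ i₀ ≤ N → 2 ^ ℓ * S ℓ N ≤ V N
  at N M≤N with dyadic N N (≤-trans (m^n>0 2 i₀) M≤N) (n<2^n N)
  ... | i , _ , 2^i≤N , N<2^1+i = begin
    2 ^ ℓ * S ℓ N ≤⟨ *-monoʳ-≤ (2 ^ ℓ) (S-upper ℓ (suc i) N N<2^1+i) ⟩
    2 ^ ℓ * len ≤⟨ *-cancelˡ-≤ (D * i) {{>-nonZero (*-mono-≤ 1≤D 1≤i)}} main ⟩
    V (2 ^ i) ≤⟨ count-mono _ 2^i≤N ⟩
    V N ∎
    where
    m len λ′ : ℕ
    m = r + suc i
    len = length (smallPowerProducts r m)
    λ′ = ⌊log₂ i ⌋
    i₀≤i : i₀ ≤ i
    i₀≤i = ≤-pred (2^-cancel-< i₀ (suc i) (≤-<-trans M≤N N<2^1+i))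
      where
      2^-cancel-< : ∀ a b → 2 ^ a < 2 ^ b → a < b
      2^-cancel-< a b h with b ≤? a
      ... | yes b≤a = contradiction h (≤⇒≯ (^-monoʳ-≤ 2 b≤a))
      ... | no b≰a = ≰⇒> b≰a
    rest≤i : r + 1 + 2 ^ L₀ ≤ i
    rest≤i = ≤-trans (m≤n+m _ n₀) i₀≤i
    r+1≤i : r + 1 ≤ i
    r+1≤i = ≤-trans (m≤m+n (r + 1) _) rest≤i
    1≤i : 1 ≤ i
    1≤i = ≤-trans (s≤s z≤n) r+1≤i
    L₀≤λ : L₀ ≤ λ′
    L₀≤λ = ≤-log₂ L₀ i (≤-trans (m≤n+m _ (r + 1)) rest≤i)
    lg≤ : lg m ≤ 2 * λ′
    lg≤ = begin
      suc ⌊log₂ m ⌋ ≤⟨ s≤s (⌊log₂⌋-mono-≤ m≤2i) ⟩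
      suc ⌊log₂ 2 * i ⌋ ≡⟨ cong suc (⌊log₂[2*b]⌋≡1+⌊log₂b⌋ i {{>-nonZero 1≤i}}) ⟩
      2 + λ′ ≤⟨ +-monoˡ-≤ λ′ (≤-trans (m≤m+n 2 _) L₀≤λ) ⟩
      λ′ + λ′ ≡⟨ cong (λ′ +_) (+-identityʳ λ′) ⟨
      2 * λ′ ∎
      where
      m≤2i : m ≤ 2 * i
      m≤2i = ≤-trans (≤-reflexive (sym (+-assoc r 1 i))) (≤-trans (+-monoˡ-≤ i r+1≤i) (≤-reflexive (cong (i +_) (sym (+-identityʳ i)))))
    upper : i * len ≤ C′ * (λ′ ^ r * 2 ^ i)
    upper = begin
      i * len ≤⟨ *-monoˡ-≤ len (≤-trans (n≤1+n i) (m≤n+m (suc i) r)) ⟩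
      m * len ≤⟨ length-smallPowerProducts r m (≤-trans (s≤s z≤n) (m≤m+n r (suc i))) ⟩
      81 ^ r * lg m ^ r * 2 ^ m ≤⟨ *-monoˡ-≤ (2 ^ m) (*-monoʳ-≤ (81 ^ r) (^-monoˡ-≤ r lg≤)) ⟩
      81 ^ r * (2 * λ′) ^ r * 2 ^ m ≡⟨ cong₂ (λ x y → 81 ^ r * x * y) (^-distribʳ-* r 2 λ′)
        (trans (cong (2 ^_) (sym (+-assoc r 1 i))) (^-distribˡ-+-* 2 (r + 1) i)) ⟩
      81 ^ r * (2 ^ r * λ′ ^ r) * (2 ^ (r + 1) * 2 ^ i) ≡⟨ lem (81 ^ r) (2 ^ r) (λ′ ^ r) (2 ^ (r + 1)) (2 ^ i) ⟩
      C′ * (λ′ ^ r * 2 ^ i) ∎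
      where
      lem : ∀ a b c d e → a * (b * c) * (d * e) ≡ a * b * d * (c * e)
      lem = solve-∀
    main : D * i * (2 ^ ℓ * len) ≤ D * i * V (2 ^ i)
    main = begin
      D * i * (2 ^ ℓ * len) ≡⟨ lem₁ D i (2 ^ ℓ) len ⟩
      2 ^ ℓ * D * (i * len) ≤⟨ *-monoʳ-≤ (2 ^ ℓ * D) upper ⟩
      2 ^ ℓ * D * (C′ * (λ′ ^ r * 2 ^ i)) ≡⟨ *-assoc (2 ^ ℓ * D) C′ _ ⟨
      2 ^ ℓ * D * C′ * (λ′ ^ r * 2 ^ i) ≤⟨ *-monoˡ-≤ (λ′ ^ r * 2 ^ i) (≤-trans (m≤n+m _ 2) L₀≤λ) ⟩
      λ′ * (λ′ ^ r * 2 ^ i) ≡⟨ lem₂ λ′ (λ′ ^ r) (2 ^ i) ⟩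
      2 ^ i * λ′ ^ suc r ≤⟨ lower i (≤-trans (m≤m+n n₀ _) i₀≤i) ⟩
      D * (i * V (2 ^ i)) ≡⟨ *-assoc D i _ ⟨
      D * i * V (2 ^ i) ∎
      where
      lem₁ : ∀ d i x l → d * i * (x * l) ≡ x * d * (i * l)
      lem₁ = solve-∀
      lem₂ : ∀ a b c → a * (b * c) ≡ c * (a * b)
      lem₂ = solve-∀

search-good : ∀ N ℓ fuel {v} → search N ℓ fuel ≡ just v → T (good N v)
search-good N ℓ (suc fuel) eq with good N ℓ in g
search-good N ℓ (suc fuel) refl | true = subst T (sym g) _
... | false = search-good N (suc ℓ) fuel eq

theorem3p8 : (ℓ₀ : ℕ) → LiminfIs ℓ₀ → (n : ℕ) → UnboundedOn (ℓ₀ + n)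
theorem3p8 ℓ₀ (recurs , _) n = refute (S-eventually-small ℓ₀ (lowerBound (suc (suc ℓ₀))))
  where
  refute : ∃[ M ] (∀ N → M ≤ N → 2 ^ ℓ₀ * S ℓ₀ N ≤ V N) → UnboundedOn (ℓ₀ + n)
  -- A finite liminf of integers is attained at arbitrarily large N, and there the search has found
  -- ℓ₀ to be good, against `small`.
  refute (M , small) with recurs M
  ... | N , M≤N , eq = contradiction (small N M≤N) (<⇒≱ (<ᵇ⇒< (V N) (2 ^ ℓ₀ * S ℓ₀ N) (search-good N 2 (⌊log₂ N ⌋ ∸ 1) eq)))
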